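{- Let $G\neq K_n$ be a simple graph with $n$ vertices and maximum degree $\Delta$. (i) If $0\leq \alpha< \frac{1}{\Delta+1}$, then $S_k(A_{\alpha}(G))\leq \frac{(1-\alpha)n}{2}(1+\sqrt{k})$ for every $2\leq k\leq n$. (ii) If $\frac{1}{\Delta+1}\leq \alpha< 1$, then $S_k(A_{\alpha}(G))\leq \frac{\alpha \Delta n}{2}(1+\sqrt{k})$ for every $2\leq k\leq n$.
   Context: All graphs are simple and undirected. For a graph $G$ with adjacency matrix $A(G)$ and diagonal degree matrix $D(G)$, and a real $\alpha\in[0,1]$, $A_{\alpha}(G)=\alpha D(G)+(1-\alpha)A(G)$. For a real symmetric $n\times n$ matrix $M$ with eigenvalues $\lambda_1(M)\geq\cdots\geq\lambda_n(M)$, $S_k(M)=\sum_{i=1}^k\lambda_i(M)$. $K_n$ is the complete graph on $n$ vertices. -}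

module Defs where

open import Algebra.Bundles.Raw using (RawRing)
import Algebra.Definitions.RawMonoid as RawMonoidOps
open import Data.Bool.Base using (Bool; true; false; not; if_then_else_)
open import Data.Fin.Base as Fin using (Fin; zero; suc; punchIn; inject≤)
open import Data.Fin.Properties using (_≟_)
open import Data.Fin.Subset using (∣_∣)
open import Data.Integer.Base as ℤ using (+_; +[1+_]; -[1+_]; +0)
import Data.Integer.Properties as ℤ
import Data.Integer.Solver as ℤ-Solver
open import Data.Nat.Base as ℕ using (ℕ; zero; suc)
import Data.Nat.Properties as ℕ
import Data.Nat.Solver as ℕ-Solver
open import Data.Product.Base using (∃; _×_; _,_; proj₁; proj₂)
open import Data.Rational.Base as ℚ using (ℚ; 0ℚ; 1ℚ; ½; mkℚ)
import Data.Rational.Properties as ℚ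
open import Data.Rational.Solver using (module +-*-Solver)
import Data.Rational.Unnormalised.Base as ℚᵘ
import Data.Rational.Unnormalised.Properties as ℚᵘ
open import Data.Sum.Base using (inj₁; inj₂)
open import Data.Vec.Base using (tabulate)
open import Data.Vec.Functional using (Vector; foldr)
open import Level using (0ℓ)
open import Relation.Binary.PropositionalEquality
  using (_≡_; refl; sym; trans; cong; cong₂; subst; subst₂; module ≡-Reasoning)
open import Relation.Nullary.Decidable using (yes; no; ⌊_⌋)
open import Relation.Nullary.Negation using (¬_)

-- A real is a Cauchy sequence of rationals together with its modulus of
-- convergence; equality of reals is _≈_, not _≡_.

IsCauchy : (ℕ → ℚ) → Set
IsCauchy s = ∀ ε → 0ℚ ℚ.< ε →
  ∃ λ N → ∀ m n → N ℕ.≤ m → N ℕ.≤ n → ℚ.∣ s m ℚ.- s n ∣ ℚ.< ε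

record ℝ : Set where
  no-eta-equality
  constructor mkℝ
  field
    seq    : ℕ → ℚ
    cauchy : IsCauchy seq

open ℝ public

infix 4 _<_ _≤_ _≈_

record _<_ (x y : ℝ) : Set where
  constructor mk<
  field
    gap   : ℚ
    gap>0 : 0ℚ ℚ.< gap
    index : ℕ
    apart : ∀ n → index ℕ.≤ n → seq x n ℚ.+ gap ℚ.≤ seq y n

_≤_ : ℝ → ℝ → Set
x ≤ y = ¬ (y < x)

_≈_ : ℝ → ℝ → Set
x ≈ y = x ≤ y × y ≤ x

-- The moduli are never computed with, so they are kept from unfolding.
private abstract
  half>0 : ∀ {ε} → 0ℚ ℚ.< ε → 0ℚ ℚ.< ½ ℚ.* ε
  half>0 {ε} ε>0 =
    subst (ℚ._< ½ ℚ.* ε) (ℚ.*-zeroʳ ½) (ℚ.*-monoʳ-<-pos ½ ε>0)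

  halves : ∀ ε → ½ ℚ.* ε ℚ.+ ½ ℚ.* ε ≡ ε
  halves ε = trans (sym (ℚ.*-distribʳ-+ ε ½ ½)) (ℚ.*-identityˡ ε)

  bounded : ∀ {s} → IsCauchy s →
            ∃ λ B → 0ℚ ℚ.< B × ∃ λ N → ∀ n → N ℕ.≤ n → ℚ.∣ s n ∣ ℚ.≤ B
  bounded {s} c with c 1ℚ (ℚ.positive⁻¹ 1ℚ)
  ... | N , h = B , B>0 , N , bound
    where
    B : ℚ
    B = 1ℚ ℚ.+ ℚ.∣ s N ∣
    B>0 : 0ℚ ℚ.< B
    B>0 = ℚ.+-mono-<-≤ {0ℚ} {1ℚ} (ℚ.positive⁻¹ 1ℚ) (ℚ.0≤∣p∣ (s N))
    bound : ∀ n → N ℕ.≤ n → ℚ.∣ s n ∣ ℚ.≤ B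
    bound n N≤n = begin
      ℚ.∣ s n ∣                           ≡⟨ cong ℚ.∣_∣ (split (s n) (s N)) ⟩
      ℚ.∣ (s n ℚ.- s N) ℚ.+ s N ∣         ≤⟨ ℚ.∣p+q∣≤∣p∣+∣q∣ (s n ℚ.- s N) (s N) ⟩
      ℚ.∣ s n ℚ.- s N ∣ ℚ.+ ℚ.∣ s N ∣     ≤⟨ ℚ.+-monoˡ-≤ ℚ.∣ s N ∣ (ℚ.<⇒≤ (h n N N≤n ℕ.≤-refl)) ⟩
      1ℚ ℚ.+ ℚ.∣ s N ∣                    ∎
      where
      open ℚ.≤-Reasoning
      split : ∀ a b → a ≡ (a ℚ.- b) ℚ.+ b
      split = solve 2 (λ a b → a := (a :- b) :+ b) refl where open +-*-Solver

  +-cauchy : ∀ s t → IsCauchy s → IsCauchy t → IsCauchy (λ n → s n ℚ.+ t n)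
  +-cauchy s t c d ε ε>0 with c (½ ℚ.* ε) (half>0 ε>0) | d (½ ℚ.* ε) (half>0 ε>0)
  ... | M , h | N , k = M ℕ.⊔ N , λ m n p q → begin-strict
      ℚ.∣ (s m ℚ.+ t m) ℚ.- (s n ℚ.+ t n) ∣      ≡⟨ cong ℚ.∣_∣ (regroup (s m) (t m) (s n) (t n)) ⟩
      ℚ.∣ (s m ℚ.- s n) ℚ.+ (t m ℚ.- t n) ∣      ≤⟨ ℚ.∣p+q∣≤∣p∣+∣q∣ (s m ℚ.- s n) (t m ℚ.- t n) ⟩
      ℚ.∣ s m ℚ.- s n ∣ ℚ.+ ℚ.∣ t m ℚ.- t n ∣    <⟨ ℚ.+-mono-< (h m n (ℕ.m⊔n≤o⇒m≤o M N p) (ℕ.m⊔n≤o⇒m≤o M N q))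
                                                                (k m n (ℕ.m⊔n≤o⇒n≤o M N p) (ℕ.m⊔n≤o⇒n≤o M N q)) ⟩
      ½ ℚ.* ε ℚ.+ ½ ℚ.* ε                        ≡⟨ halves ε ⟩
      ε                                          ∎
    where
    open ℚ.≤-Reasoning
    regroup : ∀ a b c d → (a ℚ.+ b) ℚ.- (c ℚ.+ d) ≡ (a ℚ.- c) ℚ.+ (b ℚ.- d)
    regroup = solve 4 (λ a b c d → (a :+ b) :- (c :+ d) := (a :- c) :+ (b :- d)) refl
      where open +-*-Solver

  neg-cauchy : ∀ s → IsCauchy s → IsCauchy (λ n → ℚ.- s n)
  neg-cauchy s c ε ε>0 with c ε ε>0
  ... | N , h = N , λ m n p q →
      subst (ℚ._< ε) (trans (sym (ℚ.∣-p∣≡∣p∣ (s m ℚ.- s n)))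
                            (cong ℚ.∣_∣ (ℚ.neg-distrib-+ (s m) (ℚ.- s n))))
            (h m n p q)

  shrink : ∀ K ε → 0ℚ ℚ.< K → 0ℚ ℚ.< ε → ∃ λ δ → 0ℚ ℚ.< δ × K ℚ.* δ ≡ ½ ℚ.* ε
  shrink K@(mkℚ +0       _ _) ε (ℚ.*<* (ℤ.+<+ ()))
  shrink K@(mkℚ -[1+ _ ] _ _) ε (ℚ.*<* ())
  shrink K@(mkℚ +[1+ _ ] _ _) ε K>0 ε>0 = ℚ.1/ K ℚ.* (½ ℚ.* ε)
    , subst (ℚ._< ℚ.1/ K ℚ.* (½ ℚ.* ε)) (ℚ.*-zeroʳ (ℚ.1/ K))
        (ℚ.*-monoʳ-<-pos (ℚ.1/ K) (half>0 ε>0))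
    , trans (sym (ℚ.*-assoc K (ℚ.1/ K) (½ ℚ.* ε)))
        (trans (cong (ℚ._* (½ ℚ.* ε)) (ℚ.*-inverseʳ K)) (ℚ.*-identityˡ (½ ℚ.* ε)))

  *-small : ∀ K δ p q → 0ℚ ℚ.< K → ℚ.∣ p ∣ ℚ.≤ K → ℚ.∣ q ∣ ℚ.< δ →
            ℚ.∣ p ℚ.* q ∣ ℚ.< K ℚ.* δ
  *-small K δ p q K>0 p≤K q<δ = begin-strict
      ℚ.∣ p ℚ.* q ∣           ≡⟨ ℚ.∣p*q∣≡∣p∣*∣q∣ p q ⟩
      ℚ.∣ p ∣ ℚ.* ℚ.∣ q ∣     ≤⟨ ℚ.*-monoʳ-≤-nonNeg ℚ.∣ q ∣ {{ℚ.∣-∣-nonNeg q}} p≤K ⟩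
      K ℚ.* ℚ.∣ q ∣           <⟨ ℚ.*-monoʳ-<-pos K {{ℚ.positive K>0}} q<δ ⟩
      K ℚ.* δ                 ∎
    where open ℚ.≤-Reasoning

  *-regroup : ∀ a b c d → a ℚ.* b ℚ.- c ℚ.* d ≡ a ℚ.* (b ℚ.- d) ℚ.+ d ℚ.* (a ℚ.- c)
  *-regroup a b c d = begin
    a ℚ.* b ℚ.- c ℚ.* d
      ≡⟨ cong (ℚ._- c ℚ.* d) (sym (ℚ.+-identityʳ (a ℚ.* b))) ⟩
    (a ℚ.* b ℚ.+ 0ℚ) ℚ.- c ℚ.* d
      ≡⟨ cong (λ z → (a ℚ.* b ℚ.+ z) ℚ.- c ℚ.* d) (sym (ℚ.+-inverseˡ (a ℚ.* d))) ⟩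
    (a ℚ.* b ℚ.+ (ℚ.- (a ℚ.* d) ℚ.+ a ℚ.* d)) ℚ.- c ℚ.* d
      ≡⟨ cong (ℚ._- c ℚ.* d) (sym (ℚ.+-assoc (a ℚ.* b) (ℚ.- (a ℚ.* d)) (a ℚ.* d))) ⟩
    ((a ℚ.* b ℚ.- a ℚ.* d) ℚ.+ a ℚ.* d) ℚ.- c ℚ.* d
      ≡⟨ ℚ.+-assoc (a ℚ.* b ℚ.- a ℚ.* d) (a ℚ.* d) (ℚ.- (c ℚ.* d)) ⟩
    (a ℚ.* b ℚ.- a ℚ.* d) ℚ.+ (a ℚ.* d ℚ.- c ℚ.* d)
      ≡⟨ cong₂ ℚ._+_ (cong (a ℚ.* b ℚ.+_) (ℚ.neg-distribʳ-* a d))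
           (cong₂ ℚ._+_ (ℚ.*-comm a d)
             (trans (cong ℚ.-_ (ℚ.*-comm c d)) (ℚ.neg-distribʳ-* d c))) ⟩
    (a ℚ.* b ℚ.+ a ℚ.* ℚ.- d) ℚ.+ (d ℚ.* a ℚ.+ d ℚ.* ℚ.- c)
      ≡⟨ cong₂ ℚ._+_ (ℚ.*-distribˡ-+ a b (ℚ.- d)) (ℚ.*-distribˡ-+ d a (ℚ.- c)) ⟨
    a ℚ.* (b ℚ.- d) ℚ.+ d ℚ.* (a ℚ.- c)
      ∎
    where open ≡-Reasoning

  *-close : ∀ K L δ γ ε p q p′ q′ → 0ℚ ℚ.< K → 0ℚ ℚ.< L →
            K ℚ.* δ ≡ ½ ℚ.* ε → L ℚ.* γ ≡ ½ ℚ.* ε →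
            ℚ.∣ p ∣ ℚ.≤ K → ℚ.∣ q′ ∣ ℚ.≤ L →
            ℚ.∣ q ℚ.- q′ ∣ ℚ.< δ → ℚ.∣ p ℚ.- p′ ∣ ℚ.< γ →
            ℚ.∣ p ℚ.* q ℚ.- p′ ℚ.* q′ ∣ ℚ.< ε
  *-close K L δ γ ε p q p′ q′ K>0 L>0 Kδ Lγ p≤K q′≤L q≈q′ p≈p′ = begin-strict
      ℚ.∣ p ℚ.* q ℚ.- p′ ℚ.* q′ ∣
        ≡⟨ cong ℚ.∣_∣ (*-regroup p q p′ q′) ⟩
      ℚ.∣ p ℚ.* (q ℚ.- q′) ℚ.+ q′ ℚ.* (p ℚ.- p′) ∣
        ≤⟨ ℚ.∣p+q∣≤∣p∣+∣q∣ (p ℚ.* (q ℚ.- q′)) (q′ ℚ.* (p ℚ.- p′)) ⟩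
      ℚ.∣ p ℚ.* (q ℚ.- q′) ∣ ℚ.+ ℚ.∣ q′ ℚ.* (p ℚ.- p′) ∣
        <⟨ ℚ.+-mono-< (*-small K δ p (q ℚ.- q′) K>0 p≤K q≈q′)
                      (*-small L γ q′ (p ℚ.- p′) L>0 q′≤L p≈p′) ⟩
      K ℚ.* δ ℚ.+ L ℚ.* γ
        ≡⟨ cong₂ ℚ._+_ Kδ Lγ ⟩
      ½ ℚ.* ε ℚ.+ ½ ℚ.* ε
        ≡⟨ halves ε ⟩
      ε ∎
    where open ℚ.≤-Reasoning

  *-cauchy : ∀ s t → IsCauchy s → IsCauchy t → IsCauchy (λ n → s n ℚ.* t n)
  *-cauchy s t c d ε ε>0 =
    let K , K>0 , N₁ , s≤K = bounded c
        L , L>0 , N₂ , t≤L = bounded d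
        δ , δ>0 , Kδ = shrink K ε K>0 ε>0
        γ , γ>0 , Lγ = shrink L ε L>0 ε>0
        N₃ , t-close = d δ δ>0
        N₄ , s-close = c γ γ>0
    in (N₁ ℕ.⊔ N₂) ℕ.⊔ (N₃ ℕ.⊔ N₄) , λ m n N≤m N≤n →
      let N₁₂≤m = ℕ.m⊔n≤o⇒m≤o (N₁ ℕ.⊔ N₂) (N₃ ℕ.⊔ N₄) N≤m
          N₁₂≤n = ℕ.m⊔n≤o⇒m≤o (N₁ ℕ.⊔ N₂) (N₃ ℕ.⊔ N₄) N≤n
          N₃₄≤m = ℕ.m⊔n≤o⇒n≤o (N₁ ℕ.⊔ N₂) (N₃ ℕ.⊔ N₄) N≤m
          N₃₄≤n = ℕ.m⊔n≤o⇒n≤o (N₁ ℕ.⊔ N₂) (N₃ ℕ.⊔ N₄) N≤n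
      in *-close K L δ γ ε (s m) (t m) (s n) (t n) K>0 L>0 Kδ Lγ
           (s≤K m (ℕ.m⊔n≤o⇒m≤o N₁ N₂ N₁₂≤m)) (t≤L n (ℕ.m⊔n≤o⇒n≤o N₁ N₂ N₁₂≤n))
           (t-close m n (ℕ.m⊔n≤o⇒m≤o N₃ N₄ N₃₄≤m) (ℕ.m⊔n≤o⇒m≤o N₃ N₄ N₃₄≤n))
           (s-close m n (ℕ.m⊔n≤o⇒n≤o N₃ N₄ N₃₄≤m) (ℕ.m⊔n≤o⇒n≤o N₃ N₄ N₃₄≤n))

infix  8 -_
infixl 7 _*_
infixl 6 _+_ _-_

fromℚ : ℚ → ℝ
fromℚ q = mkℝ (λ _ → q) λ ε ε>0 →
  0 , λ _ _ _ _ → subst (ℚ._< ε) (cong ℚ.∣_∣ (sym (ℚ.+-inverseʳ q))) ε>0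

fromℕ : ℕ → ℝ
fromℕ n = fromℚ (+ n ℚ./ 1)

0ℝ 1ℝ : ℝ
0ℝ = fromℕ 0
1ℝ = fromℕ 1

_+_ _*_ : ℝ → ℝ → ℝ
x + y = mkℝ (λ n → seq x n ℚ.+ seq y n) (+-cauchy (seq x) (seq y) (cauchy x) (cauchy y))
x * y = mkℝ (λ n → seq x n ℚ.* seq y n) (*-cauchy (seq x) (seq y) (cauchy x) (cauchy y))

-_ : ℝ → ℝ
- x = mkℝ (λ n → ℚ.- seq x n) (neg-cauchy (seq x) (cauchy x))

_-_ : ℝ → ℝ → ℝ
x - y = x + - y

ℝ-rawRing : RawRing 0ℓ 0ℓ
ℝ-rawRing = record
  { Carrier = ℝ ; _≈_ = _≈_ ; _+_ = _+_ ; _*_ = _*_ ; -_ = -_ ; 0# = 0ℝ ; 1# = 1ℝ }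

-- ⌊√m⌋
isqrt : ℕ → ℕ
isqrt zero    = 0
isqrt (suc m) with suc (isqrt m) ℕ.* suc (isqrt m) ℕ.≤? suc m
... | yes _ = suc (isqrt m)
... | no  _ = isqrt m

isqrt-spec : ∀ m → isqrt m ℕ.* isqrt m ℕ.≤ m × m ℕ.< suc (isqrt m) ℕ.* suc (isqrt m)
isqrt-spec zero    = ℕ.z≤n , ℕ.s≤s ℕ.z≤n
isqrt-spec (suc m) with isqrt-spec m | suc (isqrt m) ℕ.* suc (isqrt m) ℕ.≤? suc m
... | _ , m<  | yes r≤ = r≤ , ℕ.≤-<-trans m<
  (ℕ.*-mono-< (ℕ.n<1+n (suc (isqrt m))) (ℕ.n<1+n (suc (isqrt m))))
... | ≤m , _  | no  r≰ = ℕ.m≤n⇒m≤1+n ≤m , ℕ.≰⇒> r≰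

√-seq : ℕ → ℕ → ℚ
√-seq k m = + isqrt (k ℕ.* (suc m ℕ.* suc m)) ℚ./ suc m

private abstract
  square-cancel-< : ∀ a b → a ℕ.* a ℕ.< b ℕ.* b → a ℕ.< b
  square-cancel-< a b a²<b² = ℕ.≰⇒> λ b≤a → ℕ.<⇒≱ a²<b² (ℕ.*-mono-≤ b≤a b≤a)

  √-cross : ∀ k p q .{{_ : ℕ.NonZero p}} .{{_ : ℕ.NonZero q}} →
            isqrt (k ℕ.* (p ℕ.* p)) ℕ.* q ℕ.< suc (isqrt (k ℕ.* (q ℕ.* q))) ℕ.* p
  √-cross k p q = square-cancel-< (a ℕ.* q) (suc b ℕ.* p) (begin-strict
      (a ℕ.* q) ℕ.* (a ℕ.* q)                   ≡⟨ swap a q ⟩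
      (a ℕ.* a) ℕ.* (q ℕ.* q)                   ≤⟨ ℕ.*-monoˡ-≤ (q ℕ.* q) (proj₁ (isqrt-spec (k ℕ.* (p ℕ.* p)))) ⟩
      (k ℕ.* (p ℕ.* p)) ℕ.* (q ℕ.* q)           ≡⟨ swap′ k (p ℕ.* p) (q ℕ.* q) ⟩
      (k ℕ.* (q ℕ.* q)) ℕ.* (p ℕ.* p)           <⟨ ℕ.*-monoˡ-< (p ℕ.* p) {{ℕ.m*n≢0 p p}} (proj₂ (isqrt-spec (k ℕ.* (q ℕ.* q)))) ⟩
      (suc b ℕ.* suc b) ℕ.* (p ℕ.* p)           ≡⟨ sym (swap (suc b) p) ⟩
      (suc b ℕ.* p) ℕ.* (suc b ℕ.* p)           ∎)
    where
    open ℕ.≤-Reasoning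
    a b : ℕ
    a = isqrt (k ℕ.* (p ℕ.* p))
    b = isqrt (k ℕ.* (q ℕ.* q))
    open ℕ-Solver.+-*-Solver
    swap : ∀ x y → (x ℕ.* y) ℕ.* (x ℕ.* y) ≡ (x ℕ.* x) ℕ.* (y ℕ.* y)
    swap = solve 2 (λ x y → (x :* y) :* (x :* y) := (x :* x) :* (y :* y)) refl
    swap′ : ∀ x y z → (x ℕ.* y) ℕ.* z ≡ (x ℕ.* z) ℕ.* y
    swap′ = solve 3 (λ x y z → (x :* y) :* z := (x :* z) :* y) refl

  √-close : ∀ k m n → √-seq k m ℚ.< √-seq k n ℚ.+ (+ 1 ℚ./ suc n)
  √-close k m n = ℚ.toℚᵘ-cancel-< (begin-strict
      ℚ.toℚᵘ (√-seq k m)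
        ≃⟨ ℚ.toℚᵘ-fromℚᵘ (ℚᵘ.mkℚᵘ (+ a) m) ⟩
      ℚᵘ.mkℚᵘ (+ a) m
        <⟨ ℚᵘ.*<* (subst₂ ℤ._<_ (ℤ.pos-* a (suc n)) (ℤ.pos-* (suc b) (suc m))
                         (ℤ.+<+ (√-cross k (suc m) (suc n)))) ⟩
      ℚᵘ.mkℚᵘ (+ suc b) n
        ≃⟨ ℚᵘ.*≡* (common (+ b) (+ suc n)) ⟩
      ℚᵘ.mkℚᵘ (+ b) n ℚᵘ.+ ℚᵘ.mkℚᵘ (+ 1) n
        ≃⟨ ℚᵘ.+-cong (ℚ.toℚᵘ-fromℚᵘ (ℚᵘ.mkℚᵘ (+ b) n)) (ℚ.toℚᵘ-fromℚᵘ (ℚᵘ.mkℚᵘ (+ 1) n)) ⟨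
      ℚ.toℚᵘ (√-seq k n) ℚᵘ.+ ℚ.toℚᵘ (+ 1 ℚ./ suc n)
        ≃⟨ ℚ.toℚᵘ-homo-+ (√-seq k n) (+ 1 ℚ./ suc n) ⟨
      ℚ.toℚᵘ (√-seq k n ℚ.+ (+ 1 ℚ./ suc n)) ∎)
    where
    open ℚᵘ.≤-Reasoning
    a b : ℕ
    a = isqrt (k ℕ.* (suc m ℕ.* suc m))
    b = isqrt (k ℕ.* (suc n ℕ.* suc n))
    common : ∀ b q → (+ 1 ℤ.+ b) ℤ.* (q ℤ.* q) ≡ (b ℤ.* q ℤ.+ + 1 ℤ.* q) ℤ.* q
    common = solve 2 (λ b q → (con (+ 1) :+ b) :* (q :* q) := (b :* q :+ con (+ 1) :* q) :* q) refl
      where open ℤ-Solver.+-*-Solver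

  archimedean : ∀ ε → 0ℚ ℚ.< ε → ∃ λ N → ∀ n → N ℕ.≤ n → (+ 1 ℚ./ suc n) ℚ.≤ ε
  archimedean (mkℚ +0       d _) (ℚ.*<* (ℤ.+<+ ()))
  archimedean (mkℚ -[1+ e ] d _) (ℚ.*<* ())
  archimedean ε@(mkℚ +[1+ e ] d _) _ = d , λ n d≤n → ℚ.toℚᵘ-cancel-≤ (begin
      ℚ.toℚᵘ (+ 1 ℚ./ suc n)   ≃⟨ ℚ.toℚᵘ-fromℚᵘ (ℚᵘ.mkℚᵘ (+ 1) n) ⟩
      ℚᵘ.mkℚᵘ (+ 1) n          ≤⟨ ℚᵘ.*≤* (ℤ.+≤+ (ℕ.*-mono-≤ (ℕ.s≤s (ℕ.z≤n {e})) (ℕ.s≤s d≤n))) ⟩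
      ℚᵘ.mkℚᵘ +[1+ e ] d       ∎)
    where open ℚᵘ.≤-Reasoning

  ∣-∣<-intro : ∀ p q ε → p ℚ.< q ℚ.+ ε → q ℚ.< p ℚ.+ ε → ℚ.∣ p ℚ.- q ∣ ℚ.< ε
  ∣-∣<-intro p q ε p< q< with ℚ.∣p∣≡p∨∣p∣≡-p (p ℚ.- q)
  ... | inj₁ e = subst₂ ℚ._<_ (sym e) (cancel q ε) (ℚ.+-monoˡ-< (ℚ.- q) p<)
    where
    cancel : ∀ q ε → (q ℚ.+ ε) ℚ.- q ≡ ε
    cancel = solve 2 (λ q ε → (q :+ ε) :- q := ε) refl where open +-*-Solver
  ... | inj₂ e = subst₂ ℚ._<_ (trans (flip p q) (sym e)) (cancel p ε) (ℚ.+-monoˡ-< (ℚ.- p) q<)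
    where
    flip : ∀ p q → q ℚ.- p ≡ ℚ.- (p ℚ.- q)
    flip = solve 2 (λ p q → q :- p := :- (p :- q)) refl where open +-*-Solver
    cancel : ∀ q ε → (q ℚ.+ ε) ℚ.- q ≡ ε
    cancel = solve 2 (λ q ε → (q :+ ε) :- q := ε) refl where open +-*-Solver

  √-cauchy : ∀ k → IsCauchy (√-seq k)
  √-cauchy k ε ε>0 with archimedean ε ε>0
  ... | N , h = N , λ m n N≤m N≤n →
      ∣-∣<-intro (√-seq k m) (√-seq k n) ε
        (ℚ.<-≤-trans (√-close k m n) (ℚ.+-monoʳ-≤ (√-seq k n) (h n N≤n)))
        (ℚ.<-≤-trans (√-close k n m) (ℚ.+-monoʳ-≤ (√-seq k m) (h m N≤m)))

-- The m-th approximation is ⌊(m+1)√k⌋ / (m+1).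
√ : ℕ → ℝ
√ k = mkℝ (√-seq k) (√-cauchy k)

Matrix : ∀ {a} → Set a → ℕ → Set a
Matrix A n = Vector (Vector A n) n

module _ {c ℓ} (R : RawRing c ℓ) where
  open RawRing R using (Carrier; 0#; 1#; *-rawMonoid; +-rawMonoid)
    renaming (_+_ to _⊕_; _*_ to _⊛_; -_ to ⊖_)

  sum product : ∀ {n} → Vector Carrier n → Carrier
  sum     = RawMonoidOps.sum +-rawMonoid
  product = RawMonoidOps.sum *-rawMonoid

  -- (-1)ʲ
  sign : ℕ → Carrier
  sign zero    = 1#
  sign (suc j) = ⊖ sign j

  -- Laplace expansion along the first row.
  det : ∀ {n} → Matrix Carrier n → Carrier
  det {zero}  M = 1#
  det {suc n} M = sum λ j →
    sign (Fin.toℕ j) ⊛ (M zero j ⊛ det λ i l → M (suc i) (punchIn j l))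

Σ[_] Π[_] : ∀ {n} → Vector ℝ n → ℝ
Σ[_] = sum ℝ-rawRing
Π[_] = product ℝ-rawRing

diag : ∀ {n} → Vector ℝ n → Matrix ℝ n
diag v i j = if ⌊ i ≟ j ⌋ then v i else 0ℝ

charPoly : ∀ {n} → Matrix ℝ n → ℝ → ℝ
charPoly M x = det ℝ-rawRing λ i j → diag (λ _ → x) i j - M i j

-- μ lists the eigenvalues of M with multiplicity, in non-increasing order
-- (μ zero is λ₁).  Over the infinite field ℝ, agreement of both sides at
-- every x is equality of polynomials.
record IsSpectrum {n} (M : Matrix ℝ n) (μ : Vector ℝ n) : Set where
  field
    ordered : ∀ i j → i Fin.≤ j → μ j ≤ μ i
    roots   : ∀ x → charPoly M x ≈ Π[ (λ i → x - μ i) ]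

-- The sum of the first k entries of μ; this is S_k(M) when IsSpectrum M μ.
S : ∀ {n} (μ : Vector ℝ n) (k : ℕ) → k ℕ.≤ n → ℝ
S μ k k≤n = Σ[ (λ (i : Fin k) → μ (inject≤ i k≤n)) ]

record Graph (n : ℕ) : Set where
  field
    adj    : Fin n → Fin n → Bool
    irrefl : ∀ i → adj i i ≡ false
    symm   : ∀ i j → adj i j ≡ adj j i

open Graph public

IsComplete : ∀ {n} → Graph n → Set
IsComplete G = ∀ i j → adj G i j ≡ not ⌊ i ≟ j ⌋

module _ {n} (G : Graph n) where

  degree : Fin n → ℕ
  degree i = ∣ tabulate (adj G i) ∣

  maxDegree : ℕ
  maxDegree = foldr ℕ._⊔_ 0 degree

  A D : Matrix ℝ n
  A i j = if adj G i j then 1ℝ else 0ℝ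
  D = diag (λ i → fromℕ (degree i))

  Aα : ℝ → Matrix ℝ n
  Aα α i j = α * D i j + (1ℝ - α) * A i j

-- Let M be symmetric of order n with entries in [0, c], and h = cn/2.  Then
--   Σ μᵢ² = tr M² = Σ mᵢⱼ² ≤ c · 1ᵀM1 ≤ c n μ₁ = 2h μ₁,
-- so (μ₁ − h)² + Σ_{i ≥ 2} μᵢ² ≤ h², and the Cauchy–Schwarz inequality for the first k
-- terms gives S_k(M) − h ≤ h √k.  For A_α(G) one takes c = 1 − α if αΔ ≤ 1 − α, and
-- c = αΔ otherwise.
--
-- No eigenvectors are available, so both tr M² = Σ μᵢ² and the Rayleigh bound
-- 1ᵀM1 ≤ n μ₁ are read off the characteristic polynomial.  By multiplicativity of the
-- determinant M² has the eigenvalues μᵢ².  For the Rayleigh bound, shift M so that all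
-- eigenvalues are positive; the ratio 1ᵀM1 / (n μ₁) is at least squared when M is
-- replaced by M², and yet it is at most n because (1ᵀM1)² ≤ n² tr M².
module Submission where

open import Defs using (Matrix; det; sign; sum; product)
open import Algebra.Bundles using (CommutativeRing)
import Algebra.Properties.Ring
import Algebra.Properties.Semiring.Exp
import Algebra.Properties.Semiring.Mult
import Algebra.Properties.Semiring.Mult.TCOptimised
import Algebra.Properties.Semiring.Sum
import Algebra.Solver.Ring
open import Algebra.Solver.Ring.AlmostCommutativeRing
  using (fromCommutativeRing; _-Raw-AlmostCommutative⟶_)
open import Data.Bool.Base using (true; false; if_then_else_)
open import Data.Fin.Base as Fin using (Fin; zero; suc; punchIn; inject₁; inject≤; lift; toℕ)
import Data.Fin.Properties as Fin
open import Data.Integer.Base as ℤ using (ℤ; +_; +[1+_]; -[1+_]; +0)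
import Data.Integer.Properties as ℤ
open import Data.Maybe.Base using (Maybe; just; nothing)
open import Data.Nat.Base as ℕ using (ℕ; zero; suc)
import Data.Nat.Properties as ℕ
import Data.Nat.Solver as ℕ-Solver
open import Data.Product.Base using (∃; _×_; _,_; proj₁; proj₂)
open import Data.Rational.Base as ℚ using (ℚ; 0ℚ; 1ℚ; ½; mkℚ)
import Data.Rational.Properties as ℚ
open import Data.Rational.Solver using (module +-*-Solver)
import Data.Rational.Unnormalised.Base as ℚᵘ
import Data.Rational.Unnormalised.Properties as ℚᵘ
open import Data.Sum.Base using (inj₁; inj₂)
open import Data.Vec.Functional using (Vector; _∷_; foldr; insertAt; updateAt)
open import Data.Vec.Functional.Properties using (updateAt-updates; updateAt-minimal)
open import Function.Base using (_∘_; const)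
import Level
open import Relation.Binary.Bundles using (Preorder)
open import Relation.Binary.PropositionalEquality as ≡ using (_≡_; _≢_)
import Relation.Binary.Reasoning.Preorder
import Relation.Binary.Reasoning.Setoid
open import Relation.Nullary.Decidable using (yes; no; ⌊_⌋)
open import Relation.Nullary.Negation using (contradiction; ¬_)

-- A spectrum is given only as a factorisation of the values of the characteristic polynomial, over
-- reals whose order `≤` is a negated strict order. The sign of a real cannot be decided, but `≤`
-- and `≈` are stable under double negation, so they may be proved by contradiction. The algebra
-- therefore lives over an abstract commutative ring and the inequalities over a stable archimedean
-- order; Cauchy sequences enter only when the reals are shown to be an instance. Reading a
-- coefficient off the values (for the trace) and passing from the points x² to all points (for the
-- eigenvalues of M²) both rest on one fact: a polynomial with enough zeros whose differences can be
-- cancelled vanishes together with its leading coefficient. The squaring argument is run without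
-- limits or division. A ratio of at least 1 + m/k is recorded by the naturals k and m; squaring
-- keeps k and doubles m, while the trace bounds m in terms of k and n. So a ratio of 1 + 1/k is
-- refuted for every k, and the archimedean property gives the Rayleigh bound.

-- Ring identities with integer coefficients.

module IntegerCoefficientSolver {c ℓ} (R : CommutativeRing c ℓ) where
  open CommutativeRing R
  open Algebra.Properties.Ring ring
  open Algebra.Properties.Semiring.Mult.TCOptimised semiring renaming (_×_ to _·_)
  open Relation.Binary.Reasoning.Setoid setoid

  private
    ⟦_⟧ : ℤ → Carrier
    ⟦ + n ⟧      = n · 1#
    ⟦ -[1+ n ] ⟧ = - (suc n · 1#)

    neg-homo : ∀ i → ⟦ ℤ.- i ⟧ ≈ - ⟦ i ⟧
    neg-homo (+ zero)   = sym -0#≈0#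
    neg-homo (+ suc n)  = refl
    neg-homo -[1+ n ]   = sym (-‿involutive _)

    cancel-one : ∀ x y → (1# + x) - (1# + y) ≈ x - y
    cancel-one x y = begin
      (1# + x) - (1# + y)       ≈⟨ +-cong (+-comm 1# x) (sym (-‿+-comm 1# y)) ⟩
      (x + 1#) + (- 1# - y)     ≈⟨ +-assoc x 1# _ ⟩
      x + (1# + (- 1# - y))     ≈⟨ +-congˡ (sym (+-assoc 1# (- 1#) (- y))) ⟩
      x + ((1# - 1#) - y)       ≈⟨ +-congˡ (+-congʳ (-‿inverseʳ 1#)) ⟩
      x + (0# - y)              ≈⟨ +-congˡ (+-identityˡ (- y)) ⟩
      x - y                     ∎

    ⊖-homo : ∀ m n → ⟦ m ℤ.⊖ n ⟧ ≈ m · 1# - n · 1#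
    ⊖-homo m       zero    = sym (trans (+-congˡ -0#≈0#) (+-identityʳ _))
    ⊖-homo zero    (suc n) = sym (+-identityˡ _)
    ⊖-homo (suc m) (suc n) = begin
      ⟦ suc m ℤ.⊖ suc n ⟧           ≡⟨ ≡.cong ⟦_⟧ (ℤ.[1+m]⊖[1+n]≡m⊖n m n) ⟩
      ⟦ m ℤ.⊖ n ⟧                   ≈⟨ ⊖-homo m n ⟩
      m · 1# - n · 1#               ≈⟨ cancel-one (m · 1#) (n · 1#) ⟨
      (1# + m · 1#) - (1# + n · 1#) ≈⟨ +-cong (1+× m 1#) (-‿cong (1+× n 1#)) ⟨
      suc m · 1# - suc n · 1#       ∎

    +-homo : ∀ i j → ⟦ i ℤ.+ j ⟧ ≈ ⟦ i ⟧ + ⟦ j ⟧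
    +-homo (+ m)    (+ n)    = ×-homo-+ 1# m n
    +-homo (+ m)    -[1+ n ] = ⊖-homo m (suc n)
    +-homo -[1+ m ] (+ n)    = trans (⊖-homo n (suc m)) (+-comm _ _)
    +-homo -[1+ m ] -[1+ n ] = begin
      - (suc (suc (m ℕ.+ n)) · 1#)    ≡⟨ ≡.cong (λ k → - (k · 1#)) (≡.sym (ℕ.+-suc (suc m) n)) ⟩
      - ((suc m ℕ.+ suc n) · 1#)      ≈⟨ -‿cong (×-homo-+ 1# (suc m) (suc n)) ⟩
      - (suc m · 1# + suc n · 1#)     ≈⟨ sym (-‿+-comm _ _) ⟩
      - (suc m · 1#) - suc n · 1#     ∎

    *-homo-pos : ∀ m n → ⟦ + m ℤ.* + n ⟧ ≈ ⟦ + m ⟧ * ⟦ + n ⟧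
    *-homo-pos m n = trans (reflexive (≡.cong ⟦_⟧ (≡.sym (ℤ.pos-* m n)))) (×1-homo-* m n)

    *-homo : ∀ i j → ⟦ i ℤ.* j ⟧ ≈ ⟦ i ⟧ * ⟦ j ⟧
    *-homo (+ m) (+ n) = *-homo-pos m n
    *-homo (+ m) -[1+ n ] = begin
      ⟦ + m ℤ.* -[1+ n ] ⟧         ≡⟨ ≡.cong ⟦_⟧ (≡.sym (ℤ.neg-distribʳ-* (+ m) (+ suc n))) ⟩
      ⟦ ℤ.- (+ m ℤ.* + suc n) ⟧    ≈⟨ neg-homo (+ m ℤ.* + suc n) ⟩
      - ⟦ + m ℤ.* + suc n ⟧        ≈⟨ -‿cong (*-homo-pos m (suc n)) ⟩
      - (⟦ + m ⟧ * ⟦ + suc n ⟧)    ≈⟨ -‿distribʳ-* _ _ ⟩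
      ⟦ + m ⟧ * ⟦ -[1+ n ] ⟧       ∎
    *-homo -[1+ m ] (+ n) = begin
      ⟦ -[1+ m ] ℤ.* + n ⟧         ≡⟨ ≡.cong ⟦_⟧ (≡.sym (ℤ.neg-distribˡ-* (+ suc m) (+ n))) ⟩
      ⟦ ℤ.- (+ suc m ℤ.* + n) ⟧    ≈⟨ neg-homo (+ suc m ℤ.* + n) ⟩
      - ⟦ + suc m ℤ.* + n ⟧        ≈⟨ -‿cong (*-homo-pos (suc m) n) ⟩
      - (⟦ + suc m ⟧ * ⟦ + n ⟧)    ≈⟨ -‿distribˡ-* _ _ ⟩
      ⟦ -[1+ m ] ⟧ * ⟦ + n ⟧       ∎
    *-homo -[1+ m ] -[1+ n ] = begin
      ⟦ -[1+ m ] ℤ.* -[1+ n ] ⟧        ≈⟨ *-homo-pos (suc m) (suc n) ⟩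
      ⟦ + suc m ⟧ * ⟦ + suc n ⟧        ≈⟨ -‿involutive _ ⟨
      - - (⟦ + suc m ⟧ * ⟦ + suc n ⟧)  ≈⟨ -‿cong (-‿distribʳ-* _ _) ⟩
      - (⟦ + suc m ⟧ * ⟦ -[1+ n ] ⟧)   ≈⟨ -‿distribˡ-* _ _ ⟩
      ⟦ -[1+ m ] ⟧ * ⟦ -[1+ n ] ⟧      ∎

    morphism : ℤ.+-*-rawRing -Raw-AlmostCommutative⟶ fromCommutativeRing R
    morphism = record
      { ⟦_⟧ = ⟦_⟧ ; +-homo = +-homo ; *-homo = *-homo ; -‿homo = neg-homo
      ; 0-homo = refl ; 1-homo = refl }

    -- Equality of reals is undecidable, so the normaliser compares coefficients as integers. This
    -- is enough for terms such as `x - x` to cancel.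
    _coeff≟_ : ∀ i j → Maybe (⟦ i ⟧ ≈ ⟦ j ⟧)
    i coeff≟ j with i ℤ.≟ j
    ... | yes i≡j = just (reflexive (≡.cong ⟦_⟧ i≡j))
    ... | no  _   = nothing

  open Algebra.Solver.Ring ℤ.+-*-rawRing (fromCommutativeRing R) morphism _coeff≟_ public
    using (solve; con; _:=_; _:+_; _:*_; _:-_; :-_)

-- The determinant as an alternating multilinear function of the rows.

module Determinant {c ℓ} (R : CommutativeRing c ℓ) where
  open CommutativeRing R hiding (zero)
  open Algebra.Properties.Ring ring
  private module Sum = Algebra.Properties.Semiring.Sum semiring
  open Relation.Binary.Reasoning.Setoid setoid
  open IntegerCoefficientSolver R

  infix 4 _≋_
  _≋_ : ∀ {n} → Vector Carrier n → Vector Carrier n → Set ℓ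
  u ≋ v = ∀ j → u j ≈ v j

  ≋-reflexive : ∀ {n} {u v : Vector Carrier n} → u ≡ v → u ≋ v
  ≋-reflexive ≡.refl _ = refl

  minor : ∀ {m n} → Fin (suc n) → (Fin m → Vector Carrier (suc n)) → Fin m → Vector Carrier n
  minor j N i l = N i (punchIn j l)

  sgn : ∀ {n} → Fin n → Carrier
  sgn j = sign rawRing (toℕ j)

  -- Kept opaque so that the summand and the matrix can be inferred from the type.
  opaque
    ∑ : ∀ {n} → Vector Carrier n → Carrier
    ∑ = sum rawRing

    ∑-def : ∀ {n} (f : Vector Carrier n) → ∑ f ≡ sum rawRing f
    ∑-def f = ≡.refl

    ∑-empty : (f : Vector Carrier 0) → ∑ f ≈ 0#
    ∑-empty f = refl

    ∑-suc : ∀ {n} (f : Vector Carrier (suc n)) → ∑ f ≈ f zero + ∑ (f ∘ suc)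
    ∑-suc f = refl

    ∑-cong : ∀ {n} {f g : Vector Carrier n} → f ≋ g → ∑ f ≈ ∑ g
    ∑-cong = Sum.sum-cong-≋

    ∑-distrib-+ : ∀ {n} (f g : Vector Carrier n) → ∑ (λ i → f i + g i) ≈ ∑ f + ∑ g
    ∑-distrib-+ = Sum.∑-distrib-+

    ∑-comm : ∀ {m n} (f : Fin m → Fin n → Carrier) →
             ∑ (λ i → ∑ λ j → f i j) ≈ ∑ (λ j → ∑ λ i → f i j)
    ∑-comm = Sum.∑-comm

    *-distribˡ-∑ : ∀ {n} x (f : Vector Carrier n) → x * ∑ f ≈ ∑ (λ i → x * f i)
    *-distribˡ-∑ = Sum.*-distribˡ-sum

    *-distribʳ-∑ : ∀ {n} x (f : Vector Carrier n) → ∑ f * x ≈ ∑ (λ i → f i * x)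
    *-distribʳ-∑ = Sum.*-distribʳ-sum

    ∑-zero : ∀ {n} {f : Vector Carrier n} → (∀ i → f i ≈ 0#) → ∑ f ≈ 0#
    ∑-zero {n} f≈0 = trans (∑-cong f≈0) (Sum.sum-replicate-zero n)

    Det : ∀ {n} → Matrix Carrier n → Carrier
    Det = det rawRing

    Det-def : ∀ {n} (M : Matrix Carrier n) → Det M ≡ det rawRing M
    Det-def M = ≡.refl

    Det-empty : (M : Matrix Carrier 0) → Det M ≈ 1#
    Det-empty M = refl

    Det-suc : ∀ {n} (M : Matrix Carrier (suc n)) →
              Det M ≈ ∑ (λ j → sgn j * (M zero j * Det (minor j (M ∘ suc))))
    Det-suc M = refl

  -- Defined by recursion on both indices instead of a decidable test, so that sums against `δ`
  -- follow by induction; `diag≈` relates it to `diag`.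
  δ : ∀ {n} → Matrix Carrier n
  δ zero    zero    = 1#
  δ zero    (suc j) = 0#
  δ (suc i) zero    = 0#
  δ (suc i) (suc j) = δ i j

  ∑-linear : ∀ {n} a (f g : Vector Carrier n) → ∑ (λ i → a * f i + g i) ≈ a * ∑ f + ∑ g
  ∑-linear a f g = trans (∑-distrib-+ (λ i → a * f i) g) (+-congʳ (sym (*-distribˡ-∑ a f)))

  ∑-neg : ∀ {n} (f : Vector Carrier n) → ∑ (λ i → - f i) ≈ - ∑ f
  ∑-neg f = begin
    ∑ (λ i → - f i)        ≈⟨ ∑-cong (λ i → sym (-1*x≈-x (f i))) ⟩
    ∑ (λ i → - 1# * f i)   ≈⟨ sym (*-distribˡ-∑ (- 1#) f) ⟩
    - 1# * ∑ f             ≈⟨ -1*x≈-x (∑ f) ⟩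
    - ∑ f                  ∎

  ∑-δˡ : ∀ {n} i (v : Vector Carrier n) → ∑ (λ k → δ i k * v k) ≈ v i
  ∑-δˡ zero v = begin
    ∑ (λ k → δ zero k * v k)                   ≈⟨ ∑-suc _ ⟩
    1# * v zero + ∑ (λ k → 0# * v (suc k))     ≈⟨ +-cong (*-identityˡ _) (∑-zero (λ k → zeroˡ _)) ⟩
    v zero + 0#                                ≈⟨ +-identityʳ _ ⟩
    v zero                                     ∎
  ∑-δˡ (suc i) v = begin
    ∑ (λ k → δ (suc i) k * v k)                ≈⟨ ∑-suc _ ⟩
    0# * v zero + ∑ (λ k → δ i k * v (suc k))  ≈⟨ +-cong (zeroˡ _) (∑-δˡ i (v ∘ suc)) ⟩
    0# + v (suc i)                             ≈⟨ +-identityˡ _ ⟩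
    v (suc i)                                  ∎

  -- The families need not be square: fixing the first row of a determinant leaves fewer rows than
  -- columns. `linear` combines additivity and homogeneity, and relates three families up to `≋`, so
  -- that no equality of functions is required.
  record IsAlternating {m n} (F : (Fin m → Vector Carrier n) → Carrier) : Set (c Level.⊔ ℓ) where
    field
      cong : ∀ {M N} → (∀ i → M i ≋ N i) → F M ≈ F N
      linear : ∀ i a {M N P} →
        (∀ k → k ≢ i → M k ≋ P k) → (∀ k → k ≢ i → N k ≋ P k) →
        (∀ j → P i j ≈ a * M i j + N i j) → F P ≈ a * F M + F N
      alternating : ∀ {i k M} → i ≢ k → M i ≋ M k → F M ≈ 0#

    -- A zero row `r` satisfies `r = - r + r`, so `linear` with all three families equal to `M`
    -- yields `F M = - F M + F M`.
    vanishes-at-zero-row : ∀ i {M} → (∀ j → M i j ≈ 0#) → F M ≈ 0#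
    vanishes-at-zero-row i {M} Mi≈0 = begin
      F M                 ≈⟨ linear i (- 1#) (λ _ _ _ → refl) (λ _ _ _ → refl) zero-row ⟩
      - 1# * F M + F M    ≈⟨ solve 1 (λ x → :- con (+ 1) :* x :+ x := con (+ 0)) refl (F M) ⟩
      0#                  ∎
      where
      zero-row : ∀ j → M i j ≈ - 1# * M i j + M i j
      zero-row j = trans (Mi≈0 j)
        (sym (solve 1 (λ x → :- con (+ 1) :* x :+ x := con (+ 0)) refl (M i j)))

    homogeneous : ∀ i a {M P} → (∀ k → k ≢ i → M k ≋ P k) → (∀ j → P i j ≈ a * M i j) →
                  F P ≈ a * F M
    homogeneous i a {M} {P} same Pi = begin
      F P                 ≈⟨ linear i a same others row ⟩
      a * F M + F M₀      ≈⟨ +-congˡ (vanishes-at-zero-row i (≋-reflexive (updateAt-updates i M))) ⟩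
      a * F M + 0#        ≈⟨ +-identityʳ _ ⟩
      a * F M             ∎
      where
      M₀ = updateAt M i (const (λ _ → 0#))
      others : ∀ k → k ≢ i → M₀ k ≋ P k
      others k k≢i j = trans (≋-reflexive (updateAt-minimal k i M k≢i) j) (same k k≢i j)
      row : ∀ j → P i j ≈ a * M i j + M₀ i j
      row j = trans (Pi j) (sym (trans (+-congˡ (≋-reflexive (updateAt-updates i M) j)) (+-identityʳ _)))

    add-row : ∀ i k a {M P} → i ≢ k → (∀ l → l ≢ i → M l ≋ P l) →
              (∀ j → P i j ≈ a * M k j + M i j) → F P ≈ F M
    add-row i k a {M} {P} i≢k same Pi = begin
      F P                 ≈⟨ linear i a others same row ⟩
      a * F M′ + F M      ≈⟨ +-congʳ (*-congˡ (alternating i≢k repeated)) ⟩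
      a * 0# + F M        ≈⟨ trans (+-congʳ (zeroʳ a)) (+-identityˡ _) ⟩
      F M                 ∎
      where
      M′ = updateAt M i (const (M k))
      M′i : M′ i ≋ M k
      M′i = ≋-reflexive (updateAt-updates i M)
      M′l : ∀ l → l ≢ i → M′ l ≋ M l
      M′l l l≢i = ≋-reflexive (updateAt-minimal l i M l≢i)
      others : ∀ l → l ≢ i → M′ l ≋ P l
      others l l≢i j = trans (M′l l l≢i j) (same l l≢i j)
      row : ∀ j → P i j ≈ a * M′ i j + M i j
      row j = trans (Pi j) (+-congʳ (*-congˡ (sym (M′i j))))
      repeated : M′ i ≋ M′ k
      repeated j = trans (M′i j) (sym (M′l k (i≢k ∘ ≡.sym) j))

    -- (u, v) ↦ (u + v, v) ↦ (u + v, -u) ↦ (v, -u) are row additions.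
    swap : ∀ i k {M N} → i ≢ k → (∀ l → l ≢ i → l ≢ k → N l ≋ M l) →
           N i ≋ M k → N k ≋ M i → F N ≈ - F M
    swap i k {M} {N} i≢k same Ni Nk = begin
      F N            ≈⟨ homogeneous k (- 1#) N≋M₃ (λ j → trans (Nk j) (last-row j)) ⟩
      - 1# * F M₃    ≈⟨ *-congˡ (trans step₃ (trans step₂ step₁)) ⟩
      - 1# * F M     ≈⟨ -1*x≈-x (F M) ⟩
      - F M          ∎
      where
      k≢i = i≢k ∘ ≡.sym
      M₁ = updateAt M i (const (λ j → 1# * M k j + M i j))
      M₂ = updateAt M₁ k (const (λ j → - 1# * M₁ i j + M₁ k j))
      M₃ = updateAt M₂ i (const (λ j → 1# * M₂ k j + M₂ i j))
      at : ∀ {P : Fin _ → Vector Carrier _} {r} p → updateAt P p (const r) p ≋ r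
      at {P} p = ≋-reflexive (updateAt-updates p P)
      off : ∀ {P : Fin _ → Vector Carrier _} {r} p l → l ≢ p → updateAt P p (const r) l ≋ P l
      off {P} p l l≢p = ≋-reflexive (updateAt-minimal l p P l≢p)
      step₁ : F M₁ ≈ F M
      step₁ = add-row i k 1# i≢k (λ l l≢i j → sym (off i l l≢i j)) (at i)
      step₂ : F M₂ ≈ F M₁
      step₂ = add-row k i (- 1#) k≢i (λ l l≢k j → sym (off k l l≢k j)) (at k)
      step₃ : F M₃ ≈ F M₂
      step₃ = add-row i k 1# i≢k (λ l l≢i j → sym (off i l l≢i j)) (at i)
      M₁i : ∀ j → M₁ i j ≈ 1# * M k j + M i j
      M₁i = at i
      M₁k : M₁ k ≋ M k
      M₁k = off i k k≢i
      M₂k : ∀ j → M₂ k j ≈ - M i j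
      M₂k j = begin
        M₂ k j                                      ≈⟨ at k j ⟩
        - 1# * M₁ i j + M₁ k j                      ≈⟨ +-cong (*-congˡ (M₁i j)) (M₁k j) ⟩
        - 1# * (1# * M k j + M i j) + M k j         ≈⟨ solve 2 (λ u v → :- con (+ 1) :* (con (+ 1) :* v :+ u) :+ v := :- u) refl (M i j) (M k j) ⟩
        - M i j                                     ∎
      last-row : ∀ j → M i j ≈ - 1# * M₃ k j
      last-row j = begin
        M i j             ≈⟨ solve 1 (λ u → u := :- con (+ 1) :* :- u) refl (M i j) ⟩
        - 1# * - M i j    ≈⟨ *-congˡ (sym (trans (off i k k≢i j) (M₂k j))) ⟩
        - 1# * M₃ k j     ∎
      M₃i : M₃ i ≋ M k
      M₃i j = begin
        M₃ i j                                    ≈⟨ at i j ⟩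
        1# * M₂ k j + M₂ i j                      ≈⟨ +-cong (*-congˡ (M₂k j)) (trans (off k i i≢k j) (M₁i j)) ⟩
        1# * - M i j + (1# * M k j + M i j)       ≈⟨ solve 2 (λ u v → con (+ 1) :* :- u :+ (con (+ 1) :* v :+ u) := v) refl (M i j) (M k j) ⟩
        M k j                                     ∎
      N≋M₃ : ∀ l → l ≢ k → M₃ l ≋ N l
      N≋M₃ l l≢k j with l Fin.≟ i
      ... | yes ≡.refl = trans (M₃i j) (sym (Ni j))
      ... | no  l≢i    = begin
        M₃ l j ≈⟨ off i l l≢i j ⟩
        M₂ l j ≈⟨ off k l l≢k j ⟩
        M₁ l j ≈⟨ off i l l≢i j ⟩
        M l j  ≈⟨ same l l≢i l≢k j ⟨
        N l j  ∎

  det-cong : ∀ {n} {M N : Matrix Carrier n} → (∀ i → M i ≋ N i) → Det M ≈ Det N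
  det-cong {zero}  {M} {N} M≋N = trans (Det-empty M) (sym (Det-empty N))
  det-cong {suc n} {M} {N} M≋N = begin
    Det M                                                       ≈⟨ Det-suc M ⟩
    ∑ (λ j → sgn j * (M zero j * Det (minor j (M ∘ suc))))      ≈⟨ ∑-cong (λ j → *-congˡ (*-cong (M≋N zero j)
                                                                    (det-cong λ i l → M≋N (suc i) (punchIn j l)))) ⟩
    ∑ (λ j → sgn j * (N zero j * Det (minor j (N ∘ suc))))      ≈⟨ Det-suc N ⟨
    Det N                                                       ∎

  -- A row r is expanded twice; the two terms of a pair of columns cancel.
  double-expansion : ∀ n (r : Vector Carrier (2 ℕ.+ n)) (G : (Fin n → Fin (2 ℕ.+ n)) → Carrier) →
    (∀ g h → (∀ c → g c ≡ h c) → G g ≈ G h) →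
    ∑ (λ j → sgn j * (r j * ∑ λ l → sgn l * (r (punchIn j l) * G (punchIn j ∘ punchIn l)))) ≈ 0#
  double-expansion n r G G-cong = begin
    ∑ (λ j → sgn j * (r j * ∑ λ l → sgn l * (r (punchIn j l) * G (punchIn j ∘ punchIn l))))
      ≈⟨ ∑-suc _ ⟩
    1# * (r zero * ∑ H) + ∑ (λ j → - sgn j * (r (suc j) * ∑ λ l → sgn l * (r (punchIn (suc j) l) * G (punchIn (suc j) ∘ punchIn l))))
      -- Column `zero` is paired with column `suc j` once in each order, with opposite signs.
      -- Splitting off `l = zero` isolates the second occurrence as `- r zero * H j`.
      ≈⟨ +-congˡ (∑-cong regroup) ⟩
    1# * (r zero * ∑ H) + ∑ (λ j → - r zero * H j + rest n r G j)
      ≈⟨ +-congˡ (∑-linear (- r zero) H (rest n r G)) ⟩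
    1# * (r zero * ∑ H) + (- r zero * ∑ H + ∑ (rest n r G))
      ≈⟨ solve 3 (λ a h t → con (+ 1) :* (a :* h) :+ (:- a :* h :+ t) := t) refl (r zero) (∑ H) (∑ (rest n r G)) ⟩
    ∑ (rest n r G)
      ≈⟨ rest≈0 n r G G-cong ⟩
    0# ∎
    where
    H : Vector Carrier (suc n)
    H l = sgn l * (r (suc l) * G (suc ∘ punchIn l))
    rest : ∀ n → Vector Carrier (2 ℕ.+ n) → ((Fin n → Fin (2 ℕ.+ n)) → Carrier) → Vector Carrier (suc n)
    rest n r G j = - sgn j * (r (suc j) * ∑ λ l → - sgn l * (r (suc (punchIn j l)) * G (punchIn (suc j) ∘ punchIn (suc l))))
    regroup : ∀ j → - sgn j * (r (suc j) * ∑ λ l → sgn l * (r (punchIn (suc j) l) * G (punchIn (suc j) ∘ punchIn l))) ≈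
              - r zero * H j + rest n r G j
    regroup j = begin
      - sgn j * (r (suc j) * ∑ λ l → sgn l * (r (punchIn (suc j) l) * G (punchIn (suc j) ∘ punchIn l)))
        ≈⟨ *-congˡ (*-congˡ (∑-suc _)) ⟩
      - sgn j * (r (suc j) * (1# * (r zero * G (suc ∘ punchIn j)) + inner))
        ≈⟨ solve 5 (λ s x a g t →
             :- s :* (x :* (con (+ 1) :* (a :* g) :+ t)) := :- a :* (s :* (x :* g)) :+ :- s :* (x :* t))
             refl (sgn j) (r (suc j)) (r zero) (G (suc ∘ punchIn j)) inner ⟩
      - r zero * H j + rest n r G j ∎
      where
      inner = ∑ λ l → - sgn l * (r (suc (punchIn j l)) * G (punchIn (suc j) ∘ punchIn (suc l)))
    -- The pairs that avoid column `zero` form a double expansion of the shortened row: both signs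
    -- flip, hence cancel, and `lift 1` keeps column `zero` among the columns passed to `G`.
    rest≈0 : ∀ n r G → (∀ g h → (∀ c → g c ≡ h c) → G g ≈ G h) → ∑ (rest n r G) ≈ 0#
    rest≈0 zero    r G G-cong = ∑-zero λ j →
      trans (*-congˡ (trans (*-congˡ (∑-empty _)) (zeroʳ (r (suc j))))) (zeroʳ (- sgn j))
    rest≈0 (suc n) r G G-cong = trans (∑-cong term)
      (double-expansion n (r ∘ suc) (G ∘ lift 1) λ g h g≗h → G-cong _ _ λ where
        zero    → ≡.refl
        (suc c) → ≡.cong suc (g≗h c))
      where
      term : ∀ j → rest (suc n) r G j ≈
             sgn j * (r (suc j) * ∑ λ l → sgn l * (r (suc (punchIn j l)) * G (lift 1 (punchIn j ∘ punchIn l))))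
      term j = begin
        rest (suc n) r G j           ≈⟨ *-congˡ (*-congˡ (trans (∑-cong negate) (∑-neg f))) ⟩
        - sgn j * (r (suc j) * - ∑ f) ≈⟨ solve 3 (λ s x t → :- s :* (x :* :- t) := s :* (x :* t)) refl (sgn j) (r (suc j)) (∑ f) ⟩
        sgn j * (r (suc j) * ∑ f)    ∎
        where
        f : Vector Carrier (suc n)
        f l = sgn l * (r (suc (punchIn j l)) * G (lift 1 (punchIn j ∘ punchIn l)))
        negate : ∀ l → - sgn l * (r (suc (punchIn j l)) * G (punchIn (suc j) ∘ punchIn (suc l))) ≈ - f l
        negate l = trans (sym (-‿distribˡ-* _ _)) (-‿cong (*-congˡ (*-congˡ (G-cong _ _ λ where
          zero    → ≡.refl
          (suc c) → ≡.refl))))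

  -- Expansion along `r` gives a combination of minors of `N`. Each is alternating by hypothesis,
  -- since deleting a column preserves every relation between rows.
  det-of-tail-isAlternating : ∀ {n} → IsAlternating (Det {n}) → ∀ r →
    IsAlternating {n} {suc n} (λ N → Det (r ∷ N))
  det-of-tail-isAlternating {n} alt r = record
    { cong = λ M≋N → det-cong λ where
        zero    j → refl
        (suc i) j → M≋N i j
    ; linear = linear
    ; alternating = λ {i} {k} {M} i≢k Mi≋Mk → trans (Det-suc (r ∷ M)) (∑-zero λ j → trans
        (*-congˡ (trans (*-congˡ (A.alternating i≢k λ l → Mi≋Mk (punchIn j l))) (zeroʳ (r j))))
        (zeroʳ (sgn j)))
    }
    where
    module A = IsAlternating alt
    linear : ∀ i a {M N P : Fin n → Vector Carrier (suc n)} →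
      (∀ k → k ≢ i → M k ≋ P k) → (∀ k → k ≢ i → N k ≋ P k) →
      (∀ j → P i j ≈ a * M i j + N i j) → Det (r ∷ P) ≈ a * Det (r ∷ M) + Det (r ∷ N)
    linear i a {M} {N} {P} M≋P N≋P Pi = begin
      Det (r ∷ P)                                         ≈⟨ Det-suc (r ∷ P) ⟩
      ∑ (λ j → sgn j * (r j * Det (minor j P)))           ≈⟨ ∑-cong term ⟩
      ∑ (λ j → a * term-of M j + term-of N j)             ≈⟨ ∑-linear a (term-of M) (term-of N) ⟩
      a * ∑ (term-of M) + ∑ (term-of N)                   ≈⟨ +-cong (*-congˡ (Det-suc (r ∷ M))) (Det-suc (r ∷ N)) ⟨
      a * Det (r ∷ M) + Det (r ∷ N)                       ∎
      where
      term-of : (Fin n → Vector Carrier (suc n)) → Vector Carrier (suc n)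
      term-of Q j = sgn j * (r j * Det (minor j Q))
      term : ∀ j → term-of P j ≈ a * term-of M j + term-of N j
      term j = begin
        sgn j * (r j * Det (minor j P))
          ≈⟨ *-congˡ (*-congˡ (A.linear i a (λ k k≢i l → M≋P k k≢i (punchIn j l))
               (λ k k≢i l → N≋P k k≢i (punchIn j l)) (λ l → Pi (punchIn j l)))) ⟩
        sgn j * (r j * (a * Det (minor j M) + Det (minor j N)))
          ≈⟨ solve 5 (λ s x a d e → s :* (x :* (a :* d :+ e)) := a :* (s :* (x :* d)) :+ s :* (x :* e))
               refl (sgn j) (r j) a (Det (minor j M)) (Det (minor j N)) ⟩
        a * term-of M j + term-of N j ∎

  ∷-head-tail : ∀ {n} (M : Matrix Carrier (suc n)) → Det M ≈ Det (M zero ∷ (M ∘ suc))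
  ∷-head-tail M = det-cong λ where
    zero    j → refl
    (suc i) j → refl

  -- Induction on the size. Two equal rows below the head are dealt with by the minors. A row equal
  -- to the head is first swapped into second place, where the double expansion cancels.
  det-isAlternating : ∀ n → IsAlternating (Det {n})
  det-isAlternating zero = record
    { cong = det-cong ; linear = λ () ; alternating = λ { {()} } }
  det-isAlternating (suc n) = record
    { cong = det-cong ; linear = linear ; alternating = λ {i} {k} {M} → alternating i k M }
    where
    tail-alt = det-of-tail-isAlternating (det-isAlternating n)

    linear : ∀ i a {M N P : Matrix Carrier (suc n)} →
      (∀ k → k ≢ i → M k ≋ P k) → (∀ k → k ≢ i → N k ≋ P k) →
      (∀ j → P i j ≈ a * M i j + N i j) → Det P ≈ a * Det M + Det N
    linear zero a {M} {N} {P} M≋P N≋P Pi = begin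
      Det P                                     ≈⟨ Det-suc P ⟩
      ∑ (term-of P)                             ≈⟨ ∑-cong term ⟩
      ∑ (λ j → a * term-of M j + term-of N j)   ≈⟨ ∑-linear a (term-of M) (term-of N) ⟩
      a * ∑ (term-of M) + ∑ (term-of N)         ≈⟨ +-cong (*-congˡ (Det-suc M)) (Det-suc N) ⟨
      a * Det M + Det N                         ∎
      where
      term-of : Matrix Carrier (suc n) → Vector Carrier (suc n)
      term-of Q j = sgn j * (Q zero j * Det (minor j (Q ∘ suc)))
      term : ∀ j → term-of P j ≈ a * term-of M j + term-of N j
      term j = begin
        sgn j * (P zero j * Det (minor j (P ∘ suc)))
          ≈⟨ *-congˡ (*-congʳ (Pi j)) ⟩
        sgn j * ((a * M zero j + N zero j) * Det (minor j (P ∘ suc)))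
          ≈⟨ solve 5 (λ s a m n d → s :* ((a :* m :+ n) :* d) := a :* (s :* (m :* d)) :+ s :* (n :* d))
               refl (sgn j) a (M zero j) (N zero j) (Det (minor j (P ∘ suc))) ⟩
        a * (sgn j * (M zero j * Det (minor j (P ∘ suc)))) + sgn j * (N zero j * Det (minor j (P ∘ suc)))
          ≈⟨ +-cong (*-congˡ (*-congˡ (*-congˡ (det-cong λ i l → sym (M≋P (suc i) (λ ()) (punchIn j l))))))
                    (*-congˡ (*-congˡ (det-cong λ i l → sym (N≋P (suc i) (λ ()) (punchIn j l))))) ⟩
        a * term-of M j + term-of N j ∎
    linear (suc i) a {M} {N} {P} M≋P N≋P Pi = begin
      Det P                                                   ≈⟨ ∷-head-tail P ⟩
      Det (P zero ∷ (P ∘ suc))                                ≈⟨ IsAlternating.linear (tail-alt (P zero)) i a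
                                                                  (λ k k≢i → M≋P (suc k) (k≢i ∘ Fin.suc-injective))
                                                                  (λ k k≢i → N≋P (suc k) (k≢i ∘ Fin.suc-injective)) Pi ⟩
      a * Det (P zero ∷ (M ∘ suc)) + Det (P zero ∷ (N ∘ suc)) ≈⟨ +-cong (*-congˡ (det-cong (with-head (M≋P zero λ ())))) (det-cong (with-head (N≋P zero λ ()))) ⟨
      a * Det M + Det N                                       ∎
      where
      with-head : ∀ {Q : Matrix Carrier (suc n)} → Q zero ≋ P zero → ∀ k → Q k ≋ (P zero ∷ (Q ∘ suc)) k
      with-head Q₀ zero    = Q₀
      with-head Q₀ (suc k) = λ _ → refl

    first-two : ∀ {n} (M : Matrix Carrier (2 ℕ.+ n)) → M zero ≋ M (suc zero) → Det M ≈ 0#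
    first-two {n} M M₀≋M₁ = begin
      Det M
        ≈⟨ Det-suc M ⟩
      ∑ (λ j → sgn j * (M zero j * Det (minor j (M ∘ suc))))
        ≈⟨ ∑-cong (λ j → *-congˡ (*-cong (M₀≋M₁ j) (Det-suc (minor j (M ∘ suc))))) ⟩
      ∑ (λ j → sgn j * (M (suc zero) j * ∑ λ l → sgn l * (M (suc zero) (punchIn j l) *
        Det (λ i c → M (suc (suc i)) (punchIn j (punchIn l c))))))
        ≈⟨ double-expansion n (M (suc zero)) (λ h → Det λ i c → M (suc (suc i)) (h c))
             (λ g h g≗h → det-cong λ i c → reflexive (≡.cong (M (suc (suc i))) (g≗h c))) ⟩
      0# ∎

    first-row : ∀ {n} → (∀ r → IsAlternating {n} {suc n} (λ N → Det (r ∷ N))) →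
                ∀ k (M : Matrix Carrier (suc n)) → M zero ≋ M (suc k) → Det M ≈ 0#
    first-row tail-alt zero M M₀≋ = first-two M M₀≋
    first-row tail-alt (suc k) M M₀≋ = begin
      Det M                      ≈⟨ ∷-head-tail M ⟩
      Det (M zero ∷ (M ∘ suc))   ≈⟨ IsAlternating.swap (tail-alt (M zero)) zero (suc k) {N} {M ∘ suc} (λ ()) same
                                      (λ j → sym (N-k j)) (λ j → refl) ⟩
      - Det (M zero ∷ N)         ≈⟨ -‿cong (first-two (M zero ∷ N) M₀≋) ⟩
      - 0#                       ≈⟨ -0#≈0# ⟩
      0#                         ∎
      where
      M′ = updateAt (M ∘ suc) zero (const (M (suc (suc k))))
      N = updateAt M′ (suc k) (const (M (suc zero)))
      N-k : N (suc k) ≋ M (suc zero)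
      N-k = ≋-reflexive (updateAt-updates (suc k) M′)
      same : ∀ l → l ≢ zero → l ≢ suc k → M (suc l) ≋ N l
      same zero    l≢0 l≢k = contradiction ≡.refl l≢0
      same (suc l) l≢0 l≢k = ≋-reflexive (≡.sym (updateAt-minimal (suc l) (suc k) M′ l≢k))

    alternating : ∀ i k (M : Matrix Carrier (suc n)) → i ≢ k → M i ≋ M k → Det M ≈ 0#
    alternating zero    zero    M i≢k Mi≋Mk = contradiction ≡.refl i≢k
    alternating zero    (suc k) M i≢k Mi≋Mk = first-row tail-alt k M Mi≋Mk
    alternating (suc i) zero    M i≢k Mi≋Mk = first-row tail-alt i M (λ j → sym (Mi≋Mk j))
    alternating (suc i) (suc k) M i≢k Mi≋Mk = trans (∷-head-tail M)
      (IsAlternating.alternating (tail-alt (M zero)) {i} {k} {M ∘ suc} (i≢k ∘ ≡.cong suc) Mi≋Mk)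

-- Multiplicativity of the determinant.

module Multiplicativity {c ℓ} (R : CommutativeRing c ℓ) where
  open CommutativeRing R hiding (zero)
  open Algebra.Properties.Ring ring
  open Relation.Binary.Reasoning.Setoid setoid
  open IntegerCoefficientSolver R
  open Determinant R

  unit-expansion : ∀ {n} (L : Vector Carrier n → Carrier) →
    (∀ {u v} → u ≋ v → L u ≈ L v) →
    (∀ a u v → L (λ j → a * u j + v j) ≈ a * L u + L v) →
    ∀ v → L v ≈ ∑ (λ j → v j * L (δ j))
  unit-expansion {zero} L L-cong L-linear v = begin
    -- In dimension zero every vector equals `- v + v`, so linearity alone makes `L` vanish, as the
    -- empty sum does.
    L v                          ≈⟨ L-cong (λ ()) ⟩
    L (λ j → - 1# * v j + v j)   ≈⟨ L-linear (- 1#) v v ⟩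
    - 1# * L v + L v             ≈⟨ solve 1 (λ x → :- con (+ 1) :* x :+ x := con (+ 0)) refl (L v) ⟩
    0#                           ≈⟨ ∑-empty _ ⟨
    ∑ (λ j → v j * L (δ j))      ∎
  unit-expansion {suc n} L L-cong L-linear v = begin
    L v
      ≈⟨ L-cong split ⟩
    L (λ j → v zero * δ zero j + (0# ∷ (v ∘ suc)) j)
      ≈⟨ L-linear (v zero) (δ zero) (0# ∷ (v ∘ suc)) ⟩
    v zero * L (δ zero) + L (0# ∷ (v ∘ suc))
      ≈⟨ +-congˡ (unit-expansion (λ u → L (0# ∷ u)) L′-cong L′-linear (v ∘ suc)) ⟩
    v zero * L (δ zero) + ∑ (λ j → v (suc j) * L (0# ∷ δ j))
      ≈⟨ +-congˡ (∑-cong λ j → *-congˡ (L-cong λ { zero → refl ; (suc _) → refl })) ⟩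
    v zero * L (δ zero) + ∑ (λ j → v (suc j) * L (δ (suc j)))
      ≈⟨ ∑-suc _ ⟨
    ∑ (λ j → v j * L (δ j)) ∎
    where
    split : v ≋ (λ j → v zero * δ zero j + (0# ∷ (v ∘ suc)) j)
    split zero    = solve 1 (λ x → x := x :* con (+ 1) :+ con (+ 0)) refl (v zero)
    split (suc j) = solve 2 (λ x y → y := x :* con (+ 0) :+ y) refl (v zero) (v (suc j))
    L′-cong : ∀ {u w} → u ≋ w → L (0# ∷ u) ≈ L (0# ∷ w)
    L′-cong u≋w = L-cong λ { zero → refl ; (suc j) → u≋w j }
    L′-linear : ∀ a u w → L (0# ∷ λ j → a * u j + w j) ≈ a * L (0# ∷ u) + L (0# ∷ w)
    L′-linear a u w = trans
      (L-cong λ { zero → solve 1 (λ a → con (+ 0) := a :* con (+ 0) :+ con (+ 0)) refl a ; (suc j) → refl })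
      (L-linear a (0# ∷ u) (0# ∷ w))

  -- `step` leaves the other rows arbitrary, so it still applies after some rows have been replaced.
  -- This is how a whole column is cleared by single row additions.
  rowwise-invariant : ∀ {m n} (G : (Fin m → Vector Carrier n) → Carrier) →
    (∀ {M N} → (∀ i → M i ≋ N i) → G M ≈ G N) →
    (f : Vector Carrier n → Vector Carrier n) →
    (∀ i {M N} → (∀ k → k ≢ i → N k ≋ M k) → N i ≋ f (M i) → G N ≈ G M) →
    ∀ M → G (f ∘ M) ≈ G M
  rowwise-invariant {zero}  G G-cong f step M = G-cong λ ()
  rowwise-invariant {suc m} G G-cong f step M = begin
    G (f ∘ M)                        ≈⟨ G-cong (λ { zero _ → refl ; (suc i) _ → refl }) ⟩
    G (f (M zero) ∷ (f ∘ M ∘ suc))   ≈⟨ rowwise-invariant (λ N → G (f (M zero) ∷ N))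
                                          (λ M≋N → G-cong λ { zero _ → refl ; (suc i) → M≋N i }) f
                                          (λ i {P} {Q} same Qi → step (suc i) (others i P Q same) Qi) (M ∘ suc) ⟩
    G (f (M zero) ∷ (M ∘ suc))       ≈⟨ step zero (λ { zero 0≢0 → contradiction ≡.refl 0≢0 ; (suc k) _ _ → refl }) (λ _ → refl) ⟩
    G M                              ∎
    where
    others : ∀ i P Q → (∀ k → k ≢ i → Q k ≋ P k) →
             ∀ k → k ≢ suc i → (f (M zero) ∷ Q) k ≋ (f (M zero) ∷ P) k
    others i P Q same zero    _   _ = refl
    others i P Q same (suc k) k≢i   = same k (k≢i ∘ ≡.cong suc)

  -- `insertAt (v ∘ punchIn j) j 0#` is `v` with its coordinate `j` set to zero, so clearing that
  -- coordinate is adding a multiple of the row `δ j`.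
  split-at : ∀ {n} (j : Fin (suc n)) (v : Vector Carrier (suc n)) l →
             v l ≈ v j * δ j l + insertAt (v ∘ punchIn j) j 0# l
  split-at zero    v zero    = solve 1 (λ x → x := x :* con (+ 1) :+ con (+ 0)) refl (v zero)
  split-at zero    v (suc l) = solve 2 (λ x y → y := x :* con (+ 0) :+ y) refl (v zero) (v (suc l))
  split-at {suc n} (suc j) v zero    = solve 2 (λ x y → y := x :* con (+ 0) :+ y) refl (v (suc j)) (v zero)
  split-at {suc n} (suc j) v (suc l) = split-at j (v ∘ suc) l

  insertAt-cong : ∀ {n} {u v : Vector Carrier n} j → u ≋ v → insertAt u j 0# ≋ insertAt v j 0#
  insertAt-cong zero u≋v zero    = refl
  insertAt-cong zero u≋v (suc l) = u≋v l
  insertAt-cong {suc n} (suc j) u≋v zero    = u≋v zero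
  insertAt-cong {suc n} (suc j) u≋v (suc l) = insertAt-cong j (u≋v ∘ suc) l

  insertAt-linear : ∀ {n} {u v w : Vector Carrier n} j a → (∀ l → w l ≈ a * u l + v l) →
                    ∀ l → insertAt w j 0# l ≈ a * insertAt u j 0# l + insertAt v j 0# l
  insertAt-linear zero a w≈ zero    = solve 1 (λ a → con (+ 0) := a :* con (+ 0) :+ con (+ 0)) refl a
  insertAt-linear zero a w≈ (suc l) = w≈ l
  insertAt-linear {suc n} (suc j) a w≈ zero    = w≈ zero
  insertAt-linear {suc n} (suc j) a w≈ (suc l) = insertAt-linear j a (w≈ ∘ suc) l

  insertAt-δ : ∀ {n} (j : Fin (suc n)) i → insertAt (δ i) j 0# ≋ δ (punchIn j i)
  insertAt-δ zero i zero    = refl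
  insertAt-δ zero i (suc l) = refl
  insertAt-δ (suc j) zero    zero    = refl
  insertAt-δ (suc j) (suc i) zero    = refl
  insertAt-δ (suc zero)    zero (suc zero)    = refl
  insertAt-δ (suc zero)    zero (suc (suc l)) = refl
  insertAt-δ {suc (suc n)} (suc (suc j)) zero (suc zero)    = refl
  insertAt-δ {suc (suc n)} (suc (suc j)) zero (suc (suc l)) = insertAt-zero j l
    where
    insertAt-zero : ∀ {n} (j : Fin (suc n)) l → insertAt {n = n} (λ _ → 0#) j 0# l ≈ 0#
    insertAt-zero zero zero    = refl
    insertAt-zero zero (suc l) = refl
    insertAt-zero {suc n} (suc j) zero    = refl
    insertAt-zero {suc n} (suc j) (suc l) = insertAt-zero j l
  insertAt-δ (suc j) (suc i) (suc l) = insertAt-δ j i l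

  -- This and the next two facts show that `cycle (suc j)` and `cycle (inject₁ j)` differ by
  -- exchanging the places `zero` and `suc j`.
  punchIn-suc : ∀ {n} (j : Fin n) → punchIn (suc j) j ≡ inject₁ j
  punchIn-suc zero    = ≡.refl
  punchIn-suc (suc j) = ≡.cong suc (punchIn-suc j)

  punchIn-inject₁ : ∀ {n} (j : Fin n) → punchIn (inject₁ j) j ≡ suc j
  punchIn-inject₁ zero    = ≡.refl
  punchIn-inject₁ (suc j) = ≡.cong suc (punchIn-inject₁ j)

  punchIn-others : ∀ {n} (j i : Fin n) → i ≢ j → punchIn (suc j) i ≡ punchIn (inject₁ j) i
  punchIn-others zero    zero    i≢j = contradiction ≡.refl i≢j
  punchIn-others zero    (suc i) i≢j = ≡.refl
  punchIn-others (suc j) zero    i≢j = ≡.refl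
  punchIn-others (suc j) (suc i) i≢j = ≡.cong suc (punchIn-others j i (i≢j ∘ ≡.cong suc))

  module _ {n} {F : Matrix Carrier (suc n) → Carrier} (alt : IsAlternating F) where
    private module F = IsAlternating alt

    expand-first-row : ∀ M → F M ≈ ∑ (λ j → M zero j * F (δ j ∷ (M ∘ suc)))
    expand-first-row M = trans
      (F.cong (λ { zero _ → refl ; (suc i) _ → refl }))
      (unit-expansion (λ v → F (v ∷ (M ∘ suc)))
        (λ u≋v → F.cong λ { zero → u≋v ; (suc i) _ → refl })
        (λ a u v → F.linear zero a (tails u _) (tails v _) (λ _ → refl))
        (M zero))
      where
      tails : ∀ u v k → k ≢ zero → (u ∷ (M ∘ suc)) k ≋ (v ∷ (M ∘ suc)) k
      tails u v zero    0≢0 = contradiction ≡.refl 0≢0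
      tails u v (suc k) _ _ = refl

    -- Borders `P` by the first row `δ j` and a column `j` that is zero below it. The result is an
    -- alternating function of the smaller matrix, to which induction on the size applies.
    restrict : Fin (suc n) → Matrix Carrier n → Carrier
    restrict j P = F (δ j ∷ λ i → insertAt (P i) j 0#)

    -- Subtracting multiples of the row δ j from the other rows does not change F.
    clear-column : ∀ j (N : Fin n → Vector Carrier (suc n)) → F (δ j ∷ N) ≈ restrict j (minor j N)
    clear-column j N = sym (rowwise-invariant (λ N → F (δ j ∷ N))
      (λ M≋N → F.cong λ { zero _ → refl ; (suc i) → M≋N i })
      (λ v → insertAt (v ∘ punchIn j) j 0#)
      (λ i {P} {Q} same Qi → sym (F.add-row (suc i) zero (P i j) {δ j ∷ Q} {δ j ∷ P} (λ ())
        (others i same)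
        (λ l → trans (split-at j (P i) l) (+-congˡ (sym (Qi l))))))
      N)
      where
      others : ∀ i {P Q : Fin n → Vector Carrier (suc n)} → (∀ k → k ≢ i → Q k ≋ P k) →
               ∀ k → k ≢ suc i → (δ j ∷ Q) k ≋ (δ j ∷ P) k
      others i same zero    _ _ = refl
      others i same (suc k) k≢i = same k (k≢i ∘ ≡.cong suc)

    restrict-isAlternating : ∀ j → IsAlternating (restrict j)
    restrict-isAlternating j = record
      { cong = λ M≋N → F.cong λ { zero _ → refl ; (suc i) → insertAt-cong j (M≋N i) }
      ; linear = λ i a M≋P N≋P Pi → F.linear (suc i) a (others i M≋P) (others i N≋P) (insertAt-linear j a Pi)
      ; alternating = λ i≢k Mi≋Mk → F.alternating (i≢k ∘ Fin.suc-injective) (insertAt-cong j Mi≋Mk)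
      }
      where
      others : ∀ i {P Q : Matrix Carrier n} → (∀ k → k ≢ i → P k ≋ Q k) → ∀ k → k ≢ suc i →
               (δ j ∷ λ i → insertAt (P i) j 0#) k ≋ (δ j ∷ λ i → insertAt (Q i) j 0#) k
      others i same zero    _ _ = refl
      others i same (suc k) k≢i = insertAt-cong j (same k (k≢i ∘ ≡.cong suc))

    -- Puts `j` in front of the other indices in their order. The permutation is a cycle of length
    -- `toℕ j` + 1, so its sign is the one in Laplace's expansion.
    cycle : Fin (suc n) → Fin (suc n) → Fin (suc n)
    cycle j = j ∷ punchIn j

    restrict-δ : ∀ j → restrict j δ ≈ F (δ ∘ cycle j)
    restrict-δ j = F.cong λ { zero _ → refl ; (suc i) → insertAt-δ j i }

    F-cycle-suc : ∀ (j : Fin n) → F (δ ∘ cycle (suc j)) ≈ - F (δ ∘ cycle (inject₁ j))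
    F-cycle-suc j = F.swap zero (suc j) (λ ()) others
      (≋-reflexive (≡.cong δ (≡.sym (punchIn-inject₁ j))))
      (≋-reflexive (≡.cong δ (punchIn-suc j)))
      where
      others : ∀ l → l ≢ zero → l ≢ suc j → δ (cycle (suc j) l) ≋ δ (cycle (inject₁ j) l)
      others zero    l≢0 l≢j = contradiction ≡.refl l≢0
      others (suc l) l≢0 l≢j = ≋-reflexive (≡.cong δ (punchIn-others j l (l≢j ∘ ≡.cong suc)))

    -- The recursion runs on the number `m`, because `inject₁ j` is not a structural part of
    -- `suc j`.
    F-cycle : ∀ m j → toℕ j ≡ m → F (δ ∘ cycle j) ≈ sign rawRing m * F δ
    F-cycle zero    zero    _  = trans (F.cong λ { zero _ → refl ; (suc i) _ → refl }) (sym (*-identityˡ _))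
    F-cycle (suc m) (suc j) eq = begin
      F (δ ∘ cycle (suc j))            ≈⟨ F-cycle-suc j ⟩
      - F (δ ∘ cycle (inject₁ j))      ≈⟨ -‿cong (F-cycle m (inject₁ j) (≡.trans (Fin.toℕ-inject₁ j) (ℕ.suc-injective eq))) ⟩
      - (sign rawRing m * F δ)         ≈⟨ -‿distribˡ-* _ _ ⟩
      - sign rawRing m * F δ           ∎

  -- An alternating function is fixed by its value at the identity. Its first row is expanded in
  -- unit vectors `δ j`; for each `j` the column below is cleared, induction yields the minor, and
  -- `F-cycle` yields the sign.
  alternating⇒det : ∀ {n} {F : Matrix Carrier n → Carrier} → IsAlternating F → ∀ M → F M ≈ Det M * F δ
  alternating⇒det {zero} {F} alt M = begin
    F M         ≈⟨ IsAlternating.cong alt (λ ()) ⟩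
    F δ         ≈⟨ *-identityˡ _ ⟨
    1# * F δ    ≈⟨ *-congʳ (Det-empty M) ⟨
    Det M * F δ ∎
  alternating⇒det {suc n} {F} alt M = begin
    F M
      ≈⟨ expand-first-row alt M ⟩
    ∑ (λ j → M zero j * F (δ j ∷ (M ∘ suc)))
      ≈⟨ ∑-cong term ⟩
    ∑ (λ j → sgn j * (M zero j * Det (minor j (M ∘ suc))) * F δ)
      ≈⟨ *-distribʳ-∑ (F δ) (λ j → sgn j * (M zero j * Det (minor j (M ∘ suc)))) ⟨
    ∑ (λ j → sgn j * (M zero j * Det (minor j (M ∘ suc)))) * F δ
      ≈⟨ *-congʳ (Det-suc M) ⟨
    Det M * F δ ∎
    where
    term : ∀ j → M zero j * F (δ j ∷ (M ∘ suc)) ≈ sgn j * (M zero j * Det (minor j (M ∘ suc))) * F δ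
    term j = begin
      M zero j * F (δ j ∷ (M ∘ suc))
        ≈⟨ *-congˡ (clear-column alt j (M ∘ suc)) ⟩
      M zero j * restrict alt j (minor j (M ∘ suc))
        ≈⟨ *-congˡ (alternating⇒det (restrict-isAlternating alt j) (minor j (M ∘ suc))) ⟩
      M zero j * (Det (minor j (M ∘ suc)) * restrict alt j δ)
        ≈⟨ *-congˡ (*-congˡ (trans (restrict-δ alt j) (F-cycle alt (toℕ j) j ≡.refl))) ⟩
      M zero j * (Det (minor j (M ∘ suc)) * (sgn j * F δ))
        ≈⟨ solve 4 (λ m d s f → m :* (d :* (s :* f)) := s :* (m :* d) :* f) refl
             (M zero j) (Det (minor j (M ∘ suc))) (sgn j) (F δ) ⟩
      sgn j * (M zero j * Det (minor j (M ∘ suc))) * F δ ∎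

  infixl 7 _⊡_
  _⊡_ : ∀ {n} → Matrix Carrier n → Matrix Carrier n → Matrix Carrier n
  (A ⊡ B) i j = ∑ λ k → A i k * B k j

  -- `M ↦ Det (M ⊡ B)` is alternating in the rows of `M`, and its value at the identity is `Det B`.
  det-⊡ : ∀ {n} (A B : Matrix Carrier n) → Det (A ⊡ B) ≈ Det A * Det B
  det-⊡ {n} A B = trans (alternating⇒det alt A)
    (*-congˡ (det-cong λ i j → ∑-δˡ i (λ k → B k j)))
    where
    module D = IsAlternating (det-isAlternating n)
    alt : IsAlternating (λ M → Det (M ⊡ B))
    alt = record
      { cong = λ M≋N → D.cong λ i j → ∑-cong λ k → *-congʳ (M≋N i k)
      ; linear = λ i a {M} {N} {P} M≋P N≋P Pi → D.linear i a
          (λ k k≢i j → ∑-cong λ l → *-congʳ (M≋P k k≢i l))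
          (λ k k≢i j → ∑-cong λ l → *-congʳ (N≋P k k≢i l))
          (λ j → trans (∑-cong λ k → trans (*-congʳ (Pi k))
            (solve 4 (λ a m n b → (a :* m :+ n) :* b := a :* (m :* b) :+ n :* b) refl a (M i k) (N i k) (B k j)))
            (∑-linear a (λ k → M i k * B k j) (λ k → N i k * B k j)))
      ; alternating = λ i≢k Mi≋Mk → D.alternating i≢k λ j → ∑-cong λ l → *-congʳ (Mi≋Mk l)
      }

  det-neg : ∀ {n} (M : Matrix Carrier n) → Det (λ i j → - M i j) ≈ sign rawRing n * Det M
  det-neg {zero} M = trans (Det-empty _) (sym (trans (*-identityˡ _) (Det-empty M)))
  det-neg {suc n} M = begin
    Det (λ i j → - M i j)
      ≈⟨ Det-suc _ ⟩
    ∑ (λ j → sgn j * (- M zero j * Det (λ i l → - M (suc i) (punchIn j l))))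
      ≈⟨ ∑-cong (λ j → trans (*-congˡ (*-congˡ (det-neg (minor j (M ∘ suc)))))
           (solve 4 (λ s m t d → s :* (:- m :* (t :* d)) := :- t :* (s :* (m :* d))) refl
             (sgn j) (M zero j) (sign rawRing n) (Det (minor j (M ∘ suc))))) ⟩
    ∑ (λ j → - sign rawRing n * (sgn j * (M zero j * Det (minor j (M ∘ suc)))))
      ≈⟨ *-distribˡ-∑ (- sign rawRing n) (λ j → sgn j * (M zero j * Det (minor j (M ∘ suc)))) ⟨
    - sign rawRing n * ∑ (λ j → sgn j * (M zero j * Det (minor j (M ∘ suc))))
      ≈⟨ *-congˡ (Det-suc M) ⟨
    - sign rawRing n * Det M ∎

-- Characteristic polynomials: the trace, and the eigenvalues of a shift and of a square.

module CharacteristicPolynomial {c ℓ} (R : CommutativeRing c ℓ) where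
  open CommutativeRing R hiding (zero)
  open Algebra.Properties.Ring ring
  open Algebra.Properties.Semiring.Exp semiring using (_^_)
  open Relation.Binary.Reasoning.Setoid setoid
  open IntegerCoefficientSolver R
  open Determinant R
  open Multiplicativity R

  -- f is a polynomial function of degree at most n whose xⁿ-coefficient is a.
  Lead : ℕ → Carrier → (Carrier → Carrier) → Set (c Level.⊔ ℓ)
  Lead zero    a f = Level.Lift c (∀ x → f x ≈ a)
  Lead (suc n) a f = ∃ λ b → ∃ λ g → Lead n a g × (∀ x → f x ≈ b + x * g x)

  Lead-cong : ∀ n {a b f g} → a ≈ b → (∀ x → f x ≈ g x) → Lead n a f → Lead n b g
  Lead-cong zero    a≈b f≗g (Level.lift f≈a) = Level.lift λ x → trans (sym (f≗g x)) (trans (f≈a x) a≈b)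
  Lead-cong (suc n) a≈b f≗g (d , h , lead , f≈) =
    d , h , Lead-cong n a≈b (λ _ → refl) lead , λ x → trans (sym (f≗g x)) (f≈ x)

  Lead-linear : ∀ n t {a b f g} → Lead n a f → Lead n b g → Lead n (t * a + b) (λ x → t * f x + g x)
  Lead-linear zero t (Level.lift f≈a) (Level.lift g≈b) = Level.lift λ x → +-cong (*-congˡ (f≈a x)) (g≈b x)
  Lead-linear (suc n) t {f = f} {g} (d , f′ , lead-f , f≈) (e , g′ , lead-g , g≈) =
    t * d + e , (λ x → t * f′ x + g′ x) , Lead-linear n t lead-f lead-g , λ x → begin
      t * f x + g x                                   ≈⟨ +-cong (*-congˡ (f≈ x)) (g≈ x) ⟩
      t * (d + x * f′ x) + (e + x * g′ x)             ≈⟨ solve 6 (λ t d x f e g → t :* (d :+ x :* f) :+ (e :+ x :* g) :=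
                                                           (t :* d :+ e) :+ x :* (t :* f :+ g)) refl t d x (f′ x) e (g′ x) ⟩
      (t * d + e) + x * (t * f′ x + g′ x)             ∎

  Lead-x* : ∀ n {a f} → Lead n a f → Lead (suc n) a (λ x → x * f x)
  Lead-x* n {f = f} lead = 0# , f , lead , λ x → sym (+-identityˡ _)

  Lead-weaken : ∀ n {a f} → Lead n a f → Lead (suc n) 0# f
  Lead-weaken zero {a} (Level.lift f≈a) = a , (λ _ → 0#) , Level.lift (λ _ → refl) , λ x →
    trans (f≈a x) (solve 2 (λ a x → a := a :+ x :* con (+ 0)) refl a x)
  Lead-weaken (suc n) (d , g , lead , f≈) = d , g , Lead-weaken n lead , f≈

  Lead-0 : ∀ n → Lead n 0# (λ _ → 0#)
  Lead-0 zero    = Level.lift λ _ → refl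
  Lead-0 (suc n) = Lead-weaken n (Lead-0 n)

  Lead-^ : ∀ n → Lead n 1# (_^ n)
  Lead-^ zero    = Level.lift λ _ → refl
  Lead-^ (suc n) = Lead-x* n (Lead-^ n)

  Lead-difference : ∀ n {a b f g} → Lead n a f → Lead n b g → Lead n (a - b) (λ x → f x - g x)
  Lead-difference n {a} {b} {f} {g} lead-f lead-g =
    Lead-cong n (flip b a) (λ x → flip (g x) (f x)) (Lead-linear n (- 1#) lead-g lead-f)
    where
    flip : ∀ u v → - 1# * u + v ≈ v - u
    flip = solve 2 (λ u v → :- con (+ 1) :* u :+ v := v :- u) refl

  -- Synthetic division by `x - p`. The quotient keeps the leading coefficient `a`, so repeated
  -- division still says something about `a`.
  division : ∀ n p {a f} → Lead (suc n) a f →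
             ∃ λ g → Lead n a g × (∀ x → f x ≈ f p + (x - p) * g x)
  division zero p {a} {f} (b , g , Level.lift g≈a , f≈) = (λ _ → a) , Level.lift (λ _ → refl) , λ x → begin
    f x                              ≈⟨ trans (f≈ x) (+-congˡ (*-congˡ (g≈a x))) ⟩
    b + x * a                        ≈⟨ solve 4 (λ a b x p → b :+ x :* a := (b :+ p :* a) :+ (x :- p) :* a) refl a b x p ⟩
    (b + p * a) + (x - p) * a        ≈⟨ +-congʳ (trans (f≈ p) (+-congˡ (*-congˡ (g≈a p)))) ⟨
    f p + (x - p) * a                ∎
  division (suc n) p {a} {f} (b , g , lead , f≈) with division n p lead
  ... | h , lead-h , g≈ = (λ x → g p + x * h x) , (g p , h , lead-h , λ _ → refl) , λ x → begin
    f x                                            ≈⟨ trans (f≈ x) (+-congˡ (*-congˡ (g≈ x))) ⟩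
    b + x * (g p + (x - p) * h x)                  ≈⟨ solve 5 (λ b x p g h → b :+ x :* (g :+ (x :- p) :* h) :=
                                                        (b :+ p :* g) :+ (x :- p) :* (g :+ x :* h)) refl b x p (g p) (h x) ⟩
    (b + p * g p) + (x - p) * (g p + x * h x)      ≈⟨ +-congʳ (f≈ p) ⟨
    f p + (x - p) * (g p + x * h x)                ∎

  -- Stands in for distinctness of the points: without inverses, cancellation of their differences
  -- is what division by linear factors requires.
  Separated : (ℕ → Carrier) → Set (c Level.⊔ ℓ)
  Separated p = ∀ {j k} → j ℕ.< k → ∀ y → (p k - p j) * y ≈ 0# → y ≈ 0#

  -- Dividing by `x - p m` leaves a quotient that vanishes at all later points, because `p k - p m`
  -- cancels. The first conclusion is used to compare traces, the second to extend an identity to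
  -- every point.
  vanishing : ∀ n {a f} (p : ℕ → Carrier) → Separated p → Lead n a f →
              ∀ m → (∀ k → m ℕ.≤ k → f (p k) ≈ 0#) → a ≈ 0# × (∀ x → f x ≈ 0#)
  vanishing zero {a} p sep (Level.lift f≈a) m zeros = a≈0 , λ x → trans (f≈a x) a≈0
    where
    a≈0 : a ≈ 0#
    a≈0 = trans (sym (f≈a (p m))) (zeros m ℕ.≤-refl)
  vanishing (suc n) {a} {f} p sep lead m zeros with division n (p m) lead
  ... | g , lead-g , f≈ = proj₁ rec , λ x → trans (f≈g x) (trans (*-congˡ (proj₂ rec x)) (zeroʳ _))
    where
    f≈g : ∀ x → f x ≈ (x - p m) * g x
    f≈g x = trans (f≈ x) (trans (+-congʳ (zeros m ℕ.≤-refl)) (+-identityˡ _))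
    rec : a ≈ 0# × (∀ x → g x ≈ 0#)
    rec = vanishing n p sep lead-g (suc m) λ k m<k →
      sep m<k (g (p k)) (trans (sym (f≈g (p k))) (zeros k (ℕ.<⇒≤ m<k)))

  Degree≤ : ℕ → (Carrier → Carrier) → Set (c Level.⊔ ℓ)
  Degree≤ n f = ∃ λ a → Lead n a f

  Degree≤-cong : ∀ n {f g} → (∀ x → f x ≈ g x) → Degree≤ n f → Degree≤ n g
  Degree≤-cong n f≗g (a , lead) = a , Lead-cong n refl f≗g lead

  Degree≤-+ : ∀ n {f g} → Degree≤ n f → Degree≤ n g → Degree≤ n (λ x → f x + g x)
  Degree≤-+ n (a , lead-f) (b , lead-g) = 1# * a + b ,
    Lead-cong n refl (λ x → +-congʳ (*-identityˡ _)) (Lead-linear n 1# lead-f lead-g)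

  Degree≤-scale : ∀ n t {f} → Degree≤ n f → Degree≤ n (λ x → t * f x)
  Degree≤-scale n t (a , lead) = t * a + 0# ,
    Lead-cong n refl (λ x → +-identityʳ _) (Lead-linear n t lead (Lead-0 n))

  Degree≤-affine : ∀ n s t {f} → Degree≤ n f → Degree≤ (suc n) (λ x → (s * x + t) * f x)
  Degree≤-affine n s t {f} deg@(a , lead) = Degree≤-cong (suc n)
    (λ x → solve 4 (λ s x t f → s :* (x :* f) :+ t :* f := (s :* x :+ t) :* f) refl s x t (f x))
    (Degree≤-+ (suc n) (Degree≤-scale (suc n) s (a , Lead-x* n lead))
                       (Degree≤-scale (suc n) t (0# , Lead-weaken n lead)))

  Degree≤-∑ : ∀ n {m} {f : Fin m → Carrier → Carrier} → (∀ j → Degree≤ n (f j)) →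
              Degree≤ n (λ x → ∑ λ j → f j x)
  Degree≤-∑ n {zero}  deg = 0# , Lead-cong n refl (λ x → sym (∑-empty _)) (Lead-0 n)
  Degree≤-∑ n {suc m} deg = Degree≤-cong n (λ x → sym (∑-suc _)) (Degree≤-+ n (deg zero) (Degree≤-∑ n (deg ∘ suc)))

  det-degree : ∀ {n} (B C : Matrix Carrier n) → Degree≤ n (λ x → Det λ i j → B i j * x + C i j)
  det-degree {zero}  B C = 1# , Level.lift λ x → Det-empty _
  det-degree {suc n} B C = Degree≤-cong (suc n) (λ x → sym (Det-suc _)) (Degree≤-∑ (suc n) λ j →
    Degree≤-scale (suc n) (sgn j) (Degree≤-affine n (B zero j) (C zero j)
      (det-degree (minor j (B ∘ suc)) (minor j (C ∘ suc)))))

  -- Every term of the determinant takes one factor from the row `i`, and that factor does not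
  -- involve `x`; so the degree bound drops by one.
  det-degree-constant-row : ∀ {n} (B C : Matrix Carrier (suc n)) i → (∀ j → B i j ≈ 0#) →
    Degree≤ n (λ x → Det λ i j → B i j * x + C i j)
  det-degree-constant-row {n} B C zero B₀≈0 = Degree≤-cong n
    (λ x → sym (trans (Det-suc _) (∑-cong λ j → *-congˡ (*-congʳ (trans (+-congʳ (trans (*-congʳ (B₀≈0 j)) (zeroˡ x))) (+-identityˡ _))))))
    (Degree≤-∑ n λ j → Degree≤-scale n (sgn j) (Degree≤-scale n (C zero j)
      (det-degree (minor j (B ∘ suc)) (minor j (C ∘ suc)))))
  det-degree-constant-row {suc n} B C (suc i) Bᵢ≈0 = Degree≤-cong (suc n) (λ x → sym (Det-suc _))
    (Degree≤-∑ (suc n) λ j → Degree≤-scale (suc n) (sgn j) (Degree≤-affine n (B zero j) (C zero j)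
      (det-degree-constant-row (minor j (B ∘ suc)) (minor j (C ∘ suc)) i (λ l → Bᵢ≈0 (punchIn j l)))))

  χ : ∀ {n} → Matrix Carrier n → Carrier → Carrier
  χ A x = Det λ i j → x * δ i j - A i j

  -- f is monic of degree 1 + n, and its xⁿ-coefficient is a.
  Monic : ℕ → Carrier → (Carrier → Carrier) → Set (c Level.⊔ ℓ)
  Monic n a f = Lead n a (λ x → f x - x ^ suc n)

  -- With `p` for the power `x ^ suc n`, `(x - b) * f - x * p = x * (f - p) - b * p - b * (f -
  -- p)`. The three terms contribute `a`, `- b` and zero to the coefficient.
  Monic-step : ∀ n b {a f} → Monic n a f → Monic (suc n) (a - b) (λ x → (x - b) * f x)
  Monic-step n b {a} {f} lead = Lead-cong (suc n)
    (solve 2 (λ a b → con (+ 1) :* a :+ (:- b :* con (+ 1) :+ con (+ 0)) := a :- b) refl a b)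
    (λ x → solve 4 (λ x b f p → con (+ 1) :* (x :* (f :- p)) :+ (:- b :* p :+ :- b :* (f :- p)) :=
                                (x :- b) :* f :- x :* p) refl x b (f x) (x ^ suc n))
    (Lead-linear (suc n) 1# (Lead-x* n lead)
      (Lead-linear (suc n) (- b) (Lead-^ (suc n))
        (Lead-cong (suc n) (solve 1 (λ b → :- b :* con (+ 0) :+ con (+ 0) := con (+ 0)) refl b) (λ x → +-identityʳ _)
          (Lead-linear (suc n) (- b) (Lead-weaken n lead) (Lead-0 (suc n))))))

  opaque
    ∏ : ∀ {n} → Vector Carrier n → Carrier
    ∏ = product rawRing

    ∏-def : ∀ {n} (f : Vector Carrier n) → ∏ f ≡ product rawRing f
    ∏-def f = ≡.refl

    ∏-empty : (f : Vector Carrier 0) → ∏ f ≈ 1#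
    ∏-empty f = refl

    ∏-suc : ∀ {n} (f : Vector Carrier (suc n)) → ∏ f ≈ f zero * ∏ (f ∘ suc)
    ∏-suc f = refl

  ∏-cong : ∀ {n} {f g : Vector Carrier n} → f ≋ g → ∏ f ≈ ∏ g
  ∏-cong {zero}  f≋g = trans (∏-empty _) (sym (∏-empty _))
  ∏-cong {suc n} f≋g = trans (∏-suc _) (trans (*-cong (f≋g zero) (∏-cong (f≋g ∘ suc))) (sym (∏-suc _)))

  ∏-* : ∀ {n} (f g : Vector Carrier n) → ∏ (λ i → f i * g i) ≈ ∏ f * ∏ g
  ∏-* {zero}  f g = trans (∏-empty _) (sym (trans (*-cong (∏-empty f) (∏-empty g)) (*-identityˡ 1#)))
  ∏-* {suc n} f g = begin
    ∏ (λ i → f i * g i)                                   ≈⟨ ∏-suc _ ⟩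
    f zero * g zero * ∏ (λ i → f (suc i) * g (suc i))     ≈⟨ *-congˡ (∏-* (f ∘ suc) (g ∘ suc)) ⟩
    f zero * g zero * (∏ (f ∘ suc) * ∏ (g ∘ suc))         ≈⟨ solve 4 (λ a b c d → a :* b :* (c :* d) := (a :* c) :* (b :* d)) refl
                                                               (f zero) (g zero) (∏ (f ∘ suc)) (∏ (g ∘ suc)) ⟩
    (f zero * ∏ (f ∘ suc)) * (g zero * ∏ (g ∘ suc))       ≈⟨ *-cong (∏-suc f) (∏-suc g) ⟨
    ∏ f * ∏ g                                             ∎

  ∏-neg : ∀ {n} (f : Vector Carrier n) → ∏ (λ i → - f i) ≈ sign rawRing n * ∏ f
  ∏-neg {zero}  f = trans (∏-empty _) (sym (trans (*-identityˡ _) (∏-empty f)))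
  ∏-neg {suc n} f = begin
    ∏ (λ i → - f i)                                 ≈⟨ ∏-suc _ ⟩
    - f zero * ∏ (λ i → - f (suc i))                ≈⟨ *-congˡ (∏-neg (f ∘ suc)) ⟩
    - f zero * (sign rawRing n * ∏ (f ∘ suc))       ≈⟨ solve 3 (λ f s p → :- f :* (s :* p) := :- s :* (f :* p)) refl (f zero) (sign rawRing n) (∏ (f ∘ suc)) ⟩
    - sign rawRing n * (f zero * ∏ (f ∘ suc))       ≈⟨ *-congˡ (∏-suc f) ⟨
    - sign rawRing n * ∏ f                          ∎

  sign-square : ∀ n → sign rawRing n * sign rawRing n ≈ 1#
  sign-square zero    = *-identityˡ 1#
  sign-square (suc n) = trans (solve 1 (λ s → :- s :* :- s := s :* s) refl (sign rawRing n)) (sign-square n)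

  ∏-monic : ∀ {n} (μ : Vector Carrier (suc n)) → Monic n (- ∑ μ) (λ x → ∏ λ i → x - μ i)
  ∏-monic {zero} μ = Level.lift λ x → begin
    ∏ (λ i → x - μ i) - x * 1#             ≈⟨ +-congʳ (trans (∏-suc _) (*-congˡ (∏-empty _))) ⟩
    (x - μ zero) * 1# - x * 1#             ≈⟨ solve 2 (λ x m → (x :- m) :* con (+ 1) :- x :* con (+ 1) := :- (m :+ con (+ 0))) refl x (μ zero) ⟩
    - (μ zero + 0#)                        ≈⟨ -‿cong (trans (∑-suc μ) (+-congˡ (∑-empty _))) ⟨
    - ∑ μ                                  ∎
  ∏-monic {suc n} μ = Lead-cong (suc n)
    (trans (solve 2 (λ s m → :- s :- m := :- (m :+ s)) refl (∑ (μ ∘ suc)) (μ zero)) (-‿cong (sym (∑-suc μ))))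
    (λ x → +-congʳ (sym (∏-suc _)))
    (Monic-step n (μ zero) {f = λ x → ∏ λ i → x - μ (suc i)} (∏-monic (μ ∘ suc)))

  tr : ∀ {n} → Matrix Carrier n → Carrier
  tr A = ∑ λ i → A i i

  δ-≢ : ∀ {n} {i j : Fin n} → i ≢ j → δ i j ≈ 0#
  δ-≢ {i = zero}  {zero}  i≢j = contradiction ≡.refl i≢j
  δ-≢ {i = zero}  {suc j} i≢j = refl
  δ-≢ {i = suc i} {zero}  i≢j = refl
  δ-≢ {i = suc i} {suc j} i≢j = δ-≢ (i≢j ∘ ≡.cong suc)

  χ-suc : ∀ {n} (A : Matrix Carrier (suc n)) x →
    χ A x ≈ (x - A zero zero) * χ (minor zero (A ∘ suc)) x +
      ∑ (λ j → - sgn j * (- A zero (suc j) * Det λ i l →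
        δ (suc i) (punchIn (suc j) l) * x + - A (suc i) (punchIn (suc j) l)))
  χ-suc A x = trans (Det-suc _) (trans (∑-suc _) (+-cong
    (trans (*-identityˡ _) (*-congʳ (+-congʳ (*-identityʳ x))))
    (∑-cong λ j → *-congˡ (*-cong (trans (+-congʳ (zeroʳ x)) (+-identityˡ _))
      (det-cong λ i l → +-congʳ (*-comm x _))))))

  -- The first term of the expansion is `x - A zero zero` times a smaller characteristic polynomial.
  -- The minor for column `suc j` has lost the diagonal entry of its row `j`; that row is constant,
  -- so the degree is too small to affect the coefficient.
  χ-monic : ∀ {n} (A : Matrix Carrier (suc n)) → Monic n (- tr A) (χ A)
  χ-monic {zero} A = Level.lift λ x → begin
    χ A x - x * 1#                       ≈⟨ +-congʳ (trans (χ-suc A x) (+-cong (*-congˡ (Det-empty _)) (∑-empty _))) ⟩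
    ((x - a) * 1# + 0#) - x * 1#         ≈⟨ solve 2 (λ x a → ((x :- a) :* con (+ 1) :+ con (+ 0)) :- x :* con (+ 1) :=
                                              :- (a :+ con (+ 0))) refl x a ⟩
    - (a + 0#)                           ≈⟨ -‿cong (trans (∑-suc _) (+-congˡ (∑-empty _))) ⟨
    - tr A                               ∎
    where a = A zero zero
  χ-monic {suc n} A = Lead-cong (suc n)
    (trans (solve 2 (λ t a → con (+ 1) :* (:- t :- a) :+ con (+ 0) := :- (a :+ t)) refl (tr A′) a)
           (-‿cong (sym (∑-suc _))))
    (λ x → trans (solve 3 (λ f r p → con (+ 1) :* (f :- p) :+ r := (f :+ r) :- p) refl
                   ((x - a) * χ A′ x) (rest x) (x ^ suc (suc n)))
                 (+-congʳ (sym (χ-suc A x))))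
    (Lead-linear (suc n) 1# (Monic-step n a {f = χ A′} (χ-monic A′)) (Lead-weaken n (proj₂ rest-degree)))
    where
    a = A zero zero
    A′ = minor zero (A ∘ suc)
    rest : Carrier → Carrier
    rest x = ∑ λ j → - sgn j * (- A zero (suc j) * Det λ i l →
      δ (suc i) (punchIn (suc j) l) * x + - A (suc i) (punchIn (suc j) l))
    rest-degree : Degree≤ n rest
    rest-degree = Degree≤-∑ n λ j → Degree≤-scale n (- sgn j) (Degree≤-scale n (- A zero (suc j))
      (det-degree-constant-row (λ i l → δ (suc i) (punchIn (suc j) l)) (λ i l → - A (suc i) (punchIn (suc j) l)) j
        (λ l → δ-≢ (Fin.punchInᵢ≢i (suc j) l ∘ ≡.sym))))

  HasRoots : ∀ {n} → Matrix Carrier n → Vector Carrier n → Set (c Level.⊔ ℓ)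
  HasRoots A μ = ∀ x → χ A x ≈ ∏ (λ i → x - μ i)

  shift : ∀ {n} (A : Matrix Carrier n) μ t → HasRoots A μ →
          HasRoots (λ i j → A i j + t * δ i j) (λ i → μ i + t)
  shift A μ t roots x = begin
    χ (λ i j → A i j + t * δ i j) x      ≈⟨ det-cong (λ i j → solve 4 (λ x d a t → x :* d :- (a :+ t :* d) := (x :- t) :* d :- a) refl x (δ i j) (A i j) t) ⟩
    χ A (x - t)                          ≈⟨ roots (x - t) ⟩
    ∏ (λ i → (x - t) - μ i)              ≈⟨ ∏-cong (λ i → solve 3 (λ x t m → (x :- t) :- m := x :- (m :+ t)) refl x t (μ i)) ⟩
    ∏ (λ i → x - (μ i + t))              ∎

  δ-sym : ∀ {n} (i j : Fin n) → δ i j ≡ δ j i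
  δ-sym zero    zero    = ≡.refl
  δ-sym zero    (suc j) = ≡.refl
  δ-sym (suc i) zero    = ≡.refl
  δ-sym (suc i) (suc j) = δ-sym i j

  ∑-δʳ : ∀ {n} j (v : Vector Carrier n) → ∑ (λ k → v k * δ k j) ≈ v j
  ∑-δʳ j v = trans (∑-cong λ k → trans (*-comm _ _) (*-congʳ (reflexive (δ-sym k j)))) (∑-δˡ j v)

  -- The second factor `x I + A` equals `- (- x I - A)`, so its determinant is `χ A (- x)` up to the
  -- sign from negating `n` rows.
  χ-square : ∀ {n} (A : Matrix Carrier n) x →
             χ (A ⊡ A) (x * x) ≈ χ A x * (sign rawRing n * χ A (- x))
  χ-square {n} A x = begin
    χ (A ⊡ A) (x * x)                              ≈⟨ det-cong factor ⟨
    Det (minus ⊡ plus)                             ≈⟨ det-⊡ minus plus ⟩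
    χ A x * Det plus                               ≈⟨ *-congˡ (det-cong λ i j → solve 3 (λ x d a → x :* d :+ a := :- (:- x :* d :- a)) refl x (δ i j) (A i j)) ⟩
    χ A x * Det (λ i j → - (- x * δ i j - A i j))  ≈⟨ *-congˡ (det-neg _) ⟩
    χ A x * (sign rawRing n * χ A (- x))           ∎
    where
    minus plus : Matrix Carrier n
    minus i j = x * δ i j - A i j
    plus  i j = x * δ i j + A i j
    factor : ∀ i j → (minus ⊡ plus) i j ≈ x * x * δ i j - (A ⊡ A) i j
    factor i j = begin
      ∑ (λ k → (x * δ i k - A i k) * (x * δ k j + A k j))
        ≈⟨ ∑-cong (λ k → solve 5 (λ x d a e b → (x :* d :- a) :* (x :* e :+ b) :=
             x :* (d :* (x :* e :+ b)) :+ (:- x :* (a :* e) :+ :- (a :* b))) refl x (δ i k) (A i k) (δ k j) (A k j)) ⟩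
      ∑ (λ k → x * (δ i k * (x * δ k j + A k j)) + (- x * (A i k * δ k j) + - (A i k * A k j)))
        ≈⟨ ∑-linear x _ _ ⟩
      x * ∑ (λ k → δ i k * (x * δ k j + A k j)) + ∑ (λ k → - x * (A i k * δ k j) + - (A i k * A k j))
        ≈⟨ +-cong (*-congˡ (∑-δˡ i (λ k → x * δ k j + A k j))) (∑-linear (- x) _ _) ⟩
      x * (x * δ i j + A i j) + (- x * ∑ (λ k → A i k * δ k j) + ∑ (λ k → - (A i k * A k j)))
        ≈⟨ +-congˡ (+-cong (*-congˡ (∑-δʳ j (A i))) (∑-neg _)) ⟩
      x * (x * δ i j + A i j) + (- x * A i j + - (A ⊡ A) i j)
        ≈⟨ solve 4 (λ x d a q → x :* (x :* d :+ a) :+ (:- x :* a :+ :- q) := x :* x :* d :- q) refl x (δ i j) (A i j) ((A ⊡ A) i j) ⟩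
      x * x * δ i j - (A ⊡ A) i j ∎

  ∏-square : ∀ {n} (μ : Vector Carrier n) x →
    ∏ (λ i → x - μ i) * (sign rawRing n * ∏ (λ i → - x - μ i)) ≈ ∏ (λ i → x * x - μ i * μ i)
  ∏-square {n} μ x = begin
    ∏ (λ i → x - μ i) * (s * ∏ (λ i → - x - μ i))
      ≈⟨ *-congˡ (*-congˡ (∏-cong λ i → solve 2 (λ x m → :- x :- m := :- (x :+ m)) refl x (μ i))) ⟩
    ∏ (λ i → x - μ i) * (s * ∏ (λ i → - (x + μ i)))
      ≈⟨ *-congˡ (*-congˡ (∏-neg (λ i → x + μ i))) ⟩
    ∏ (λ i → x - μ i) * (s * (s * ∏ (λ i → x + μ i)))
      ≈⟨ *-congˡ (trans (sym (*-assoc s s _)) (trans (*-congʳ (sign-square n)) (*-identityˡ _))) ⟩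
    ∏ (λ i → x - μ i) * ∏ (λ i → x + μ i)
      ≈⟨ ∏-* (λ i → x - μ i) (λ i → x + μ i) ⟨
    ∏ (λ i → (x - μ i) * (x + μ i))
      ≈⟨ ∏-cong (λ i → solve 2 (λ x m → (x :- m) :* (x :+ m) := x :* x :- m :* m) refl x (μ i)) ⟩
    ∏ (λ i → x * x - μ i * μ i) ∎
    where s = sign rawRing n

  monic-difference : ∀ n {a b f g} → Monic n a f → Monic n b g → Lead n (a - b) (λ x → f x - g x)
  monic-difference n {f = f} {g} lead-f lead-g = Lead-cong n refl
    (λ x → solve 3 (λ f g p → (f :- p) :- (g :- p) := f :- g) refl (f x) (g x) (x ^ suc n))
    (Lead-difference n lead-f lead-g)

  module _ (q : ℕ → Carrier) (separated : Separated (λ k → q k * q k)) where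

    -- Two monic polynomials with the same values have the same next coefficient; here these
    -- coefficients are `- tr A` and `- ∑ μ`.
    trace≈sum-of-roots : ∀ {n} (A : Matrix Carrier n) μ → HasRoots A μ → tr A ≈ ∑ μ
    trace≈sum-of-roots {zero}  A μ roots = trans (∑-empty _) (sym (∑-empty μ))
    trace≈sum-of-roots {suc n} A μ roots = begin
      tr A                                 ≈⟨ solve 2 (λ t s → t := s :- (:- t :- :- s)) refl (tr A) (∑ μ) ⟩
      ∑ μ - (- tr A - - ∑ μ)               ≈⟨ +-congˡ (-‿cong equal) ⟩
      ∑ μ - 0#                             ≈⟨ trans (+-congˡ -0#≈0#) (+-identityʳ _) ⟩
      ∑ μ                                  ∎
      where
      equal : - tr A - - ∑ μ ≈ 0#
      equal = proj₁ (vanishing n (λ k → q k * q k) separated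
        (monic-difference n {f = χ A} {λ x → ∏ λ i → x - μ i} (χ-monic A) (∏-monic μ)) 0
        λ k _ → trans (+-congʳ (roots _)) (-‿inverseʳ _))

    -- The squares already determine a polynomial, and there (A − x)(A + x) = A² − x².
    square-roots : ∀ {n} (A : Matrix Carrier n) μ → HasRoots A μ → HasRoots (A ⊡ A) (λ i → μ i * μ i)
    square-roots {zero}  A μ roots y = trans (Det-empty _) (sym (∏-empty _))
    square-roots {suc n} A μ roots y = begin
      χ (A ⊡ A) y                        ≈⟨ solve 2 (λ f g → f := g :+ (f :- g)) refl (χ (A ⊡ A) y) (∏ (λ i → y - μ i * μ i)) ⟩
      ∏ (λ i → y - μ i * μ i) + (χ (A ⊡ A) y - ∏ (λ i → y - μ i * μ i))
        ≈⟨ +-congˡ (proj₂ (vanishing n (λ k → q k * q k) separated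
             (monic-difference n {f = χ (A ⊡ A)} {λ y → ∏ λ i → y - μ i * μ i} (χ-monic (A ⊡ A)) (∏-monic (λ i → μ i * μ i))) 0
             λ k _ → trans (+-congʳ (at-square (q k))) (-‿inverseʳ _)) y) ⟩
      ∏ (λ i → y - μ i * μ i) + 0#       ≈⟨ +-identityʳ _ ⟩
      ∏ (λ i → y - μ i * μ i)            ∎
      where
      at-square : ∀ x → χ (A ⊡ A) (x * x) ≈ ∏ (λ i → x * x - μ i * μ i)
      at-square x = trans (χ-square A x) (trans (*-cong (roots x) (*-congˡ (roots (- x)))) (∏-square μ x))

-- Inequalities in an archimedean ordered ring.

-- There is no primitive <: x < y is ¬ (y ≤ x), and stability makes reasoning about ≤ classical.
record IsArchimedean {c ℓ} (R : CommutativeRing c ℓ)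
  (_≤_ : CommutativeRing.Carrier R → CommutativeRing.Carrier R → Set ℓ) : Set (c Level.⊔ ℓ) where
  open CommutativeRing R
  open Algebra.Properties.Semiring.Mult semiring using () renaming (_×_ to _·_)
  field
    ≤-reflexive : ∀ {x y} → x ≈ y → x ≤ y
    ≤-trans     : ∀ {x y z} → x ≤ y → y ≤ z → x ≤ z
    ≤-antisym   : ∀ {x y} → x ≤ y → y ≤ x → x ≈ y
    ≤-total     : ∀ {x y} → ¬ (x ≤ y) → y ≤ x
    ≤-stable    : ∀ {x y} → ¬ ¬ (x ≤ y) → x ≤ y
    +-monoʳ-≤   : ∀ z {x y} → x ≤ y → (z + x) ≤ (z + y)
    *-nonNeg    : ∀ {x y} → 0# ≤ x → 0# ≤ y → 0# ≤ (x * y)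
    *-cancel-≤0 : ∀ {x y} → ¬ (x ≤ 0#) → (x * y) ≤ 0# → y ≤ 0#
    1≰0         : ¬ (1# ≤ 0#)
    archimedean : ∀ {x y} → (∀ k → ((k · 1#) * y) ≤ x) → y ≤ 0#

module OrderedRing {c ℓ} {R : CommutativeRing c ℓ}
  {_≤_ : CommutativeRing.Carrier R → CommutativeRing.Carrier R → Set ℓ}
  (isArchimedean : IsArchimedean R _≤_) where

  open CommutativeRing R hiding (zero)
  open IsArchimedean isArchimedean public
  open Algebra.Properties.Ring ring
  open Algebra.Properties.Semiring.Mult semiring using (×-homo-+; ×1-homo-*) renaming (_×_ to _·_)
  open IntegerCoefficientSolver R
  open Determinant R
  open Multiplicativity R
  open CharacteristicPolynomial R

  ≤-preorder : Preorder c ℓ ℓ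
  ≤-preorder = record
    { Carrier = Carrier ; _≈_ = _≈_ ; _≲_ = _≤_
    ; isPreorder = record { isEquivalence = isEquivalence ; reflexive = ≤-reflexive ; trans = ≤-trans } }
  open Relation.Binary.Reasoning.Preorder ≤-preorder

  ι : ℕ → Carrier
  ι k = k · 1#

  ≤-refl : ∀ {x} → x ≤ x
  ≤-refl = ≤-reflexive refl

  +-mono-≤ : ∀ {x y u v} → x ≤ y → u ≤ v → (x + u) ≤ (y + v)
  +-mono-≤ {x} {y} {u} {v} x≤y u≤v = begin
    x + u ≲⟨ +-monoʳ-≤ x u≤v ⟩
    x + v ≈⟨ +-comm x v ⟩
    v + x ≲⟨ +-monoʳ-≤ v x≤y ⟩
    v + y ≈⟨ +-comm v y ⟩
    y + v ∎

  ≤⇒0≤- : ∀ {x y} → x ≤ y → 0# ≤ (y - x)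
  ≤⇒0≤- {x} {y} x≤y = begin
    0#      ≈⟨ -‿inverseˡ x ⟨
    - x + x ≲⟨ +-monoʳ-≤ (- x) x≤y ⟩
    - x + y ≈⟨ +-comm (- x) y ⟩
    y - x   ∎

  0≤-⇒≤ : ∀ {x y} → 0# ≤ (y - x) → x ≤ y
  0≤-⇒≤ {x} {y} 0≤y-x = begin
    x           ≈⟨ +-identityʳ x ⟨
    x + 0#      ≲⟨ +-monoʳ-≤ x 0≤y-x ⟩
    x + (y - x) ≈⟨ solve 2 (λ x y → x :+ (y :- x) := y) refl x y ⟩
    y           ∎

  +-nonNeg : ∀ {x y} → 0# ≤ x → 0# ≤ y → 0# ≤ (x + y)
  +-nonNeg 0≤x 0≤y = ≤-trans (≤-reflexive (sym (+-identityˡ 0#))) (+-mono-≤ 0≤x 0≤y)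

  *-monoˡ-≤ : ∀ {z x y} → 0# ≤ z → x ≤ y → (z * x) ≤ (z * y)
  *-monoˡ-≤ {z} {x} {y} 0≤z x≤y = 0≤-⇒≤ (≤-trans (*-nonNeg 0≤z (≤⇒0≤- x≤y))
    (≤-reflexive (solve 3 (λ z x y → z :* (y :- x) := z :* y :- z :* x) refl z x y)))

  *-mono-≤ : ∀ {x y u v} → 0# ≤ x → x ≤ y → 0# ≤ u → u ≤ v → (x * u) ≤ (y * v)
  *-mono-≤ {x} {y} {u} {v} 0≤x x≤y 0≤u u≤v = begin
    x * u  ≈⟨ *-comm x u ⟩
    u * x  ≲⟨ *-monoˡ-≤ 0≤u x≤y ⟩
    u * y  ≈⟨ *-comm u y ⟩
    y * u  ≲⟨ *-monoˡ-≤ (≤-trans 0≤x x≤y) u≤v ⟩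
    y * v  ∎

  -- The sign of `x` cannot be decided, but the goal is stable: if it failed, `0# ≤ x` would fail
  -- too, so `x ≤ 0#`, and then the square of `0# - x` is non-negative.
  square-nonNeg : ∀ x → 0# ≤ (x * x)
  square-nonNeg x = ≤-stable λ 0≰x² →
    let x≤0 = ≤-total λ 0≤x → 0≰x² (*-nonNeg 0≤x 0≤x)
        0≤0-x = ≤⇒0≤- x≤0
    in 0≰x² (≤-trans (*-nonNeg 0≤0-x 0≤0-x)
         (≤-reflexive (solve 1 (λ x → (con (+ 0) :- x) :* (con (+ 0) :- x) := x :* x) refl x)))

  *-cancelˡ-≤ : ∀ {z x y} → ¬ (z ≤ 0#) → (z * x) ≤ (z * y) → x ≤ y
  *-cancelˡ-≤ {z} {x} {y} z≰0 zx≤zy = begin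
    x                 ≈⟨ solve 2 (λ x y → x := y :+ (x :- y)) refl x y ⟩
    y + (x - y)       ≲⟨ +-monoʳ-≤ y (*-cancel-≤0 z≰0 (begin
      z * (x - y)       ≈⟨ solve 3 (λ z x y → z :* (x :- y) := :- (z :* y) :+ z :* x) refl z x y ⟩
      - (z * y) + z * x ≲⟨ +-monoʳ-≤ _ zx≤zy ⟩
      - (z * y) + z * y ≈⟨ -‿inverseˡ _ ⟩
      0#                ∎)) ⟩
    y + 0#            ≈⟨ +-identityʳ y ⟩
    y                 ∎

  -- If `a ≤ b` failed, `a - b` could be cancelled from `(a - b) * (a + b) ≤ 0#`. Then
  -- `a ≤ - b ≤ 0# ≤ b` after all.
  square-cancel-≤ : ∀ {a b} → 0# ≤ b → (a * a) ≤ (b * b) → a ≤ b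
  square-cancel-≤ {a} {b} 0≤b a²≤b² = ≤-stable λ a≰b →
    let a-b≰0 = λ a-b≤0 → a≰b (begin
          a            ≈⟨ solve 2 (λ a b → a := b :+ (a :- b)) refl a b ⟩
          b + (a - b)  ≲⟨ +-monoʳ-≤ b a-b≤0 ⟩
          b + 0#       ≈⟨ +-identityʳ b ⟩
          b            ∎)
        a+b≤0 = *-cancel-≤0 a-b≰0 (begin
          (a - b) * (a + b)      ≈⟨ solve 2 (λ a b → (a :- b) :* (a :+ b) := :- (b :* b) :+ a :* a) refl a b ⟩
          - (b * b) + a * a      ≲⟨ +-monoʳ-≤ _ a²≤b² ⟩
          - (b * b) + b * b      ≈⟨ -‿inverseˡ _ ⟩
          0#                     ∎)
    in a≰b (begin
      a                ≈⟨ solve 2 (λ a b → a := :- b :+ (a :+ b)) refl a b ⟩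
      - b + (a + b)    ≲⟨ +-mono-≤ (≤-refl {x = - b}) (≤-trans a+b≤0 (≤-trans 0≤b (≤-reflexive (sym (+-identityʳ b))))) ⟩
      - b + (b + 0#)   ≲⟨ ≤-reflexive (solve 1 (λ b → :- b :+ (b :+ con (+ 0)) := con (+ 0)) refl b) ⟩
      0#               ≲⟨ 0≤b ⟩
      b                ∎)

  0≤1 : 0# ≤ 1#
  0≤1 = ≤-trans (square-nonNeg 1#) (≤-reflexive (*-identityˡ 1#))

  0≤ι : ∀ k → 0# ≤ ι k
  0≤ι zero    = ≤-refl
  0≤ι (suc k) = +-nonNeg 0≤1 (0≤ι k)

  ι-mono-≤ : ∀ {j k} → j ℕ.≤ k → ι j ≤ ι k
  ι-mono-≤ {k = k} ℕ.z≤n = 0≤ι k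
  ι-mono-≤ (ℕ.s≤s j≤k)   = +-monoʳ-≤ 1# (ι-mono-≤ j≤k)

  ι-suc≰0 : ∀ k → ¬ (ι (suc k) ≤ 0#)
  ι-suc≰0 k 1+k≤0 = 1≰0 (begin
    1#         ≈⟨ +-identityʳ 1# ⟨
    1# + 0#    ≲⟨ +-monoʳ-≤ 1# (0≤ι k) ⟩
    1# + ι k   ≲⟨ 1+k≤0 ⟩
    0#         ∎)

  ι-+ : ∀ j k → ι (j ℕ.+ k) ≈ ι j + ι k
  ι-+ = ×-homo-+ 1#

  ι-* : ∀ j k → ι (j ℕ.* k) ≈ ι j * ι k
  ι-* = ×1-homo-*

  ι-cancel-≤ : ∀ j k → ι j ≤ ι k → j ℕ.≤ k
  ι-cancel-≤ j k ιj≤ιk = ℕ.≮⇒≥ λ k<j → let d , 1+k+d≡j = ℕ.m≤n⇒∃[o]m+o≡n k<j in ι-suc≰0 d (begin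
    ι (suc d)                ≈⟨ solve 2 (λ k d → d := :- k :+ (k :+ d)) refl (ι k) (ι (suc d)) ⟩
    - ι k + (ι k + ι (suc d)) ≈⟨ +-congˡ (sym (ι-+ k (suc d))) ⟩
    - ι k + ι (k ℕ.+ suc d)  ≈⟨ +-congˡ (reflexive (≡.cong ι (≡.trans (ℕ.+-suc k d) 1+k+d≡j))) ⟩
    - ι k + ι j              ≲⟨ +-monoʳ-≤ _ ιj≤ιk ⟩
    - ι k + ι k              ≈⟨ -‿inverseˡ _ ⟩
    0#                       ∎)

  -- Cancelling the positive difference of squares from `z * y ≤ 0#` and from `z * - y ≤ 0#` gives
  -- the two inequalities that make `y` zero.
  squares-separated : Separated (λ k → ι k * ι k)
  squares-separated {j} {k} j<k y zy≈0 = ≤-antisym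
    (*-cancel-≤0 z≰0 (≤-reflexive zy≈0))
    (0≤-⇒≤ (≤-trans (≤⇒0≤- (*-cancel-≤0 z≰0 (≤-reflexive
       (trans (sym (-‿distribʳ-* z y)) (trans (-‿cong zy≈0) -0#≈0#)))))
       (≤-reflexive (solve 1 (λ y → con (+ 0) :- :- y := y :- con (+ 0)) refl y))))
    where
    z = ι k * ι k - ι j * ι j
    z≰0 : ¬ (z ≤ 0#)
    z≰0 z≤0 = ℕ.<⇒≱ (ℕ.*-mono-< j<k j<k) (ι-cancel-≤ (k ℕ.* k) (j ℕ.* j) (begin
      ι (k ℕ.* k)          ≈⟨ trans (ι-* k k) (solve 2 (λ a b → a := b :+ (a :- b)) refl (ι k * ι k) (ι j * ι j)) ⟩
      ι j * ι j + z        ≲⟨ +-monoʳ-≤ _ z≤0 ⟩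
      ι j * ι j + 0#       ≈⟨ trans (+-identityʳ _) (sym (ι-* j j)) ⟩
      ι (j ℕ.* j)          ∎))

  ∑-mono-≤ : ∀ {n} {f g : Vector Carrier n} → (∀ i → f i ≤ g i) → ∑ f ≤ ∑ g
  ∑-mono-≤ {zero}  {f} {g} f≤g = ≤-reflexive (trans (∑-empty f) (sym (∑-empty g)))
  ∑-mono-≤ {suc n} {f} {g} f≤g = begin
    ∑ f                    ≈⟨ ∑-suc f ⟩
    f zero + ∑ (f ∘ suc)   ≲⟨ +-mono-≤ (f≤g zero) (∑-mono-≤ (f≤g ∘ suc)) ⟩
    g zero + ∑ (g ∘ suc)   ≈⟨ ∑-suc g ⟨
    ∑ g                    ∎

  ∑-const : ∀ n x → ∑ {n} (λ _ → x) ≈ ι n * x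
  ∑-const zero    x = trans (∑-empty _) (sym (zeroˡ x))
  ∑-const (suc n) x = trans (∑-suc _) (trans (+-congˡ (∑-const n x))
    (solve 2 (λ x n → x :+ n :* x := (con (+ 1) :+ n) :* x) refl x (ι n)))

  ∑-nonNeg : ∀ {n} {f : Vector Carrier n} → (∀ i → 0# ≤ f i) → 0# ≤ ∑ f
  ∑-nonNeg 0≤f = ≤-trans (≤-reflexive (sym (∑-zero λ _ → refl))) (∑-mono-≤ 0≤f)

  ∑-inject≤ : ∀ {m n} {f : Vector Carrier n} → (∀ i → 0# ≤ f i) → (m≤n : m ℕ.≤ n) →
              ∑ (λ (i : Fin m) → f (inject≤ i m≤n)) ≤ ∑ f
  ∑-inject≤ {zero}  0≤f m≤n = ≤-trans (≤-reflexive (∑-empty _)) (∑-nonNeg 0≤f)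
  ∑-inject≤ {suc m} {suc n} {f} 0≤f m≤n = begin
    ∑ (λ i → f (inject≤ i m≤n))                              ≈⟨ ∑-suc _ ⟩
    f zero + ∑ (λ i → f (suc (inject≤ i (ℕ.s≤s⁻¹ m≤n))))     ≲⟨ +-monoʳ-≤ (f zero) (∑-inject≤ (0≤f ∘ suc) (ℕ.s≤s⁻¹ m≤n)) ⟩
    f zero + ∑ (f ∘ suc)                                     ≈⟨ ∑-suc f ⟨
    ∑ f                                                      ∎

  -- Induction on the length: the cross term is bounded by summing `2 a b ≤ a² + b²` over the
  -- entries `b` of the tail.
  cauchy-schwarz : ∀ {n} (v : Vector Carrier n) → (∑ v * ∑ v) ≤ (ι n * ∑ (λ i → v i * v i))
  cauchy-schwarz {zero}  v = ≤-reflexive (trans (*-congʳ (∑-empty v)) (trans (zeroˡ _) (sym (zeroˡ _))))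
  cauchy-schwarz {suc n} v = begin
    ∑ v * ∑ v                                             ≈⟨ *-cong (∑-suc v) (∑-suc v) ⟩
    (a + s) * (a + s)                                     ≈⟨ solve 2 (λ a s → (a :+ s) :* (a :+ s) := a :* a :+ (con (+ 2) :* a :* s :+ s :* s)) refl a s ⟩
    a * a + ((1# + 1#) * a * s + s * s)                   ≲⟨ +-monoʳ-≤ _ (+-mono-≤ cross (cauchy-schwarz (v ∘ suc))) ⟩
    a * a + ((ι n * (a * a) + q) + ι n * q)               ≈⟨ solve 3 (λ a q n → a :* a :+ ((n :* (a :* a) :+ q) :+ n :* q) := (con (+ 1) :+ n) :* (a :* a :+ q)) refl a q (ι n) ⟩
    (1# + ι n) * (a * a + q)                              ≈⟨ *-congˡ (∑-suc _) ⟨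
    ι (suc n) * ∑ (λ i → v i * v i)                       ∎
    where
    a = v zero
    s = ∑ (v ∘ suc)
    q = ∑ (λ i → v (suc i) * v (suc i))
    cross : ((1# + 1#) * a * s) ≤ (ι n * (a * a) + q)
    cross = begin
      (1# + 1#) * a * s                                   ≈⟨ *-distribˡ-∑ _ (v ∘ suc) ⟩
      ∑ (λ i → (1# + 1#) * a * v (suc i))                 ≲⟨ ∑-mono-≤ (λ i → 0≤-⇒≤ (≤-trans (square-nonNeg (a - v (suc i)))
                                                              (≤-reflexive (solve 2 (λ a b → (a :- b) :* (a :- b) := (a :* a :+ b :* b) :- con (+ 2) :* a :* b) refl a (v (suc i)))))) ⟩
      ∑ (λ i → a * a + v (suc i) * v (suc i))             ≈⟨ ∑-distrib-+ (λ _ → a * a) (λ i → v (suc i) * v (suc i)) ⟩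
      ∑ {n} (λ i → a * a) + q                             ≈⟨ +-congʳ (∑-const n (a * a)) ⟩
      ι n * (a * a) + q                                   ∎

  -- The origin of the threshold 1/(Δ+1). With `d` = Δ it is the point `w` at which the diagonal
  -- bound `a * d` and the off-diagonal value `1# - a` coincide.
  module _ {d w : Carrier} (0≤d : 0# ≤ d) (w-inverse : (1# + d) * w ≈ 1#) where
    private
      0≤1+d = +-nonNeg 0≤1 0≤d

    ≤-inverse⇒ : ∀ {a} → a ≤ w → (a * d) ≤ (1# - a)
    ≤-inverse⇒ {a} a≤w = 0≤-⇒≤ (≤-trans (≤⇒0≤- (*-monoˡ-≤ 0≤1+d a≤w)) (≤-reflexive
      (trans (+-congʳ w-inverse) (solve 2 (λ a d → con (+ 1) :- (con (+ 1) :+ d) :* a := (con (+ 1) :- a) :- a :* d) refl a d))))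

    inverse-≤⇒ : ∀ {a} → w ≤ a → (1# - a) ≤ (a * d)
    inverse-≤⇒ {a} w≤a = 0≤-⇒≤ (≤-trans (≤⇒0≤- (*-monoˡ-≤ 0≤1+d w≤a)) (≤-reflexive
      (trans (+-congˡ (-‿cong w-inverse)) (solve 2 (λ a d → (con (+ 1) :+ d) :* a :- con (+ 1) := a :* d :- (con (+ 1) :- a)) refl a d))))

  twice-half : ∀ {h} → h + h ≈ 1# → ∀ a b → (1# + 1#) * (a * b * h) ≈ a * b
  twice-half {h} h+h≈1 a b = trans
    (solve 3 (λ a b h → con (+ 2) :* (a :* b :* h) := a :* b :* (h :+ h)) refl a b h)
    (trans (*-congˡ h+h≈1) (*-identityʳ _))

  -- Since a diagonal position is not adjacent, at most one summand survives. An entry is `a * d`,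
  -- `1# - a` or zero, so `c` has to dominate these values separately, not their sum.
  entry-bounds : ∀ {a d c} → 0# ≤ a → 0# ≤ (1# - a) → 0# ≤ d → (a * d) ≤ c → (1# - a) ≤ c →
    ∀ diagonal adjacent → (diagonal ≡ true → adjacent ≡ false) →
    let e = a * (if diagonal then d else 0#) + (1# - a) * (if adjacent then 1# else 0#)
    in (0# ≤ e) × (e ≤ c)
  entry-bounds {a} {d} {c} 0≤a 0≤1-a 0≤d ad≤c 1-a≤c = λ where
      true  true  loop → contradiction (loop ≡.refl) λ ()
      true  false _    → between (*-nonNeg 0≤a 0≤d) ad≤c
        (solve 2 (λ a d → a :* d :+ (con (+ 1) :- a) :* con (+ 0) := a :* d) refl a d)
      false true  _    → between 0≤1-a 1-a≤c
        (solve 1 (λ a → a :* con (+ 0) :+ (con (+ 1) :- a) :* con (+ 1) := con (+ 1) :- a) refl a)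
      false false _    → between ≤-refl (≤-trans 0≤1-a 1-a≤c)
        (solve 1 (λ a → a :* con (+ 0) :+ (con (+ 1) :- a) :* con (+ 0) := con (+ 0)) refl a)
    where
    between : ∀ {x y} → 0# ≤ y → y ≤ c → x ≈ y → (0# ≤ x) × (x ≤ c)
    between 0≤y y≤c x≈y = ≤-trans 0≤y (≤-reflexive (sym x≈y)) , ≤-trans (≤-reflexive x≈y) y≤c

-- The Rayleigh bound and the sum of the largest eigenvalues.

module EigenvalueSums {c ℓ} {R : CommutativeRing c ℓ}
  {_≤_ : CommutativeRing.Carrier R → CommutativeRing.Carrier R → Set ℓ}
  (isArchimedean : IsArchimedean R _≤_) where

  open CommutativeRing R hiding (zero)
  open IntegerCoefficientSolver R
  open Determinant R
  open Multiplicativity R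
  open CharacteristicPolynomial R
  open OrderedRing isArchimedean

  open Relation.Binary.Reasoning.Preorder ≤-preorder

  IsSymmetric : ∀ {n} → Matrix Carrier n → Set ℓ
  IsSymmetric A = ∀ i j → A i j ≈ A j i

  total : ∀ {n} → Matrix Carrier n → Carrier
  total A = ∑ λ i → ∑ λ j → A i j

  ⊡-symmetric : ∀ {n} {A : Matrix Carrier n} → IsSymmetric A → IsSymmetric (A ⊡ A)
  ⊡-symmetric {A = A} sym-A i j = ∑-cong λ k → trans (*-comm (A i k) (A k j)) (*-cong (sym-A k j) (sym-A i k))

  tr-square : ∀ {n} {A : Matrix Carrier n} → IsSymmetric A →
              tr (A ⊡ A) ≈ ∑ (λ i → ∑ λ j → A i j * A i j)
  tr-square sym-A = ∑-cong λ i → ∑-cong λ j → *-congˡ (sym-A j i)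

  -- For symmetric `A`, `1ᵀA²1` is the squared length of the vector `A1` of row sums.
  total-square : ∀ {n} {A : Matrix Carrier n} → IsSymmetric A →
                 total (A ⊡ A) ≈ ∑ (λ k → ∑ (A k) * ∑ (A k))
  total-square {A = A} sym-A = begin-equality
    ∑ (λ i → ∑ λ j → ∑ λ k → A i k * A k j)
      ≈⟨ ∑-cong (λ i → ∑-comm (λ j k → A i k * A k j)) ⟩
    ∑ (λ i → ∑ λ k → ∑ λ j → A i k * A k j)
      ≈⟨ ∑-comm (λ i k → ∑ λ j → A i k * A k j) ⟩
    ∑ (λ k → ∑ λ i → ∑ λ j → A i k * A k j)
      ≈⟨ ∑-cong (λ k → ∑-cong λ i → trans (*-cong (sym-A k i) refl) (*-distribˡ-∑ (A i k) (A k))) ⟨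
    ∑ (λ k → ∑ λ i → A k i * ∑ (A k))
      ≈⟨ ∑-cong (λ k → *-distribʳ-∑ (∑ (A k)) (A k)) ⟨
    ∑ (λ k → ∑ (A k) * ∑ (A k)) ∎

  -- Divided by the square of `ι n * b`, this says that the ratio for `A ⊡ A` and `b * b` is at
  -- least the square of the ratio for `A` and `b`.
  total²≤total-square : ∀ {n} {A : Matrix Carrier n} → IsSymmetric A →
                        (total A * total A) ≤ (ι n * total (A ⊡ A))
  total²≤total-square {n} {A} sym-A = ≤-trans (cauchy-schwarz (λ i → ∑ (A i)))
    (≤-reflexive (*-congˡ (sym (total-square sym-A))))

  total-square≤tr-square : ∀ {n} {A : Matrix Carrier n} → IsSymmetric A →
                           total (A ⊡ A) ≤ (ι n * tr (A ⊡ A))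
  total-square≤tr-square {n} {A} sym-A = begin
    total (A ⊡ A)                                   ≈⟨ total-square sym-A ⟩
    ∑ (λ k → ∑ (A k) * ∑ (A k))                     ≲⟨ ∑-mono-≤ (λ k → cauchy-schwarz (A k)) ⟩
    ∑ (λ k → ι n * ∑ (λ j → A k j * A k j))         ≈⟨ *-distribˡ-∑ (ι n) (λ k → ∑ (λ j → A k j * A k j)) ⟨
    ι n * ∑ (λ k → ∑ (λ j → A k j * A k j))         ≈⟨ *-congˡ (tr-square sym-A) ⟨
    ι n * tr (A ⊡ A)                                ∎

  sum-of-squared-roots : ∀ {n} {A : Matrix Carrier n} {μ} → HasRoots A μ → tr (A ⊡ A) ≈ ∑ (λ i → μ i * μ i)
  sum-of-squared-roots {A = A} {μ} roots =
    trace≈sum-of-roots ι squares-separated (A ⊡ A) _ (square-roots ι squares-separated A μ roots)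

  private
    *≰0 : ∀ {x y} → ¬ (x ≤ 0#) → ¬ (y ≤ 0#) → ¬ ((x * y) ≤ 0#)
    *≰0 x≰0 y≰0 xy≤0 = y≰0 (*-cancel-≤0 x≰0 xy≤0)

  -- If 1ᵀA1 / (n b) is at least 1 + m/k, where b bounds the eigenvalues, then passing
  -- to A² squares it and hence doubles m; but it cannot exceed n.
  module _ (n-1 k-1 : ℕ) where
    private
      n = suc n-1
      k = suc k-1

    module _ {m} {A : Matrix Carrier n} {b} (sym-A : IsSymmetric A) (b≰0 : ¬ (b ≤ 0#))
             (excess : (ι (k ℕ.+ m) * (ι n * b)) ≤ (ι k * total A)) where

      excess-squared : (ι (k ℕ.+ m) * (ι n * b) * (ι (k ℕ.+ m) * (ι n * b))) ≤ (ι k * ι k * (ι n * total (A ⊡ A)))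
      excess-squared = begin
        ι (k ℕ.+ m) * (ι n * b) * (ι (k ℕ.+ m) * (ι n * b))
          ≲⟨ *-mono-≤ 0≤lhs excess 0≤lhs excess ⟩
        ι k * total A * (ι k * total A)
          ≈⟨ solve 2 (λ k t → k :* t :* (k :* t) := k :* k :* (t :* t)) refl (ι k) (total A) ⟩
        ι k * ι k * (total A * total A)
          ≲⟨ *-monoˡ-≤ (*-nonNeg (0≤ι k) (0≤ι k)) (total²≤total-square sym-A) ⟩
        ι k * ι k * (ι n * total (A ⊡ A)) ∎
        where
        0≤lhs : 0# ≤ (ι (k ℕ.+ m) * (ι n * b))
        0≤lhs = *-nonNeg (0≤ι (k ℕ.+ m)) (*-nonNeg (0≤ι n) (≤-total b≰0))

      excess-doubled : (ι (k ℕ.+ (m ℕ.+ m)) * (ι n * (b * b))) ≤ (ι k * total (A ⊡ A))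
      excess-doubled = *-cancelˡ-≤ (*≰0 (ι-suc≰0 k-1) (ι-suc≰0 n-1)) (begin
        ι k * ι n * (ι (k ℕ.+ (m ℕ.+ m)) * (ι n * (b * b)))
          ≈⟨ solve 4 (λ k n k2m b → k :* n :* (k2m :* (n :* (b :* b))) := (n :* b) :* (n :* b) :* (k :* k2m)) refl
               (ι k) (ι n) (ι (k ℕ.+ (m ℕ.+ m))) b ⟩
        (ι n * b) * (ι n * b) * (ι k * ι (k ℕ.+ (m ℕ.+ m)))
          ≲⟨ *-monoˡ-≤ (square-nonNeg _) (begin
               ι k * ι (k ℕ.+ (m ℕ.+ m))     ≈⟨ ι-* k (k ℕ.+ (m ℕ.+ m)) ⟨
               ι (k ℕ.* (k ℕ.+ (m ℕ.+ m)))   ≲⟨ ι-mono-≤ bernoulli ⟩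
               ι ((k ℕ.+ m) ℕ.* (k ℕ.+ m))   ≈⟨ ι-* (k ℕ.+ m) (k ℕ.+ m) ⟩
               ι (k ℕ.+ m) * ι (k ℕ.+ m)     ∎) ⟩
        (ι n * b) * (ι n * b) * (ι (k ℕ.+ m) * ι (k ℕ.+ m))
          ≈⟨ solve 2 (λ x y → x :* x :* (y :* y) := y :* x :* (y :* x)) refl (ι n * b) (ι (k ℕ.+ m)) ⟩
        ι (k ℕ.+ m) * (ι n * b) * (ι (k ℕ.+ m) * (ι n * b))
          ≲⟨ excess-squared ⟩
        ι k * ι k * (ι n * total (A ⊡ A))
          ≈⟨ solve 3 (λ k n t → k :* k :* (n :* t) := k :* n :* (k :* t)) refl (ι k) (ι n) (total (A ⊡ A)) ⟩
        ι k * ι n * (ι k * total (A ⊡ A)) ∎)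
        where
        bernoulli : k ℕ.* (k ℕ.+ (m ℕ.+ m)) ℕ.≤ (k ℕ.+ m) ℕ.* (k ℕ.+ m)
        bernoulli = ℕ.≤-trans (ℕ.m≤m+n _ (m ℕ.* m)) (ℕ.≤-reflexive
          (S.solve 2 (λ k m → k S.:* (k S.:+ (m S.:+ m)) S.:+ m S.:* m S.:= (k S.:+ m) S.:* (k S.:+ m)) ≡.refl k m))
          where module S = ℕ-Solver.+-*-Solver

      -- The square of the ratio is at most `n`: `total (A ⊡ A)` is at most `n` times the sum of the
      -- squared roots, and each of these is at most `b * b`.
      excess-bounded : ∀ {μ} → HasRoots A μ → (∀ i → 0# ≤ μ i) → (∀ i → μ i ≤ b) →
                       (k ℕ.+ m) ℕ.* (k ℕ.+ m) ℕ.≤ k ℕ.* (k ℕ.* n)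
      excess-bounded {μ} roots 0≤μ μ≤b = ι-cancel-≤ _ _ (*-cancelˡ-≤ (*≰0 nb≰0 nb≰0) (begin
        (ι n * b) * (ι n * b) * ι ((k ℕ.+ m) ℕ.* (k ℕ.+ m))
          ≈⟨ *-congˡ (ι-* (k ℕ.+ m) (k ℕ.+ m)) ⟩
        (ι n * b) * (ι n * b) * (ι (k ℕ.+ m) * ι (k ℕ.+ m))
          ≈⟨ solve 2 (λ x y → x :* x :* (y :* y) := y :* x :* (y :* x)) refl (ι n * b) (ι (k ℕ.+ m)) ⟩
        ι (k ℕ.+ m) * (ι n * b) * (ι (k ℕ.+ m) * (ι n * b))
          ≲⟨ excess-squared ⟩
        ι k * ι k * (ι n * total (A ⊡ A))
          ≲⟨ *-monoˡ-≤ (*-nonNeg (0≤ι k) (0≤ι k)) (*-monoˡ-≤ (0≤ι n) total-bound) ⟩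
        ι k * ι k * (ι n * (ι n * (ι n * (b * b))))
          ≈⟨ solve 3 (λ k n b → k :* k :* (n :* (n :* (n :* (b :* b)))) := (n :* b) :* (n :* b) :* (k :* (k :* n))) refl (ι k) (ι n) b ⟩
        (ι n * b) * (ι n * b) * (ι k * (ι k * ι n))
          ≈⟨ *-congˡ (trans (ι-* k (k ℕ.* n)) (*-congˡ (ι-* k n))) ⟨
        (ι n * b) * (ι n * b) * ι (k ℕ.* (k ℕ.* n)) ∎))
        where
        nb≰0 = *≰0 (ι-suc≰0 n-1) b≰0
        total-bound : total (A ⊡ A) ≤ (ι n * (ι n * (b * b)))
        total-bound = begin
          total (A ⊡ A)                   ≲⟨ total-square≤tr-square sym-A ⟩
          ι n * tr (A ⊡ A)                ≈⟨ *-congˡ (sum-of-squared-roots roots) ⟩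
          ι n * ∑ (λ i → μ i * μ i)       ≲⟨ *-monoˡ-≤ (0≤ι n) (∑-mono-≤ λ i → *-mono-≤ (0≤μ i) (μ≤b i) (0≤μ i) (μ≤b i)) ⟩
          ι n * ∑ {n} (λ _ → b * b)       ≈⟨ *-congˡ (∑-const n (b * b)) ⟩
          ι n * (ι n * (b * b))           ∎

    -- Squaring replaces `m` by `m + m`, which exceeds `m` as `1 ≤ m`, so the fuel may drop by one.
    -- When it is spent, `k n ≤ m`, hence `k² n ≤ k m < (k + m)²`, against `excess-bounded`.
    no-excess : ∀ fuel {m} {A : Matrix Carrier n} {μ b} → 1 ℕ.≤ m → k ℕ.* n ℕ.≤ fuel ℕ.+ m →
      IsSymmetric A → HasRoots A μ → (∀ i → 0# ≤ μ i) → (∀ i → μ i ≤ b) → ¬ (b ≤ 0#) →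
      ¬ ((ι (k ℕ.+ m) * (ι n * b)) ≤ (ι k * total A))
    no-excess zero {m} 1≤m kn≤m sym-A roots 0≤μ μ≤b b≰0 excess =
      ℕ.<⇒≱ small (excess-bounded sym-A b≰0 excess roots 0≤μ μ≤b)
      where
      small : k ℕ.* (k ℕ.* n) ℕ.< (k ℕ.+ m) ℕ.* (k ℕ.+ m)
      small = ℕ.≤-<-trans (ℕ.*-monoʳ-≤ k kn≤m) (ℕ.<-≤-trans
        (ℕ.*-monoʳ-< k (ℕ.m<n+m m (ℕ.s≤s ℕ.z≤n)))
        (ℕ.*-monoˡ-≤ (k ℕ.+ m) (ℕ.m≤m+n k m)))
    no-excess (suc fuel) {m} 1≤m kn≤ sym-A roots 0≤μ μ≤b b≰0 excess =
      no-excess fuel (ℕ.≤-trans 1≤m (ℕ.m≤m+n m m))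
        (ℕ.≤-trans kn≤ (ℕ.≤-trans (ℕ.≤-reflexive (≡.sym (ℕ.+-suc fuel m))) (ℕ.+-monoʳ-≤ fuel (ℕ.+-monoˡ-≤ m 1≤m))))
        (⊡-symmetric sym-A) (square-roots ι squares-separated _ _ roots)
        (λ i → square-nonNeg _) (λ i → *-mono-≤ (0≤μ i) (μ≤b i) (0≤μ i) (μ≤b i)) (*≰0 b≰0 b≰0)
        (excess-doubled sym-A b≰0 excess)

  -- By the archimedean property it is enough that every multiple of `total A - ι n * b` stays below
  -- `ι n * b`.
  rayleigh-nonNeg : ∀ {n-1 A μ b} → let n = suc n-1 in IsSymmetric A → HasRoots {n} A μ →
    (∀ i → 0# ≤ μ i) → (∀ i → μ i ≤ b) → ¬ (b ≤ 0#) → total A ≤ (ι n * b)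
  rayleigh-nonNeg {n-1} {A} {μ} {b} sym-A roots 0≤μ μ≤b b≰0 = begin
    total A                                ≈⟨ solve 2 (λ t x → t := x :+ (t :- x)) refl (total A) (ι n * b) ⟩
    ι n * b + (total A - ι n * b)          ≲⟨ +-monoʳ-≤ _ (archimedean multiples-bounded) ⟩
    ι n * b + 0#                           ≈⟨ +-identityʳ _ ⟩
    ι n * b                                ∎
    where
    n = suc n-1
    multiples-bounded : ∀ k → (ι k * (total A - ι n * b)) ≤ (ι n * b)
    multiples-bounded zero    = ≤-trans (≤-reflexive (zeroˡ _)) (*-nonNeg (0≤ι n) (≤-total b≰0))
    multiples-bounded (suc k-1) = ≤-stable λ excess →
      -- If the multiple by `k` reaches `ι n * b`, the ratio is at least 1 + 1/k. This is an excess
      -- with `m = 1`.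
      no-excess n-1 k-1 (k ℕ.* n) ℕ.≤-refl (ℕ.m≤m+n _ 1) sym-A roots 0≤μ μ≤b b≰0 (begin
        ι (k ℕ.+ 1) * (ι n * b)                      ≈⟨ trans (*-congʳ (ι-+ k 1)) (solve 2 (λ k x → (k :+ (con (+ 1) :+ con (+ 0))) :* x := k :* x :+ x) refl (ι k) (ι n * b)) ⟩
        ι k * (ι n * b) + ι n * b                    ≲⟨ +-monoʳ-≤ _ (≤-total excess) ⟩
        ι k * (ι n * b) + ι k * (total A - ι n * b)  ≈⟨ solve 3 (λ k x t → k :* x :+ k :* (t :- x) := k :* t) refl (ι k) (ι n * b) (total A) ⟩
        ι k * total A                                ∎)
      where k = suc k-1

  -- Twice the difference of the two sides is `(1 + x)² + (s - x²) + (1 + s)`. It gives a shift that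
  -- makes all roots positive without absolute values. The nested constants in the identity spell
  -- out `ι 2`, which is `1# + (1# + 0#)`.
  1≤x+2+s : ∀ {x s} → (x * x) ≤ s → 1# ≤ (x + ((1# + 1#) + s))
  1≤x+2+s {x} {s} x²≤s = *-cancelˡ-≤ (ι-suc≰0 1) (0≤-⇒≤ (begin
    0#                                                        ≲⟨ +-nonNeg (square-nonNeg (1# + x)) (+-nonNeg (≤⇒0≤- x²≤s) (+-nonNeg 0≤1 (≤-trans (square-nonNeg x) x²≤s))) ⟩
    (1# + x) * (1# + x) + ((s - x * x) + (1# + s))            ≈⟨ solve 2 (λ x s → (con (+ 1) :+ x) :* (con (+ 1) :+ x) :+ ((s :- x :* x) :+ (con (+ 1) :+ s)) :=
                                                                   (con (+ 1) :+ (con (+ 1) :+ con (+ 0))) :* (x :+ (con (+ 2) :+ s)) :- (con (+ 1) :+ (con (+ 1) :+ con (+ 0))) :* con (+ 1)) refl x s ⟩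
    ι 2 * (x + ((1# + 1#) + s)) - ι 2 * 1#                    ∎))

  ≤∑ : ∀ {n} {f : Vector Carrier n} → (∀ i → 0# ≤ f i) → ∀ i → f i ≤ ∑ f
  ≤∑ {suc n} {f} 0≤f i = ≤-trans (at i) (≤-reflexive (sym (∑-suc f)))
    where
    at : ∀ i → f i ≤ (f zero + ∑ (f ∘ suc))
    at zero    = ≤-trans (≤-reflexive (sym (+-identityʳ _))) (+-monoʳ-≤ _ (∑-nonNeg (0≤f ∘ suc)))
    at (suc i) = ≤-trans (≤-reflexive (sym (+-identityˡ _))) (+-mono-≤ (0≤f zero) (≤∑ (0≤f ∘ suc) i))

  -- Adding `t` to the diagonal raises every root and `b` by `t`, and both sides by `ι n * t`; with
  -- `t` from `1≤x+2+s` the non-negative case applies.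
  rayleigh : ∀ {n-1 A μ b} → let n = suc n-1 in IsSymmetric A → HasRoots {n} A μ →
    (∀ i → μ i ≤ b) → total A ≤ (ι n * b)
  rayleigh {n-1} {A} {μ} {b} sym-A roots μ≤b = begin
    total A                                   ≈⟨ solve 2 (λ x y → x := (x :+ y) :- y) refl (total A) (ι n * t) ⟩
    (total A + ι n * t) - ι n * t             ≈⟨ +-congʳ total-shift ⟨
    total B - ι n * t                         ≲⟨ +-mono-≤ (rayleigh-nonNeg sym-B (shift A μ t roots)
                                                   (λ i → ≤-trans 0≤1 (1≤μ+t i))
                                                   (λ i → +-mono-≤ (μ≤b i) ≤-refl)
                                                   (λ b+t≤0 → 1≰0 (≤-trans (1≤μ+t zero) (≤-trans (+-mono-≤ (μ≤b zero) ≤-refl) b+t≤0)))) ≤-refl ⟩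
    ι n * (b + t) - ι n * t                   ≈⟨ solve 3 (λ n b t → n :* (b :+ t) :- n :* t := n :* b) refl (ι n) b t ⟩
    ι n * b                                   ∎
    where
    n = suc n-1
    t = (1# + 1#) + ∑ (λ i → μ i * μ i)
    B : Matrix Carrier n
    B i j = A i j + t * δ i j
    sym-B : IsSymmetric B
    sym-B i j = +-cong (sym-A i j) (*-congˡ (reflexive (δ-sym i j)))
    1≤μ+t : ∀ i → 1# ≤ (μ i + t)
    1≤μ+t i = 1≤x+2+s (≤∑ (λ i → square-nonNeg (μ i)) i)
    total-shift : total B ≈ total A + ι n * t
    total-shift = trans
      (∑-cong λ i → trans (∑-distrib-+ (A i) (λ j → t * δ i j)) (+-congˡ (∑-δʳ′ i)))
      (trans (∑-distrib-+ (λ i → ∑ (A i)) (λ _ → t)) (+-congˡ (∑-const n t)))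
      where
      ∑-δʳ′ : ∀ (i : Fin n) → ∑ (λ j → t * δ i j) ≈ t
      ∑-δʳ′ i = trans (∑-cong λ j → *-comm t (δ i j)) (∑-δˡ i (λ _ → t))

  -- `r` stands for √k. It enters as an upper bound on `k` after Cauchy-Schwarz, so the inequality
  -- `ι k ≤ r * r` is all that is asked of it.
  sum-of-largest-roots : ∀ {n-1} {A : Matrix Carrier (suc n-1)} {μ c h r} → let n = suc n-1 in
    IsSymmetric A → (∀ i j → 0# ≤ A i j) → (∀ i j → A i j ≤ c) →
    HasRoots A μ → (∀ i → μ i ≤ μ zero) →
    (1# + 1#) * h ≈ c * ι n → 0# ≤ r →
    ∀ k-1 → let k = suc k-1 in ι k ≤ (r * r) → (k≤n : k ℕ.≤ n) →
    ∑ (λ (i : Fin k) → μ (inject≤ i k≤n)) ≤ (h * (1# + r))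
  sum-of-largest-roots {n-1} {A} {μ} {c} {h} {r} sym-A 0≤A A≤c roots μ≤μ₀ 2h≈cn 0≤r k-1 k≤r² k≤n = begin
    ∑ top                               ≈⟨ trans (∑-suc top) (solve 3 (λ m h s → m :+ s := h :+ ((m :- h) :+ s)) refl (μ zero) h (∑ (top ∘ suc))) ⟩
    h + ((μ zero - h) + ∑ (top ∘ suc))  ≈⟨ +-congˡ (∑-suc v) ⟨
    h + ∑ v                             ≲⟨ +-monoʳ-≤ h (square-cancel-≤ (*-nonNeg 0≤r 0≤h) ∑v²≤) ⟩
    h + r * h                           ≈⟨ solve 2 (λ h r → h :+ r :* h := h :* (con (+ 1) :+ r)) refl h r ⟩
    h * (1# + r)                        ∎
    where
    n = suc n-1
    k = suc k-1
    top v : Vector Carrier k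
    top i = μ (inject≤ i k≤n)
    v = (μ zero - h) ∷ (top ∘ suc)

    0≤c : 0# ≤ c
    0≤c = ≤-trans (0≤A zero zero) (A≤c zero zero)

    0≤h : 0# ≤ h
    0≤h = *-cancelˡ-≤ (ι-suc≰0 1) (begin
      ι 2 * 0#        ≈⟨ zeroʳ _ ⟩
      0#              ≲⟨ *-nonNeg 0≤c (0≤ι n) ⟩
      c * ι n         ≈⟨ 2h≈cn ⟨
      (1# + 1#) * h   ≈⟨ *-congʳ (+-congˡ (+-identityʳ 1#)) ⟨
      ι 2 * h         ∎)

    squares≤ : ∑ (λ i → top i * top i) ≤ ((1# + 1#) * h * μ zero)
    squares≤ = begin
      ∑ (λ i → top i * top i)               ≲⟨ ∑-inject≤ {f = λ i → μ i * μ i} (λ i → square-nonNeg (μ i)) k≤n ⟩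
      ∑ (λ i → μ i * μ i)                   ≈⟨ trans (sym (tr-square sym-A)) (sum-of-squared-roots roots) ⟨
      ∑ (λ i → ∑ λ j → A i j * A i j)       ≲⟨ ∑-mono-≤ (λ i → ∑-mono-≤ λ j → ≤-trans (*-monoˡ-≤ (0≤A i j) (A≤c i j)) (≤-reflexive (*-comm _ _))) ⟩
      ∑ (λ i → ∑ λ j → c * A i j)           ≈⟨ trans (*-distribˡ-∑ c (λ i → ∑ (A i))) (∑-cong λ i → *-distribˡ-∑ c (A i)) ⟨
      c * total A                           ≲⟨ *-monoˡ-≤ 0≤c (rayleigh sym-A roots μ≤μ₀) ⟩
      c * (ι n * μ zero)                    ≈⟨ trans (sym (*-assoc _ _ _)) (*-congʳ (sym 2h≈cn)) ⟩
      (1# + 1#) * h * μ zero                ∎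

    ∑v²≤ : (∑ v * ∑ v) ≤ (r * h * (r * h))
    ∑v²≤ = begin
      ∑ v * ∑ v                                                 ≲⟨ cauchy-schwarz v ⟩
      ι k * ∑ (λ i → v i * v i)                                 ≲⟨ *-monoˡ-≤ (0≤ι k) v²≤h² ⟩
      ι k * (h * h)                                             ≈⟨ *-comm _ _ ⟩
      h * h * ι k                                               ≲⟨ *-monoˡ-≤ (square-nonNeg h) k≤r² ⟩
      h * h * (r * r)                                           ≈⟨ solve 2 (λ h r → h :* h :* (r :* r) := r :* h :* (r :* h)) refl h r ⟩
      r * h * (r * h)                                           ∎
      where
      q = ∑ (λ i → top (suc i) * top (suc i))
      v²≤h² : ∑ (λ i → v i * v i) ≤ (h * h)
      v²≤h² = begin
        ∑ (λ i → v i * v i)                                     ≈⟨ ∑-suc _ ⟩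
        (μ zero - h) * (μ zero - h) + q                         ≈⟨ solve 3 (λ m h q → (m :- h) :* (m :- h) :+ q := (h :* h :- con (+ 2) :* h :* m) :+ (m :* m :+ q)) refl (μ zero) h q ⟩
        (h * h - (1# + 1#) * h * μ zero) + (μ zero * μ zero + q) ≈⟨ +-congˡ (∑-suc _) ⟨
        (h * h - (1# + 1#) * h * μ zero) + ∑ (λ i → top i * top i) ≲⟨ +-monoʳ-≤ _ squares≤ ⟩
        (h * h - (1# + 1#) * h * μ zero) + (1# + 1#) * h * μ zero ≈⟨ solve 2 (λ a b → (a :- b) :+ b := a) refl (h * h) ((1# + 1#) * h * μ zero) ⟩
        h * h                                                   ∎

open import Defs

-- Rational estimates.

module RationalOrder where
  open +-*-Solver

  -- One error each for moving `x` and `y` between indices, and three for the gap tolerated at a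
  -- fixed index, make the five parts of `ε` in `≤⇒≤ᵉ`.
  ⅕ : ℚ
  ⅕ = + 1 ℚ./ 5

  scale>0 : ∀ r .{{_ : ℚ.Positive r}} {ε} → 0ℚ ℚ.< ε → 0ℚ ℚ.< r ℚ.* ε
  scale>0 r {ε} ε>0 = ≡.subst (ℚ._< r ℚ.* ε) (ℚ.*-zeroʳ r) (ℚ.*-monoʳ-<-pos r ε>0)

  halves : ∀ ε → ½ ℚ.* ε ℚ.+ ½ ℚ.* ε ≡ ε
  halves = solve 1 (λ ε → con ½ :* ε :+ con ½ :* ε := ε) ≡.refl

  fifths : ∀ y ε → let δ = ⅕ ℚ.* ε in (((y ℚ.+ δ) ℚ.+ (δ ℚ.+ δ ℚ.+ δ)) ℚ.+ δ) ≡ y ℚ.+ ε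
  fifths = solve 2 (λ y ε → let δ = con ⅕ :* ε in (((y :+ δ) :+ (δ :+ δ :+ δ)) :+ δ) := y :+ ε) ≡.refl

  p≤∣p∣ : ∀ p → p ℚ.≤ ℚ.∣ p ∣
  p≤∣p∣ p with ℚ.≤-total 0ℚ p
  ... | inj₁ 0≤p = ℚ.≤-reflexive (≡.sym (ℚ.0≤p⇒∣p∣≡p 0≤p))
  ... | inj₂ p≤0 = ℚ.≤-trans p≤0 (ℚ.0≤∣p∣ p)

  ∣p∣≤ : ∀ {p q} → p ℚ.≤ q → ℚ.- p ℚ.≤ q → ℚ.∣ p ∣ ℚ.≤ q
  ∣p∣≤ {p} p≤q -p≤q with ℚ.∣p∣≡p∨∣p∣≡-p p
  ... | inj₁ e = ≡.subst (ℚ._≤ _) (≡.sym e) p≤q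
  ... | inj₂ e = ≡.subst (ℚ._≤ _) (≡.sym e) -p≤q

  add-difference : ∀ p q → p ≡ q ℚ.+ (p ℚ.- q)
  add-difference = solve 2 (λ p q → p := q :+ (p :- q)) ≡.refl

  close⇒≤ : ∀ p q {ε} → ℚ.∣ p ℚ.- q ∣ ℚ.< ε → p ℚ.≤ q ℚ.+ ε
  close⇒≤ p q {ε} close = ≡.subst (ℚ._≤ q ℚ.+ ε) (≡.sym (add-difference p q))
    (ℚ.+-monoʳ-≤ q (ℚ.≤-trans (p≤∣p∣ (p ℚ.- q)) (ℚ.<⇒≤ close)))

  cancelˡ : ∀ p q → ℚ.- p ℚ.+ (p ℚ.+ q) ≡ q
  cancelˡ = solve 2 (λ p q → :- p :+ (p :+ q) := q) ≡.refl

  +-cancelˡ-≤ : ∀ p {q r} → p ℚ.+ q ℚ.≤ p ℚ.+ r → q ℚ.≤ r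
  +-cancelˡ-≤ p {q} {r} h = ≡.subst₂ ℚ._≤_ (cancelˡ p q) (cancelˡ p r) (ℚ.+-monoʳ-≤ (ℚ.- p) h)

  ε≰½ε : ∀ {ε} → 0ℚ ℚ.< ε → ¬ (ε ℚ.≤ ½ ℚ.* ε)
  ε≰½ε {ε} ε>0 ε≤½ε = ℚ.<-irrefl ≡.refl (ℚ.<-≤-trans (scale>0 ½ ε>0)
    (+-cancelˡ-≤ (½ ℚ.* ε) (≡.subst₂ ℚ._≤_ (≡.sym (halves ε)) (≡.sym (ℚ.+-identityʳ (½ ℚ.* ε))) ε≤½ε)))

  *-mono-≤-bound : ∀ {p B q δ} → 0ℚ ℚ.≤ p → p ℚ.≤ B → q ℚ.≤ δ → 0ℚ ℚ.≤ δ → p ℚ.* q ℚ.≤ B ℚ.* δ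
  *-mono-≤-bound {p} {B} {q} {δ} 0≤p p≤B q≤δ 0≤δ = ℚ.≤-trans
    (ℚ.*-monoˡ-≤-nonNeg p {{ℚ.nonNegative 0≤p}} q≤δ)
    (ℚ.*-monoʳ-≤-nonNeg δ {{ℚ.nonNegative 0≤δ}} p≤B)

  divide : ∀ {B} → 0ℚ ℚ.< B → ∀ {ε} → 0ℚ ℚ.< ε → ∃ λ δ → 0ℚ ℚ.< δ × B ℚ.* δ ≡ ε
  divide {B} B>0 {ε} ε>0 = 1/B ℚ.* ε , scale>0 1/B {{ℚ.1/pos⇒pos B}} ε>0 ,
    ≡.trans (≡.sym (ℚ.*-assoc B 1/B ε)) (≡.trans (≡.cong (ℚ._* ε) (ℚ.*-inverseʳ B)) (ℚ.*-identityˡ ε))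
    where
    instance
      B-pos : ℚ.Positive B
      B-pos = ℚ.positive B>0
      B≢0 : ℚ.NonZero B
      B≢0 = ℚ.pos⇒nonZero B
    1/B = ℚ.1/ B

  -- Mirrors the repeated sum that defines `ι`, so that the terms of `ι k` are `embed k` by
  -- induction; `embed≡/1` connects it with `fromℕ`.
  embed : ℕ → ℚ
  embed zero    = 0ℚ
  embed (suc k) = 1ℚ ℚ.+ embed k

  embed≡/1 : ∀ k → embed k ≡ + k ℚ./ 1
  embed≡/1 zero    = ≡.refl
  embed≡/1 (suc k) = ≡.trans (≡.cong (1ℚ ℚ.+_) (embed≡/1 k)) (ℚ.toℚᵘ-injective (begin
      ℚ.toℚᵘ (1ℚ ℚ.+ (+ k ℚ./ 1))            ≈⟨ ℚ.toℚᵘ-homo-+ 1ℚ (+ k ℚ./ 1) ⟩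
      ℚᵘ.1ℚᵘ ℚᵘ.+ ℚ.toℚᵘ (+ k ℚ./ 1)         ≈⟨ ℚᵘ.+-congʳ ℚᵘ.1ℚᵘ (ℚ.toℚᵘ-fromℚᵘ (ℚᵘ.mkℚᵘ (+ k) 0)) ⟩
      ℚᵘ.1ℚᵘ ℚᵘ.+ ℚᵘ.mkℚᵘ (+ k) 0            ≈⟨ ℚᵘ.*≡* (≡.cong (λ z → (+ 1 ℤ.+ z) ℤ.* + 1) (ℤ.*-identityʳ (+ k))) ⟩
      ℚᵘ.mkℚᵘ (+ suc k) 0                    ≈⟨ ℚ.toℚᵘ-fromℚᵘ (ℚᵘ.mkℚᵘ (+ suc k) 0) ⟨
      ℚ.toℚᵘ (+ suc k ℚ./ 1)                 ∎))
    where open import Relation.Binary.Reasoning.Setoid ℚᵘ.≃-setoid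

  -- The absolute value of the numerator works, since the denominator is at least one.
  ≤embed : ∀ q → ∃ λ k → q ℚ.≤ embed k
  ≤embed q@(mkℚ n d _) = k , ≡.subst (q ℚ.≤_) (≡.sym (embed≡/1 k)) (ℚ.toℚᵘ-cancel-≤
    (ℚᵘ.≤-respʳ-≃ (ℚᵘ.≃-sym (ℚ.toℚᵘ-fromℚᵘ (ℚᵘ.mkℚᵘ (+ k) 0))) (ℚᵘ.*≤* (num≤ n))))
    where
    k = ℤ.∣ n ∣
    num≤ : ∀ n → n ℤ.* + 1 ℤ.≤ + ℤ.∣ n ∣ ℤ.* + suc d
    num≤ (+ m)    = ≡.subst₂ ℤ._≤_ (≡.sym (ℤ.*-identityʳ (+ m))) (ℤ.pos-* m (suc d)) (ℤ.+≤+ (ℕ.m≤m*n m (suc d)))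
    num≤ -[1+ m ] = ℤ.-≤+

-- The Cauchy reals as an archimedean ordered ring.

module Reals where
  open RationalOrder

  infix 4 _≤ᵉ_
  -- A refuted strict inequality carries no numbers. This equivalent form supplies the index and the
  -- error that estimates of products work with.
  _≤ᵉ_ : ℝ → ℝ → Set
  x ≤ᵉ y = ∀ ε → 0ℚ ℚ.< ε → ∃ λ N → ∀ n → N ℕ.≤ n → seq x n ℚ.≤ seq y n ℚ.+ ε

  -- Rationals are comparable, so the terms at one late index `N` decide. If `x` exceeded `y` there
  -- by `3 δ`, moving both to a later index would cost `2 δ` and leave the gap `δ` that makes
  -- `y < x`.
  ≤⇒≤ᵉ : ∀ x y → x ≤ y → x ≤ᵉ y
  ≤⇒≤ᵉ x y x≤y ε ε>0 with cauchy x (⅕ ℚ.* ε) (scale>0 ⅕ ε>0) | cauchy y (⅕ ℚ.* ε) (scale>0 ⅕ ε>0)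
  ... | Nx , x-close | Ny , y-close = N , bound
    where
    δ = ⅕ ℚ.* ε
    N = Nx ℕ.⊔ Ny
    close : ∀ {z M} → M ℕ.≤ N → (∀ m n → M ℕ.≤ m → M ℕ.≤ n → ℚ.∣ seq z m ℚ.- seq z n ∣ ℚ.< δ) →
            ∀ m n → N ℕ.≤ m → N ℕ.≤ n → seq z m ℚ.≤ seq z n ℚ.+ δ
    close {z} M≤N h m n N≤m N≤n = close⇒≤ (seq z m) (seq z n) (h m n (ℕ.≤-trans M≤N N≤m) (ℕ.≤-trans M≤N N≤n))
    x-N = close {x} (ℕ.m≤m⊔n Nx Ny) x-close
    y-N = close {y} (ℕ.m≤n⊔m Nx Ny) y-close
    at-N : seq x N ℚ.≤ seq y N ℚ.+ (δ ℚ.+ δ ℚ.+ δ)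
    at-N with seq x N ℚ.≤? seq y N ℚ.+ (δ ℚ.+ δ ℚ.+ δ)
    ... | yes p = p
    ... | no ¬p = contradiction (mk< δ (scale>0 ⅕ ε>0) N apart) x≤y
      where
      regroup : ∀ y δ → ((y ℚ.+ δ) ℚ.+ δ) ℚ.+ δ ≡ y ℚ.+ (δ ℚ.+ δ ℚ.+ δ)
      regroup = solve 2 (λ y δ → ((y :+ δ) :+ δ) :+ δ := y :+ (δ :+ δ :+ δ)) ≡.refl
        where open +-*-Solver
      apart : ∀ n → N ℕ.≤ n → seq y n ℚ.+ δ ℚ.≤ seq x n
      apart n N≤n = +-cancelˡ-≤ δ (begin
        δ ℚ.+ (seq y n ℚ.+ δ)                ≡⟨ ℚ.+-comm δ _ ⟩
        (seq y n ℚ.+ δ) ℚ.+ δ                ≤⟨ ℚ.+-monoˡ-≤ δ (ℚ.+-monoˡ-≤ δ (y-N n N N≤n ℕ.≤-refl)) ⟩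
        ((seq y N ℚ.+ δ) ℚ.+ δ) ℚ.+ δ        ≡⟨ regroup (seq y N) δ ⟩
        seq y N ℚ.+ (δ ℚ.+ δ ℚ.+ δ)          ≤⟨ ℚ.<⇒≤ (ℚ.≰⇒> ¬p) ⟩
        seq x N                              ≤⟨ x-N N n ℕ.≤-refl N≤n ⟩
        seq x n ℚ.+ δ                        ≡⟨ ℚ.+-comm (seq x n) δ ⟩
        δ ℚ.+ seq x n                        ∎)
        where open ℚ.≤-Reasoning
    bound : ∀ n → N ℕ.≤ n → seq x n ℚ.≤ seq y n ℚ.+ ε
    bound n N≤n = begin
      seq x n                                                  ≤⟨ x-N n N N≤n ℕ.≤-refl ⟩
      seq x N ℚ.+ δ                                            ≤⟨ ℚ.+-monoˡ-≤ δ at-N ⟩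
      (seq y N ℚ.+ (δ ℚ.+ δ ℚ.+ δ)) ℚ.+ δ                      ≤⟨ ℚ.+-monoˡ-≤ δ (ℚ.+-monoˡ-≤ (δ ℚ.+ δ ℚ.+ δ) (y-N N n ℕ.≤-refl N≤n)) ⟩
      ((seq y n ℚ.+ δ) ℚ.+ (δ ℚ.+ δ ℚ.+ δ)) ℚ.+ δ              ≡⟨ fifths (seq y n) ε ⟩
      seq y n ℚ.+ ε                                            ∎
      where open ℚ.≤-Reasoning

  ≤ᵉ⇒≤ : ∀ x y → x ≤ᵉ y → x ≤ y
  ≤ᵉ⇒≤ x y x≤y (mk< g g>0 M apart) with x≤y (½ ℚ.* g) (scale>0 ½ g>0)
  ... | N , h = ε≰½ε g>0 (+-cancelˡ-≤ (seq y n)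
    (ℚ.≤-trans (apart n (ℕ.m≤n⊔m N M)) (h n (ℕ.m≤m⊔n N M))))
    where n = N ℕ.⊔ M

  pointwise-≤ : ∀ x y → (∀ n → seq x n ℚ.≤ seq y n) → x ≤ y
  pointwise-≤ x y x≤y = ≤ᵉ⇒≤ x y λ ε ε>0 → 0 , λ n _ → ℚ.≤-trans (x≤y n)
    (≡.subst (ℚ._≤ seq y n ℚ.+ ε) (ℚ.+-identityʳ (seq y n)) (ℚ.+-monoʳ-≤ (seq y n) (ℚ.<⇒≤ ε>0)))

  pointwise-≈ : ∀ x y → (∀ n → seq x n ≡ seq y n) → x ≈ y
  pointwise-≈ x y x≡y = pointwise-≤ x y (ℚ.≤-reflexive ∘ x≡y) , pointwise-≤ y x (ℚ.≤-reflexive ∘ ≡.sym ∘ x≡y)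

  ≤-trans : ∀ x y z → x ≤ y → y ≤ z → x ≤ z
  ≤-trans x y z x≤y y≤z = ≤ᵉ⇒≤ x z λ ε ε>0 →
    let N , x≤y+ = ≤⇒≤ᵉ x y x≤y (½ ℚ.* ε) (scale>0 ½ ε>0)
        M , y≤z+ = ≤⇒≤ᵉ y z y≤z (½ ℚ.* ε) (scale>0 ½ ε>0)
    in N ℕ.⊔ M , λ n N⊔M≤n → begin
      seq x n                                   ≤⟨ x≤y+ n (ℕ.≤-trans (ℕ.m≤m⊔n N M) N⊔M≤n) ⟩
      seq y n ℚ.+ ½ ℚ.* ε                       ≤⟨ ℚ.+-monoˡ-≤ (½ ℚ.* ε) (y≤z+ n (ℕ.≤-trans (ℕ.m≤n⊔m N M) N⊔M≤n)) ⟩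
      (seq z n ℚ.+ ½ ℚ.* ε) ℚ.+ ½ ℚ.* ε         ≡⟨ ≡.trans (ℚ.+-assoc (seq z n) _ _) (≡.cong (seq z n ℚ.+_) (halves ε)) ⟩
      seq z n ℚ.+ ε                             ∎
    where open ℚ.≤-Reasoning

  ≈-refl : ∀ x → x ≈ x
  ≈-refl x = pointwise-≈ x x λ _ → ≡.refl

  ≈-trans : ∀ x y z → x ≈ y → y ≈ z → x ≈ z
  ≈-trans x y z (x≤y , y≤x) (y≤z , z≤y) = ≤-trans x y z x≤y y≤z , ≤-trans z y x z≤y y≤x

  +-monoʳ-≤ : ∀ z x y → x ≤ y → z + x ≤ z + y
  +-monoʳ-≤ z x y x≤y (mk< g g>0 N apart) = x≤y (mk< g g>0 N λ n N≤n → +-cancelˡ-≤ (seq z n)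
    (≡.subst (ℚ._≤ seq z n ℚ.+ seq x n) (ℚ.+-assoc (seq z n) (seq y n) g) (apart n N≤n)))

  +-comm : ∀ x y → x + y ≈ y + x
  +-comm x y = pointwise-≈ (x + y) (y + x) λ n → ℚ.+-comm (seq x n) (seq y n)

  +-congˡ : ∀ z x y → x ≈ y → z + x ≈ z + y
  +-congˡ z x y (x≤y , y≤x) = +-monoʳ-≤ z x y x≤y , +-monoʳ-≤ z y x y≤x

  +-cong : ∀ x y u v → x ≈ y → u ≈ v → x + u ≈ y + v
  +-cong x y u v x≈y u≈v = ≈-trans (x + u) (x + v) (y + v) (+-congˡ x u v u≈v)
    (≈-trans (x + v) (v + x) (y + v) (+-comm x v)
      (≈-trans (v + x) (v + y) (y + v) (+-congˡ v x y x≈y) (+-comm v y)))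

  neg-antimono-≤ : ∀ x y → x ≤ y → - y ≤ - x
  neg-antimono-≤ x y x≤y (mk< g g>0 N apart) = x≤y (mk< g g>0 N λ n N≤n →
    ≡.subst₂ ℚ._≤_ (left (seq x n) (seq y n) g) (right (seq x n) (seq y n))
      (ℚ.+-monoʳ-≤ (seq x n ℚ.+ seq y n) (apart n N≤n)))
    where
    open +-*-Solver
    left : ∀ a b g → (a ℚ.+ b) ℚ.+ (ℚ.- a ℚ.+ g) ≡ b ℚ.+ g
    left = solve 3 (λ a b g → (a :+ b) :+ (:- a :+ g) := b :+ g) ≡.refl
    right : ∀ a b → (a ℚ.+ b) ℚ.+ (ℚ.- b) ≡ a
    right = solve 2 (λ a b → (a :+ b) :+ (:- b) := a) ≡.refl

  eventually-bounded : ∀ x → ∃ λ B → 0ℚ ℚ.< B × ∃ λ N → ∀ n → N ℕ.≤ n → ℚ.∣ seq x n ∣ ℚ.≤ B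
  eventually-bounded x with cauchy x 1ℚ (ℚ.positive⁻¹ 1ℚ)
  ... | N , close = B , ℚ.+-mono-<-≤ {0ℚ} {1ℚ} (ℚ.positive⁻¹ 1ℚ) (ℚ.0≤∣p∣ (seq x N)) , N , λ n N≤n → begin
      ℚ.∣ seq x n ∣                                       ≡⟨ ≡.cong ℚ.∣_∣ (≡.trans (add-difference (seq x n) (seq x N)) (ℚ.+-comm (seq x N) _)) ⟩
      ℚ.∣ (seq x n ℚ.- seq x N) ℚ.+ seq x N ∣             ≤⟨ ℚ.∣p+q∣≤∣p∣+∣q∣ (seq x n ℚ.- seq x N) (seq x N) ⟩
      ℚ.∣ seq x n ℚ.- seq x N ∣ ℚ.+ ℚ.∣ seq x N ∣         ≤⟨ ℚ.+-monoˡ-≤ ℚ.∣ seq x N ∣ (ℚ.<⇒≤ (close n N N≤n ℕ.≤-refl)) ⟩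
      B                                                   ∎
    where
    open ℚ.≤-Reasoning
    B = 1ℚ ℚ.+ ℚ.∣ seq x N ∣

  -- The sign of `w` is unknown, so both halves of `u ≈ v` are used: they bound the distance of the
  -- terms by `δ`, and `δ` is chosen so that a bound `B` of `w` gives `B * δ = ε`.
  *-congˡ-≤ : ∀ w u v → u ≈ v → w * u ≤ w * v
  *-congˡ-≤ w u v (u≤v , v≤u) = ≤ᵉ⇒≤ (w * u) (w * v) λ ε ε>0 →
    let B , B>0 , L , w≤B = eventually-bounded w
        δ , δ>0 , Bδ≡ε = divide B>0 ε>0
        N , u≤v+ = ≤⇒≤ᵉ u v u≤v δ δ>0
        M , v≤u+ = ≤⇒≤ᵉ v u v≤u δ δ>0
    in L ℕ.⊔ (N ℕ.⊔ M) , λ n K≤n →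
      let L≤n = ℕ.≤-trans (ℕ.m≤m⊔n L (N ℕ.⊔ M)) K≤n
          N⊔M≤n = ℕ.≤-trans (ℕ.m≤n⊔m L (N ℕ.⊔ M)) K≤n
          a = seq w n
          p = seq u n
          q = seq v n
          p-q≤δ = ≡.subst (p ℚ.- q ℚ.≤_) (shift q δ) (ℚ.+-monoˡ-≤ (ℚ.- q) (u≤v+ n (ℕ.≤-trans (ℕ.m≤m⊔n N M) N⊔M≤n)))
          q-p≤δ = ≡.subst₂ ℚ._≤_ (flip p q) (shift p δ) (ℚ.+-monoˡ-≤ (ℚ.- p) (v≤u+ n (ℕ.≤-trans (ℕ.m≤n⊔m N M) N⊔M≤n)))
      in begin
        a ℚ.* p                              ≡⟨ ≡.cong (a ℚ.*_) (add-difference p q) ⟩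
        a ℚ.* (q ℚ.+ (p ℚ.- q))              ≡⟨ ℚ.*-distribˡ-+ a q (p ℚ.- q) ⟩
        a ℚ.* q ℚ.+ a ℚ.* (p ℚ.- q)          ≤⟨ ℚ.+-monoʳ-≤ (a ℚ.* q) (p≤∣p∣ (a ℚ.* (p ℚ.- q))) ⟩
        a ℚ.* q ℚ.+ ℚ.∣ a ℚ.* (p ℚ.- q) ∣    ≡⟨ ≡.cong (a ℚ.* q ℚ.+_) (ℚ.∣p*q∣≡∣p∣*∣q∣ a (p ℚ.- q)) ⟩
        a ℚ.* q ℚ.+ ℚ.∣ a ∣ ℚ.* ℚ.∣ p ℚ.- q ∣ ≤⟨ ℚ.+-monoʳ-≤ (a ℚ.* q) (*-mono-≤-bound (ℚ.0≤∣p∣ a) (w≤B n L≤n) (∣p∣≤ p-q≤δ q-p≤δ) (ℚ.<⇒≤ δ>0)) ⟩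
        a ℚ.* q ℚ.+ B ℚ.* δ                  ≡⟨ ≡.cong (a ℚ.* q ℚ.+_) Bδ≡ε ⟩
        a ℚ.* q ℚ.+ ε                        ∎
    where
    open ℚ.≤-Reasoning
    open +-*-Solver using (solve; _:+_; _:-_; :-_; _:=_)
    shift : ∀ q δ → (q ℚ.+ δ) ℚ.- q ≡ δ
    shift = solve 2 (λ q δ → (q :+ δ) :- q := δ) ≡.refl
    flip : ∀ p q → q ℚ.- p ≡ ℚ.- (p ℚ.- q)
    flip = solve 2 (λ p q → q :- p := :- (p :- q)) ≡.refl

  *-comm : ∀ x y → x * y ≈ y * x
  *-comm x y = pointwise-≈ (x * y) (y * x) λ n → ℚ.*-comm (seq x n) (seq y n)

  *-congˡ : ∀ w u v → u ≈ v → w * u ≈ w * v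
  *-congˡ w u v u≈v@(u≤v , v≤u) = *-congˡ-≤ w u v u≈v , *-congˡ-≤ w v u (v≤u , u≤v)

  *-cong : ∀ x y u v → x ≈ y → u ≈ v → x * u ≈ y * v
  *-cong x y u v x≈y u≈v = ≈-trans (x * u) (x * v) (y * v) (*-congˡ x u v u≈v)
    (≈-trans (x * v) (v * x) (y * v) (*-comm x v)
      (≈-trans (v * x) (v * y) (y * v) (*-congˡ v x y x≈y) (*-comm v y)))

  ℝ-commutativeRing : CommutativeRing _ _
  ℝ-commutativeRing = record
    { Carrier = ℝ ; _≈_ = _≈_ ; _+_ = _+_ ; _*_ = _*_ ; -_ = -_ ; 0# = 0ℝ ; 1# = 1ℝ
    ; isCommutativeRing = record
      { isRing = record
        { +-isAbelianGroup = record
          { isGroup = record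
            { isMonoid = record
              { isSemigroup = record
                { isMagma = record
                  { isEquivalence = record
                    { refl = λ {x} → ≈-refl x
                    ; sym = λ (x≤y , y≤x) → y≤x , x≤y
                    ; trans = λ {x} {y} {z} → ≈-trans x y z }
                  ; ∙-cong = λ {x} {y} {u} {v} → +-cong x y u v }
                ; assoc = λ x y z → pointwise-≈ ((x + y) + z) (x + (y + z)) λ n → ℚ.+-assoc (seq x n) (seq y n) (seq z n) }
              ; identity = (λ x → pointwise-≈ (0ℝ + x) x λ n → ℚ.+-identityˡ (seq x n))
                         , (λ x → pointwise-≈ (x + 0ℝ) x λ n → ℚ.+-identityʳ (seq x n)) }
            ; inverse = (λ x → pointwise-≈ (- x + x) 0ℝ λ n → ℚ.+-inverseˡ (seq x n))
                      , (λ x → pointwise-≈ (x + - x) 0ℝ λ n → ℚ.+-inverseʳ (seq x n))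
            ; ⁻¹-cong = λ {x} {y} (x≤y , y≤x) → neg-antimono-≤ y x y≤x , neg-antimono-≤ x y x≤y }
          ; comm = +-comm }
        ; *-cong = λ {x} {y} {u} {v} → *-cong x y u v
        ; *-assoc = λ x y z → pointwise-≈ ((x * y) * z) (x * (y * z)) λ n → ℚ.*-assoc (seq x n) (seq y n) (seq z n)
        ; *-identity = (λ x → pointwise-≈ (1ℝ * x) x λ n → ℚ.*-identityˡ (seq x n))
                     , (λ x → pointwise-≈ (x * 1ℝ) x λ n → ℚ.*-identityʳ (seq x n))
        ; distrib = (λ x y z → pointwise-≈ (x * (y + z)) (x * y + x * z) λ n → ℚ.*-distribˡ-+ (seq x n) (seq y n) (seq z n))
                  , (λ x y z → pointwise-≈ ((y + z) * x) (y * x + z * x) λ n → ℚ.*-distribʳ-+ (seq x n) (seq y n) (seq z n)) }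
      ; *-comm = *-comm } }

  <⇒≤ : ∀ x y → x < y → x ≤ y
  <⇒≤ x y (mk< g g>0 N x<y) (mk< h h>0 M y<x) = ℚ.<-irrefl ≡.refl (begin-strict
      seq x n                   ≡⟨ ℚ.+-identityʳ (seq x n) ⟨
      seq x n ℚ.+ 0ℚ            <⟨ ℚ.+-monoʳ-< (seq x n) (ℚ.+-mono-< g>0 h>0) ⟩
      seq x n ℚ.+ (g ℚ.+ h)     ≡⟨ ℚ.+-assoc (seq x n) g h ⟨
      (seq x n ℚ.+ g) ℚ.+ h     ≤⟨ ℚ.+-monoˡ-≤ h (x<y n (ℕ.m≤m⊔n N M)) ⟩
      seq y n ℚ.+ h             ≤⟨ y<x n (ℕ.m≤n⊔m N M) ⟩
      seq x n                   ∎)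
    where
    open ℚ.≤-Reasoning
    n = N ℕ.⊔ M

  *-positive : ∀ x y → 0ℝ < x → 0ℝ < y → 0ℝ < x * y
  *-positive x y (mk< g g>0 N g≤x) (mk< h h>0 M h≤y) = mk< (g ℚ.* h) (scale>0 g h>0) (N ℕ.⊔ M) λ n N⊔M≤n →
    let h≤y′ = ≡.subst (ℚ._≤ seq y n) (ℚ.+-identityˡ h) (h≤y n (ℕ.≤-trans (ℕ.m≤n⊔m N M) N⊔M≤n))
        g≤x′ = ≡.subst (ℚ._≤ seq x n) (ℚ.+-identityˡ g) (g≤x n (ℕ.≤-trans (ℕ.m≤m⊔n N M) N⊔M≤n))
    in ≡.subst (ℚ._≤ seq x n ℚ.* seq y n) (≡.sym (ℚ.+-identityˡ (g ℚ.* h)))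
         (*-mono-≤-bound (ℚ.<⇒≤ g>0) g≤x′ h≤y′ (ℚ.≤-trans (ℚ.<⇒≤ h>0) h≤y′))
    where
    instance
      g-pos : ℚ.Positive g
      g-pos = ℚ.positive g>0

  -- Non-negative reals may have slightly negative terms. At each index the sign of the rational `a`
  -- is decided, and then `- (a * b)` is at most a bounded factor times a small one.
  *-nonNeg : ∀ x y → 0ℝ ≤ x → 0ℝ ≤ y → 0ℝ ≤ x * y
  *-nonNeg x y 0≤x 0≤y = ≤ᵉ⇒≤ 0ℝ (x * y) λ ε ε>0 →
    let B , B>0 , N₁ , x≤B = eventually-bounded x
        C , C>0 , N₂ , y≤C = eventually-bounded y
        γ , γ>0 , Bγ≡ε = divide B>0 ε>0
        δ , δ>0 , Cδ≡ε = divide C>0 ε>0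
        N₃ , -γ≤y = ≤⇒≤ᵉ 0ℝ y 0≤y γ γ>0
        N₄ , -δ≤x = ≤⇒≤ᵉ 0ℝ x 0≤x δ δ>0
        K₁ = N₁ ℕ.⊔ N₂
        K₂ = N₃ ℕ.⊔ N₄
    in K₁ ℕ.⊔ K₂ , λ n K≤n →
      let K₁≤n = ℕ.≤-trans (ℕ.m≤m⊔n K₁ K₂) K≤n
          K₂≤n = ℕ.≤-trans (ℕ.m≤n⊔m K₁ K₂) K≤n
          a = seq x n
          b = seq y n
          -b≤γ = negate b (-γ≤y n (ℕ.≤-trans (ℕ.m≤m⊔n N₃ N₄) K₂≤n))
          -a≤δ = negate a (-δ≤x n (ℕ.≤-trans (ℕ.m≤n⊔m N₃ N₄) K₂≤n))
          a≤B = ℚ.≤-trans (p≤∣p∣ a) (x≤B n (ℕ.≤-trans (ℕ.m≤m⊔n N₁ N₂) K₁≤n))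
          b≤C = ℚ.≤-trans (p≤∣p∣ b) (y≤C n (ℕ.≤-trans (ℕ.m≤n⊔m N₁ N₂) K₁≤n))
      in unnegate (a ℚ.* b) (product-bound a b ε B γ C δ Bγ≡ε Cδ≡ε γ>0 C>0 -b≤γ -a≤δ a≤B b≤C)
    where
    open ℚ.≤-Reasoning
    negate : ∀ p {ε} → 0ℚ ℚ.≤ p ℚ.+ ε → ℚ.- p ℚ.≤ ε
    negate p {ε} h = ≡.subst₂ ℚ._≤_ (ℚ.+-identityʳ (ℚ.- p)) (cancelˡ p ε) (ℚ.+-monoʳ-≤ (ℚ.- p) h)
    unnegate : ∀ p {ε} → ℚ.- p ℚ.≤ ε → 0ℚ ℚ.≤ p ℚ.+ ε
    unnegate p {ε} h = ≡.subst (ℚ._≤ p ℚ.+ ε) (ℚ.+-inverseʳ p) (ℚ.+-monoʳ-≤ p h)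
    product-bound : ∀ a b ε B γ C δ → B ℚ.* γ ≡ ε → C ℚ.* δ ≡ ε → 0ℚ ℚ.< γ → 0ℚ ℚ.< C →
      ℚ.- b ℚ.≤ γ → ℚ.- a ℚ.≤ δ → a ℚ.≤ B → b ℚ.≤ C → ℚ.- (a ℚ.* b) ℚ.≤ ε
    product-bound a b ε B γ C δ Bγ≡ε Cδ≡ε γ>0 C>0 -b≤γ -a≤δ a≤B b≤C with ℚ.≤-total 0ℚ a
    ... | inj₁ 0≤a = begin
      ℚ.- (a ℚ.* b)       ≡⟨ ℚ.neg-distribʳ-* a b ⟩
      a ℚ.* ℚ.- b         ≤⟨ *-mono-≤-bound 0≤a a≤B -b≤γ (ℚ.<⇒≤ γ>0) ⟩
      B ℚ.* γ             ≡⟨ Bγ≡ε ⟩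
      ε                   ∎
    ... | inj₂ a≤0 = begin
      ℚ.- (a ℚ.* b)       ≡⟨ ℚ.neg-distribˡ-* a b ⟩
      ℚ.- a ℚ.* b         ≤⟨ *-mono-≤-bound (ℚ.neg-antimono-≤ a≤0) -a≤δ b≤C (ℚ.<⇒≤ C>0) ⟩
      δ ℚ.* C             ≡⟨ ≡.trans (ℚ.*-comm δ C) Cδ≡ε ⟩
      ε                   ∎

  open Algebra.Properties.Semiring.Mult (CommutativeRing.semiring ℝ-commutativeRing)
    using () renaming (_×_ to _·_)

  seq-ι : ∀ k n → seq (k · 1ℝ) n ≡ embed k
  seq-ι zero    n = ≡.refl
  seq-ι (suc k) n = ≡.cong (1ℚ ℚ.+_) (seq-ι k n)

  -- If `y` were eventually at least `g > 0` and `B` bounds `x`, a natural above `(B + 1) / g` would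
  -- carry its multiple of `y` to at least `x + 1`.
  archimedean : ∀ x y → (∀ k → (k · 1ℝ) * y ≤ x) → y ≤ 0ℝ
  archimedean x y multiples≤x (mk< g g>0 N g≤y) =
    let B , B>0 , M , x≤B = eventually-bounded x
        δ , δ>0 , gδ≡ = divide g>0 (ℚ.+-mono-< B>0 (ℚ.positive⁻¹ 1ℚ))
        k , δ≤k = ≤embed δ
        δ≥0 = ℚ.<⇒≤ δ>0
    in multiples≤x k (mk< 1ℚ (ℚ.positive⁻¹ 1ℚ) (N ℕ.⊔ M) λ n N⊔M≤n →
      let g≤yₙ = ≡.subst (ℚ._≤ seq y n) (ℚ.+-identityˡ g) (g≤y n (ℕ.≤-trans (ℕ.m≤m⊔n N M) N⊔M≤n))
      in begin
        seq x n ℚ.+ 1ℚ                        ≤⟨ ℚ.+-monoˡ-≤ 1ℚ (ℚ.≤-trans (p≤∣p∣ (seq x n)) (x≤B n (ℕ.≤-trans (ℕ.m≤n⊔m N M) N⊔M≤n))) ⟩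
        B ℚ.+ 1ℚ                              ≡⟨ gδ≡ ⟨
        g ℚ.* δ                               ≡⟨ ℚ.*-comm g δ ⟩
        δ ℚ.* g                               ≤⟨ *-mono-≤-bound δ≥0 δ≤k g≤yₙ (ℚ.≤-trans (ℚ.<⇒≤ g>0) g≤yₙ) ⟩
        embed k ℚ.* seq y n                   ≡⟨ ≡.cong (ℚ._* seq y n) (seq-ι k n) ⟨
        seq (k · 1ℝ) n ℚ.* seq y n           ∎)
    where open ℚ.≤-Reasoning

  -- A refuted `x ≤ 0ℝ` is only a double negation of `0ℝ < x`. This is enough, because each
  -- conclusion drawn from it is itself a negation.
  ℝ-isArchimedean : IsArchimedean ℝ-commutativeRing _≤_
  ℝ-isArchimedean = record
    { ≤-reflexive = proj₁
    ; ≤-trans     = λ {x} {y} {z} → ≤-trans x y z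
    ; ≤-antisym   = _,_
    ; ≤-total     = λ {x} {y} x≰y x<y → x≰y (<⇒≤ x y x<y)
    ; ≤-stable    = λ ¬¬x≤y y<x → ¬¬x≤y λ x≤y → x≤y y<x
    ; +-monoʳ-≤   = λ z {x} {y} → +-monoʳ-≤ z x y
    ; *-nonNeg    = λ {x} {y} → *-nonNeg x y
    ; *-cancel-≤0 = λ {x} {y} x≰0 xy≤0 0<y → x≰0 λ 0<x → xy≤0 (*-positive x y 0<x 0<y)
    ; 1≰0         = λ 1≤0 → 1≤0 (mk< 1ℚ (ℚ.positive⁻¹ 1ℚ) 0 λ _ _ → ℚ.≤-reflexive (ℚ.+-identityˡ 1ℚ))
    ; archimedean = λ {x} {y} → archimedean x y
    }

-- Square roots of naturals and the rational constants.

module SquareRoot where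
  open RationalOrder
  open Reals
  open OrderedRing ℝ-isArchimedean using (ι)

  -- Uses `k ≤ k²`, that is √k ≤ k. So crude a bound suffices for the error term of `isqrt-lower`.
  m²≤k*s²⇒m≤k*s : ∀ m k s → m ℕ.* m ℕ.≤ k ℕ.* (s ℕ.* s) → m ℕ.≤ k ℕ.* s
  m²≤k*s²⇒m≤k*s m k s m²≤ = ℕ.≮⇒≥ λ ks<m → ℕ.<⇒≱ (ℕ.*-mono-< ks<m ks<m) (begin
    m ℕ.* m                           ≤⟨ m²≤ ⟩
    k ℕ.* (s ℕ.* s)                   ≤⟨ ℕ.*-monoˡ-≤ (s ℕ.* s) (k≤k² k) ⟩
    k ℕ.* k ℕ.* (s ℕ.* s)             ≡⟨ solve 2 (λ k s → k :* k :* (s :* s) := k :* s :* (k :* s)) ≡.refl k s ⟩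
    k ℕ.* s ℕ.* (k ℕ.* s)             ∎)
    where
    open ℕ.≤-Reasoning
    open ℕ-Solver.+-*-Solver
    k≤k² : ∀ k → k ℕ.≤ k ℕ.* k
    k≤k² zero    = ℕ.z≤n
    k≤k² (suc k) = ℕ.m≤m*n (suc k) (suc k)

  -- From `k s² < (a + 1)²` with `a ≤ k s` and `1 ≤ s`. After division by `s²`, the square of the
  -- approximation falls short of `k` by at most `(2 k + 1) / s`.
  isqrt-lower : ∀ k s .{{_ : ℕ.NonZero s}} → let a = isqrt (k ℕ.* (s ℕ.* s)) in
                k ℕ.* (s ℕ.* s) ℕ.≤ a ℕ.* a ℕ.+ (2 ℕ.* k ℕ.+ 1) ℕ.* s
  isqrt-lower k s = begin
    k ℕ.* (s ℕ.* s)                               ≤⟨ ℕ.<⇒≤ (proj₂ (isqrt-spec (k ℕ.* (s ℕ.* s)))) ⟩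
    suc a ℕ.* suc a                               ≡⟨ solve 1 (λ a → (con 1 :+ a) :* (con 1 :+ a) := a :* a :+ (con 2 :* a :+ con 1)) ≡.refl a ⟩
    a ℕ.* a ℕ.+ (2 ℕ.* a ℕ.+ 1)                   ≤⟨ ℕ.+-monoʳ-≤ (a ℕ.* a) (ℕ.+-mono-≤ (ℕ.*-monoʳ-≤ 2 a≤ks) (ℕ.>-nonZero⁻¹ s)) ⟩
    a ℕ.* a ℕ.+ (2 ℕ.* (k ℕ.* s) ℕ.+ s)           ≡⟨ solve 3 (λ a k s → a :* a :+ (con 2 :* (k :* s) :+ s) := a :* a :+ (con 2 :* k :+ con 1) :* s) ≡.refl a k s ⟩
    a ℕ.* a ℕ.+ (2 ℕ.* k ℕ.+ 1) ℕ.* s             ∎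
    where
    open ℕ.≤-Reasoning
    open ℕ-Solver.+-*-Solver
    a = isqrt (k ℕ.* (s ℕ.* s))
    a≤ks = m²≤k*s²⇒m≤k*s a k s (proj₁ (isqrt-spec (k ℕ.* (s ℕ.* s))))

  √-seq-lower : ∀ k n → embed k ℚ.≤ √-seq k n ℚ.* √-seq k n ℚ.+ (+ (2 ℕ.* k ℕ.+ 1) ℚ./ suc n)
  √-seq-lower k n = ≡.subst (ℚ._≤ √-seq k n ℚ.* √-seq k n ℚ.+ (+ C ℚ./ s)) (≡.sym (embed≡/1 k)) (ℚ.toℚᵘ-cancel-≤ (begin
    ℚ.toℚᵘ (+ k ℚ./ 1)
      ≃⟨ ℚ.toℚᵘ-fromℚᵘ (ℚᵘ.mkℚᵘ (+ k) 0) ⟩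
    ℚᵘ.mkℚᵘ (+ k) 0
      ≤⟨ ℚᵘ.*≤* cross ⟩
    aᵘ ℚᵘ.* aᵘ ℚᵘ.+ Cᵘ
      ≃⟨ ℚᵘ.+-cong (ℚᵘ.*-cong (ℚ.toℚᵘ-fromℚᵘ aᵘ) (ℚ.toℚᵘ-fromℚᵘ aᵘ)) (ℚ.toℚᵘ-fromℚᵘ Cᵘ) ⟨
    ℚ.toℚᵘ (√-seq k n) ℚᵘ.* ℚ.toℚᵘ (√-seq k n) ℚᵘ.+ ℚ.toℚᵘ (+ C ℚ./ s)
      ≃⟨ ℚᵘ.+-congˡ (ℚ.toℚᵘ (+ C ℚ./ s)) (ℚ.toℚᵘ-homo-* (√-seq k n) (√-seq k n)) ⟨
    ℚ.toℚᵘ (√-seq k n ℚ.* √-seq k n) ℚᵘ.+ ℚ.toℚᵘ (+ C ℚ./ s)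
      ≃⟨ ℚ.toℚᵘ-homo-+ (√-seq k n ℚ.* √-seq k n) (+ C ℚ./ s) ⟨
    ℚ.toℚᵘ (√-seq k n ℚ.* √-seq k n ℚ.+ (+ C ℚ./ s)) ∎))
    where
    open ℚᵘ.≤-Reasoning
    s = suc n
    C = 2 ℕ.* k ℕ.+ 1
    a = isqrt (k ℕ.* (s ℕ.* s))
    aᵘ = ℚᵘ.mkℚᵘ (+ a) n
    Cᵘ = ℚᵘ.mkℚᵘ (+ C) n
    cross-ℕ : k ℕ.* (s ℕ.* s ℕ.* s) ℕ.≤ a ℕ.* a ℕ.* s ℕ.+ C ℕ.* (s ℕ.* s)
    cross-ℕ = ℕ.≤-trans (ℕ.≤-reflexive (≡.sym (ℕ.*-assoc k (s ℕ.* s) s)))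
      (ℕ.≤-trans (ℕ.*-monoˡ-≤ s (isqrt-lower k s)) (ℕ.≤-reflexive
        (solve 3 (λ a C s → (a :* a :+ C :* s) :* s := a :* a :* s :+ C :* (s :* s)) ≡.refl a C s)))
      where open ℕ-Solver.+-*-Solver
    cross : + k ℤ.* + (s ℕ.* s ℕ.* s) ℤ.≤ (+ a ℤ.* + a ℤ.* + s ℤ.+ + C ℤ.* + (s ℕ.* s)) ℤ.* + 1
    cross = ≡.subst₂ ℤ._≤_ (ℤ.pos-* k (s ℕ.* s ℕ.* s))
      (≡.trans (≡.cong₂ ℤ._+_
          (≡.trans (ℤ.pos-* (a ℕ.* a) s) (≡.cong (ℤ._* + s) (ℤ.pos-* a a)))
          (ℤ.pos-* C (s ℕ.* s)))
        (≡.sym (ℤ.*-identityʳ _)))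
      (ℤ.+≤+ cross-ℕ)

  fraction-small : ∀ C ε → 0ℚ ℚ.< ε → ∃ λ N → ∀ n → N ℕ.≤ n → (+ C ℚ./ suc n) ℚ.≤ ε
  fraction-small C (mkℚ +0       d _) (ℚ.*<* (ℤ.+<+ ()))
  fraction-small C (mkℚ -[1+ e ] d _) (ℚ.*<* ())
  fraction-small C ε@(mkℚ +[1+ e ] d _) _ = C ℕ.* suc d , λ n N≤n → ℚ.toℚᵘ-cancel-≤ (begin
      ℚ.toℚᵘ (+ C ℚ./ suc n)   ≃⟨ ℚ.toℚᵘ-fromℚᵘ (ℚᵘ.mkℚᵘ (+ C) n) ⟩
      ℚᵘ.mkℚᵘ (+ C) n          ≤⟨ ℚᵘ.*≤* (≡.subst (ℤ._≤ + (suc e ℕ.* suc n)) (ℤ.pos-* C (suc d))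
                                    (ℤ.+≤+ (ℕ.≤-trans N≤n (ℕ.≤-trans (ℕ.n≤1+n n) (ℕ.m≤n*m (suc n) (suc e)))))) ⟩
      ℚᵘ.mkℚᵘ +[1+ e ] d       ∎)
    where open ℚᵘ.≤-Reasoning

  -- The shortfall `(2 k + 1) / (n + 1)` of the squared approximations tends to zero.
  ι≤√*√ : ∀ k → ι k ≤ √ k * √ k
  ι≤√*√ k = ≤ᵉ⇒≤ (ι k) (√ k * √ k) λ ε ε>0 →
    let N , small = fraction-small (2 ℕ.* k ℕ.+ 1) ε ε>0
    in N , λ n N≤n → ≡.subst (ℚ._≤ √-seq k n ℚ.* √-seq k n ℚ.+ ε) (≡.sym (seq-ι k n))
      (ℚ.≤-trans (√-seq-lower k n) (ℚ.+-monoʳ-≤ (√-seq k n ℚ.* √-seq k n) (small n N≤n)))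

  /-nonNeg : ∀ a n → 0ℚ ℚ.≤ + a ℚ./ suc n
  /-nonNeg a n = ℚ.toℚᵘ-cancel-≤ (ℚᵘ.≤-respʳ-≃ (ℚᵘ.≃-sym (ℚ.toℚᵘ-fromℚᵘ (ℚᵘ.mkℚᵘ (+ a) n)))
    (ℚᵘ.nonNegative⁻¹ (ℚᵘ.mkℚᵘ (+ a) n)))

  0≤√ : ∀ k → 0ℝ ≤ √ k
  0≤√ k = pointwise-≤ 0ℝ (√ k) λ n → /-nonNeg (isqrt (k ℕ.* (suc n ℕ.* suc n))) n

  ι≈fromℕ : ∀ k → ι k ≈ fromℕ k
  ι≈fromℕ k = pointwise-≈ (ι k) (fromℕ k) λ n → ≡.trans (seq-ι k n) (embed≡/1 k)

  ½+½≈1 : fromℚ ½ + fromℚ ½ ≈ 1ℝ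
  ½+½≈1 = pointwise-≈ (fromℚ ½ + fromℚ ½) 1ℝ λ _ → ≡.refl

  1/suc-inverse : ∀ d → (1ℝ + fromℕ d) * fromℚ (+ 1 ℚ./ suc d) ≈ 1ℝ
  1/suc-inverse d = pointwise-≈ ((1ℝ + fromℕ d) * fromℚ (+ 1 ℚ./ suc d)) 1ℝ λ _ → ≡.trans
    (≡.cong (ℚ._* (+ 1 ℚ./ suc d)) (≡.trans (≡.cong (1ℚ ℚ.+_) (≡.sym (embed≡/1 d))) (embed≡/1 (suc d))))
    (ℚ.toℚᵘ-injective (begin
      ℚ.toℚᵘ ((+ suc d ℚ./ 1) ℚ.* (+ 1 ℚ./ suc d))            ≈⟨ ℚ.toℚᵘ-homo-* (+ suc d ℚ./ 1) (+ 1 ℚ./ suc d) ⟩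
      ℚ.toℚᵘ (+ suc d ℚ./ 1) ℚᵘ.* ℚ.toℚᵘ (+ 1 ℚ./ suc d)      ≈⟨ ℚᵘ.*-cong (ℚ.toℚᵘ-fromℚᵘ (ℚᵘ.mkℚᵘ (+ suc d) 0)) (ℚ.toℚᵘ-fromℚᵘ (ℚᵘ.mkℚᵘ (+ 1) d)) ⟩
      ℚᵘ.mkℚᵘ (+ suc d) 0 ℚᵘ.* ℚᵘ.mkℚᵘ (+ 1) d                ≈⟨ ℚᵘ.*≡* (≡.cong +_ (solve 1 (λ d → (con 1 :+ d) :* con 1 :* con 1 := con 1 :* (con 1 :* (con 1 :+ d))) ≡.refl d)) ⟩
      ℚ.toℚᵘ 1ℚ                                               ∎))
    where
    open import Relation.Binary.Reasoning.Setoid ℚᵘ.≃-setoid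
    open ℕ-Solver.+-*-Solver

-- The matrix `Aα`: symmetry, entry bounds and its spectrum.

module AlphaMatrix where
  open Reals
  open SquareRoot
  open CommutativeRing ℝ-commutativeRing using (sym; trans; reflexive; *-identityʳ; zeroʳ)
  open OrderedRing ℝ-isArchimedean
    using (ι; 0≤ι; ι-mono-≤; ≤-reflexive; *-monoˡ-≤; twice-half; entry-bounds)
  open Determinant ℝ-commutativeRing
  open CharacteristicPolynomial ℝ-commutativeRing
  open EigenvalueSums ℝ-isArchimedean

  diag≈ : ∀ {n} x (i j : Fin n) → diag (λ _ → x) i j ≈ x * δ i j
  diag≈ x i j with i Fin.≟ j
  ... | yes ≡.refl = sym {x * δ i i} {x} (trans {x * δ i i} {x * 1ℝ} {x} (*-congˡ x (δ i i) 1ℝ (δ-diagonal i)) (*-identityʳ x))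
    where
    δ-diagonal : ∀ {n} (i : Fin n) → δ i i ≈ 1ℝ
    δ-diagonal zero    = ≈-refl 1ℝ
    δ-diagonal (suc i) = δ-diagonal i
  ... | no i≢j = sym {x * δ i j} {0ℝ} (trans {x * δ i j} {x * 0ℝ} {0ℝ} (*-congˡ x (δ i j) 0ℝ (δ-≢ i≢j)) (zeroʳ x))

  diag-symmetric : ∀ {n} (v : Vector ℝ n) i j → diag v i j ≡ diag v j i
  diag-symmetric v i j with i Fin.≟ j | j Fin.≟ i
  ... | yes ≡.refl | yes _      = ≡.refl
  ... | yes ≡.refl | no i≢i     = contradiction ≡.refl i≢i
  ... | no i≢i     | yes ≡.refl = contradiction ≡.refl i≢i
  ... | no _       | no _       = ≡.refl

  entry-cong : ∀ α {x y a b} → x ≡ y → a ≡ b →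
    α * x + (1ℝ - α) * (if a then 1ℝ else 0ℝ) ≈ α * y + (1ℝ - α) * (if b then 1ℝ else 0ℝ)
  entry-cong α {x} {a = a} ≡.refl ≡.refl = ≈-refl (α * x + (1ℝ - α) * (if a then 1ℝ else 0ℝ))

  -- The two notions differ by `diag` against `δ`, and by the opaque `Det` and `∏` against their
  -- definitions.
  IsSpectrum⇒HasRoots : ∀ {n} {M : Matrix ℝ n} {μ} → IsSpectrum M μ → HasRoots M μ
  IsSpectrum⇒HasRoots {n} {M} {μ} spec x = ≈-trans (χ M x) (charPoly M x) (∏ λ i → x - μ i)
    (≈-trans (χ M x) (Det N) (charPoly M x)
      (det-cong λ i j → +-cong (x * δ i j) (diag (λ _ → x) i j) (- M i j) (- M i j)
        (sym {diag (λ _ → x) i j} {x * δ i j} (diag≈ x i j)) (≈-refl (- M i j)))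
      (reflexive {Det N} {charPoly M x} (Det-def N)))
    (≈-trans (charPoly M x) (Π[ (λ i → x - μ i) ]) (∏ λ i → x - μ i)
      (IsSpectrum.roots spec x)
      (reflexive {Π[ (λ i → x - μ i) ]} {∏ λ i → x - μ i} (≡.sym (∏-def (λ i → x - μ i)))))
    where
    N : Matrix ℝ n
    N i j = diag (λ _ → x) i j - M i j

  module _ {n} (G : Graph n) where

    degree≤maxDegree : ∀ i → degree G i ℕ.≤ maxDegree G
    degree≤maxDegree = ≤foldr (degree G)
      where
      ≤foldr : ∀ {m} (f : Vector ℕ m) i → f i ℕ.≤ foldr ℕ._⊔_ 0 f
      ≤foldr f zero    = ℕ.m≤m⊔n (f zero) _
      ≤foldr f (suc i) = ℕ.≤-trans (≤foldr (f ∘ suc) i) (ℕ.m≤n⊔m (f zero) _)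

    Aα-symmetric : ∀ α → IsSymmetric (Aα G α)
    Aα-symmetric α i j = entry-cong α {D G i j} {D G j i} {adj G i j} {adj G j i} (diag-symmetric (λ i → fromℕ (degree G i)) i j) (symm G i j)

    fromℕ-degree≤ : ∀ i → fromℕ (degree G i) ≤ fromℕ (maxDegree G)
    fromℕ-degree≤ i = ≤-trans (fromℕ d) (ι d) (fromℕ Δ) (proj₂ (ι≈fromℕ d))
      (≤-trans (ι d) (ι Δ) (fromℕ Δ) (ι-mono-≤ (degree≤maxDegree i)) (proj₁ (ι≈fromℕ Δ)))
      where
      d = degree G i
      Δ = maxDegree G

  0≤fromℕ : ∀ k → 0ℝ ≤ fromℕ k
  0≤fromℕ k = ≤-trans 0ℝ (ι k) (fromℕ k) (0≤ι k) (proj₁ (ι≈fromℕ k))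

  entry-bounds-ℝ : ∀ α d c → 0ℝ ≤ α → 0ℝ ≤ 1ℝ - α → 0ℝ ≤ d → α * d ≤ c → 1ℝ - α ≤ c →
    ∀ a b → (a ≡ true → b ≡ false) →
    (0ℝ ≤ α * (if a then d else 0ℝ) + (1ℝ - α) * (if b then 1ℝ else 0ℝ)) ×
    (α * (if a then d else 0ℝ) + (1ℝ - α) * (if b then 1ℝ else 0ℝ) ≤ c)
  entry-bounds-ℝ α d c 0≤α 0≤1-α 0≤d αd≤c 1-α≤c = entry-bounds {α} {d} {c} 0≤α 0≤1-α 0≤d αd≤c 1-α≤c

  no-loop : ∀ {n} (G : Graph n) i j → ⌊ i Fin.≟ j ⌋ ≡ true → adj G i j ≡ false
  no-loop G i j _ with yes ≡.refl ← i Fin.≟ j = irrefl G i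

  α*degree≤ : ∀ {n} (G : Graph n) α c → 0ℝ ≤ α → α * fromℕ (maxDegree G) ≤ c → ∀ i → α * fromℕ (degree G i) ≤ c
  α*degree≤ G α c 0≤α αΔ≤c i = ≤-trans (α * d) (α * Δ) c (*-monoˡ-≤ {α} {d} {Δ} 0≤α (fromℕ-degree≤ G i)) αΔ≤c
    where
    d = fromℕ (degree G i)
    Δ = fromℕ (maxDegree G)

  Aα-bounds : ∀ {n} (G : Graph n) α c → 0ℝ ≤ α → 0ℝ ≤ 1ℝ - α →
    α * fromℕ (maxDegree G) ≤ c → 1ℝ - α ≤ c → ∀ i j → (0ℝ ≤ Aα G α i j) × (Aα G α i j ≤ c)
  Aα-bounds G α c 0≤α 0≤1-α αΔ≤c 1-α≤c i j =
    entry-bounds-ℝ α (fromℕ (degree G i)) c 0≤α 0≤1-α (0≤fromℕ (degree G i)) (α*degree≤ G α c 0≤α αΔ≤c i) 1-α≤c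
      ⌊ i Fin.≟ j ⌋ (adj G i j) (no-loop G i j)

  sum-of-largest-eigenvalues : ∀ {n} (M : Matrix ℝ n) c μ → IsSymmetric M →
    (∀ i j → (0ℝ ≤ M i j) × (M i j ≤ c)) → IsSpectrum M μ →
    ∀ k → 2 ℕ.≤ k → (k≤n : k ℕ.≤ n) → S μ k k≤n ≤ c * fromℕ n * fromℚ ½ * (1ℝ + √ k)
  sum-of-largest-eigenvalues {zero} M c μ sym-M bounds spec (suc k) 2≤k ()
  sum-of-largest-eigenvalues {suc n-1} M c μ sym-M bounds spec (suc k-1) 2≤k k≤n =
    ≤-trans (S μ k k≤n) (∑ top) (h * (1ℝ + √ k))
      (≤-reflexive {S μ k k≤n} {∑ top} (reflexive {S μ k k≤n} {∑ top} (≡.sym (∑-def top))))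
      (sum-of-largest-roots {n-1} {M} {μ} {c} {h} {√ k} sym-M (λ i j → proj₁ (bounds i j)) (λ i j → proj₂ (bounds i j))
        -- The ordering of the spectrum enters through its first entry, the bound for the Rayleigh
        -- inequality.
        (IsSpectrum⇒HasRoots {n} {M} {μ} spec) (λ i → IsSpectrum.ordered spec zero i ℕ.z≤n)
        (trans {(1ℝ + 1ℝ) * h} {c * fromℕ n} {c * ι n} (twice-half {fromℚ ½} ½+½≈1 c (fromℕ n))
          (*-congˡ c (fromℕ n) (ι n) (sym {ι n} {fromℕ n} (ι≈fromℕ n))))
        (0≤√ k) k-1 (ι≤√*√ k) k≤n)
    where
    n = suc n-1
    k = suc k-1
    h = c * fromℕ n * fromℚ ½
    top : Vector ℝ k
    top i = μ (Fin.inject≤ i k≤n)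

open Reals
open SquareRoot
open AlphaMatrix

theorem3p1 : ∀ {n : ℕ} (G : Graph n) → ¬ IsComplete G →
    (α : ℝ) (μ : Vector ℝ n) → IsSpectrum (Aα G α) μ →
    let Δ = maxDegree G in
    (0ℝ ≤ α → α < fromℚ (+ 1 ℚ./ suc Δ) →
    ∀ k → 2 ℕ.≤ k → (k≤n : k ℕ.≤ n) →
    S μ k k≤n ≤ (1ℝ - α) * fromℕ n * fromℚ ½ * (1ℝ + √ k))
    ×
    (fromℚ (+ 1 ℚ./ suc Δ) ≤ α → α < 1ℝ →
    ∀ k → 2 ℕ.≤ k → (k≤n : k ℕ.≤ n) →
    S μ k k≤n ≤ α * fromℕ Δ * fromℕ n * fromℚ ½ * (1ℝ + √ k))
theorem3p1 G _ α μ spec =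
  (λ 0≤α α<w →
    let αΔ≤1-α = ≤-inverse⇒ {fromℕ Δ} {w} (0≤fromℕ Δ) (1/suc-inverse Δ) {α} (<⇒≤ α w α<w)
        -- Below the threshold `1ℝ - α` is non-negative because it dominates `α * fromℕ Δ`.
        0≤1-α = ≤-trans 0ℝ (α * fromℕ Δ) (1ℝ - α) (*-nonNeg α (fromℕ Δ) 0≤α (0≤fromℕ Δ)) αΔ≤1-α
    in sum-of-largest-eigenvalues (Aα G α) (1ℝ - α) μ (Aα-symmetric G α)
        (Aα-bounds G α (1ℝ - α) 0≤α 0≤1-α αΔ≤1-α (proj₁ (≈-refl (1ℝ - α)))) spec) ,
  (λ w≤α α<1 →
    -- Above the threshold the sign of `α` comes from the lower bound `w`.
    let 0≤α = ≤-trans 0ℝ w α (pointwise-≤ 0ℝ w λ _ → /-nonNeg 1 Δ) w≤α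
        1-α≤αΔ = inverse-≤⇒ {fromℕ Δ} {w} (0≤fromℕ Δ) (1/suc-inverse Δ) {α} w≤α
        0≤1-α = ≤⇒0≤- {α} {1ℝ} (<⇒≤ α 1ℝ α<1)
    in sum-of-largest-eigenvalues (Aα G α) (α * fromℕ Δ) μ (Aα-symmetric G α)
        (Aα-bounds G α (α * fromℕ Δ) 0≤α 0≤1-α (proj₁ (≈-refl (α * fromℕ Δ))) 1-α≤αΔ) spec)
  where
  Δ = maxDegree G
  w = fromℚ (+ 1 ℚ./ suc Δ)
  open OrderedRing ℝ-isArchimedean using (≤⇒0≤-; ≤-inverse⇒; inverse-≤⇒)
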